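{- Let $n\ge 1$. (1) The map which sends a necklace $(M_1,\ldots,M_n)$ of order $n$ to the sequence $$(\Pi_0(M_1,M_1),\Pi_0(M_1,M_2),\ldots,\Pi_0(M_1,M_n))$$ is a bijection between the set of necklaces of order $n$ and the set of maximal chains of $2$-divisible noncrossing partitions on $\langle 0,2n-1\rangle$. (2) Every necklace (of order $n$) is a strong necklace.
   Context: **Matchings and partitions.** $\langle 0,2n-1\rangle=\{0,1,\ldots,2n-1\}$. A matching on a set of size $2n$ is a partition of it into $n$ subsets of size $2$ (pairs). Two blocks of a partition of a subset of $\mathbb{R}$ cross if there are elements $i<j<k<\ell$ with $i,k$ in one block and $j,\ell$ in the other; a partition is noncrossing if no two of its blocks cross. $M'$ is a flip of $M$ if $M'$ is obtained from $M$ by replacing two pairs $\{i,j\},\{k,\ell\}$ of $M$ by $\{i,\ell\},\{j,k\}$. For real $\epsilon$, $M(\epsilon)$ is the matching in which $i+\epsilon,j+\epsilon$ are matched if and only if $i,j$ are matched in $M$ (addition modulo $2n$). **Necklaces.** A necklace of order $n$ is an $n$-tuple $(M_1,\ldots,M_n)$ of noncrossing matchings on $\langle 0,2n-1\rangle$ such that $M_{s+1}$ is a flip of $M_s$ for $1\le s<n$ and $M_n=M_1(-1)$. **Systems of meanders.** $\Pi_0(M,M')$ is the set of equivalence classes of the equivalence relation on $\langle 0,2n-1\rangle$ generated by $i\sim j$ for every $\{i,j\}\in M$ and for every $\{i,j\}\in M'$. **Strong necklaces.** A pair $\{i,j\}\in M$ is said to cross $\{i',j'\}\in M'$ if the blocks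 $\{i,j\}$ and $\{i'+\frac12,j'+\frac12\}$ of the matching $M\cup M'(\frac12)$ on $\{0,\frac12,1,\ldots,2n-\frac12\}$ cross. An ordered pair $(M,M')$ of noncrossing matchings on $\langle 0,2n-1\rangle$ is a basketball if $M\cup M'(\frac12)$ has exactly $n$ crossings (pairs of crossing blocks). A strong necklace of order $n$ is an $n$-tuple $(M_1,\ldots,M_n)$ of noncrossing matchings on $\langle 0,2n-1\rangle$ such that: (i) $(M_r,M_s)$ is a basketball for all $1\le r<s\le n$; (ii) if $r<s<t$ and $\{i_r,j_r\}\in M_r$ crosses both $\{i_s,j_s\}\in M_s$ and $\{i_t,j_t\}\in M_t$, then $\{i_s,j_s\}\in M_s$ crosses $\{i_t,j_t\}\in M_t$; (iii) $M_{r+1}\ne M_r$ for $1\le r<n$. **Chains.** A partition is $2$-divisible if every block has even cardinality. A maximal chain of $2$-divisible noncrossing partitions on $\langle 0,2n-1\rangle$ is a sequence $(P_1,\ldots,P_n)$ of $2$-divisible noncrossing partitions of $\langle 0,2n-1\rangle$ such that $P_i$ has $n+1-i$ blocks and $P_i$ is a refinement of $P_{i+1}$ for $1\le i<n$. -}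

module Defs where

open import Data.Bool.Properties using () renaming (_≟_ to _≟ᵇ_)
open import Data.Fin.Base using (Fin; zero; suc; toℕ; fromℕ<; combine; _<_)
open import Data.Fin.Properties using (_≟_; any?; _<?_)
open import Data.Fin.Subset using (Subset; ⁅_⁆; _∪_; _∩_; ∣_∣; Nonempty; Empty)
  renaming (_∈_ to _∈ˢ_; _⊆_ to _⊆ˢ_)
open import Data.Fin.Subset.Properties using (⊆-antisym; x∈p∩q⁻)
  renaming (_∈?_ to _∈ˢ?_)
open import Data.Integer.Base as ℤ using (ℤ; +_; -1ℤ)
open import Data.Integer.DivMod using (_%ℕ_; n%ℕd<d)
open import Data.List.Base
  using (List; []; _∷_; _++_; map; filter; length; deduplicate; allFin; cartesianProduct)
open import Data.List.Membership.Propositional using (_∈_; lose)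
open import Data.List.Membership.Propositional.Properties
  using (∈-map⁺; ∈-map⁻; ∈-deduplicate⁺; ∈-deduplicate⁻; ∈-filter⁺; ∈-filter⁻;
         ∈-allFin; ∈-cartesianProduct⁺)
import Data.List.Membership.DecPropositional as DecMembership
open import Data.List.Relation.Binary.BagAndSetEquality using (set; [_]-Equality)
open import Data.List.Relation.Unary.All as All using (All; []; _∷_)
open import Data.List.Relation.Unary.AllPairs using (AllPairs; []; _∷_)
open import Data.List.Relation.Unary.Any using (Any; here; there)
open import Data.List.Relation.Unary.Unique.Propositional using (Unique)
import Data.List.Relation.Unary.Unique.DecPropositional.Properties as DecUnique
open import Data.Nat.Base using (ℕ; NonZero; >-nonZero⁻¹)
  renaming (suc to 1+; _*_ to _*ⁿ_; _∸_ to _∸ⁿ_)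
open import Data.Nat.Divisibility using (_∣_)
open import Data.Nat.Properties using (m*n≢0)
open import Data.Product.Base using (∃-syntax; _×_; _,_; proj₁; proj₂; uncurry)
open import Data.Sum.Base using (_⊎_; inj₁; inj₂)
open import Data.Vec.Base using (tabulate)
open import Data.Vec.Functional.Relation.Binary.Equality.Setoid using (≋-setoid)
open import Data.Vec.Properties using (≡-dec; lookup∘tabulate; []=⇒lookup; lookup⇒[]=)
open import Function.Base using (_∘_)
open import Function.Bundles using (_⇔_)
open import Level using (0ℓ)
open import Relation.Binary.Bundles using (Setoid)
open import Relation.Binary.Construct.Closure.Equivalence as EqC using (EqClosure)
open import Relation.Binary.Construct.Closure.ReflexiveTransitive using (ε; _◅_; _◅◅_)
open import Relation.Binary.Construct.Closure.Symmetric using (fwd; bwd)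
import Relation.Binary.Construct.On as On
open import Relation.Binary.Core using (Rel)
open import Relation.Binary.Definitions using (DecidableEquality)
  renaming (Decidable to Decidable₂)
open import Relation.Binary.PropositionalEquality.Core using (_≡_; _≢_; refl; sym; trans)
open import Relation.Binary.Structures using (IsDecEquivalence)
open import Relation.Nullary.Decidable
  using (yes; no; does; dec-true; map′; _×-dec_; _⊎-dec_)
open import Relation.Nullary.Negation using (¬_)
open import Relation.Unary using (Pred; Decidable)

private
  variable
    n N K : ℕ

_≟ˢ_ : DecidableEquality (Subset N)
_≟ˢ_ = ≡-dec _≟ᵇ_

comprehension : {P : Pred (Fin N) 0ℓ} → Decidable P → Subset N
comprehension P? = tabulate (does ∘ P?)

module _ {P : Pred (Fin N) 0ℓ} (P? : Decidable P) where

  ∈-comprehension⁺ : ∀ {i} → P i → i ∈ˢ comprehension P?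
  ∈-comprehension⁺ {i} p =
    lookup⇒[]= i _ (trans (lookup∘tabulate (does ∘ P?) i) (dec-true (P? i) p))

  ∈-comprehension⁻ : ∀ {i} → i ∈ˢ comprehension P? → P i
  ∈-comprehension⁻ {i} i∈ with P? i | trans (sym (lookup∘tabulate (does ∘ P?) i)) ([]=⇒lookup i∈)
  ... | yes p | _  = p
  ... | no  _ | ()

⟅_,_⟆ : Fin N → Fin N → Subset N
⟅ i , j ⟆ = ⁅ i ⁆ ∪ ⁅ j ⁆

image : (Fin N → Fin K) → Subset N → Subset K
image f B = comprehension (λ y → any? (λ x → (x ∈ˢ? B) ×-dec (f x ≟ y)))

-- A partition of {0, …, N-1}.  Its set of blocks is a list, without
-- repetitions since the blocks are nonempty and disjoint; the order of the list
-- is forgotten by the equality `_≈ᴾ_`.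
record Partition (N : ℕ) : Set where
  field
    blocks   : List (Subset N)
    nonempty : All Nonempty blocks
    disjoint : AllPairs (λ B C → Empty (B ∩ C)) blocks
    cover    : ∀ i → Any (i ∈ˢ_) blocks

open Partition public

infix 4 _≈ᴾ_ _∋ᴾ_

_∋ᴾ_ : Partition N → Subset N → Set
P ∋ᴾ B = B ∈ blocks P

partitionSetoid : ℕ → Setoid 0ℓ 0ℓ
partitionSetoid N = On.setoid ([ set ]-Equality (Subset N)) (blocks {N})

_≈ᴾ_ : Rel (Partition N) 0ℓ
_≈ᴾ_ {N} = Setoid._≈_ (partitionSetoid N)

Refines : Rel (Partition N) 0ℓ
Refines P Q = ∀ {B} → P ∋ᴾ B → ∃[ C ] Q ∋ᴾ C × B ⊆ˢ C

Interleave : Rel (Subset N) 0ℓ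
Interleave B C = ∃[ i ] ∃[ j ] ∃[ k ] ∃[ l ]
  (i < j × j < k × k < l) × (i ∈ˢ B × k ∈ˢ B) × (j ∈ˢ C × l ∈ˢ C)

Cross : Rel (Subset N) 0ℓ
Cross B C = Interleave B C ⊎ Interleave C B

Noncrossing : Pred (Partition N) 0ℓ
Noncrossing P = ∀ {B C} → P ∋ᴾ B → P ∋ᴾ C → B ≢ C → ¬ Cross B C

TwoDivisible : Pred (Partition N) 0ℓ
TwoDivisible P = ∀ {B} → P ∋ᴾ B → 2 ∣ ∣ B ∣

module _ {_∼_ : Rel (Fin N) 0ℓ} (isDecEq : IsDecEquivalence _∼_) where

  private module E = IsDecEquivalence isDecEq

  class : Fin N → Subset N
  class i = comprehension (i E.≟_)

  private
    classList : List (Subset N)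
    classList = deduplicate _≟ˢ_ (map class (allFin N))

    class-cong : ∀ {i j} → i ∼ j → class i ≡ class j
    class-cong {i} {j} i∼j = ⊆-antisym
      (λ x∈ → ∈-comprehension⁺ (j E.≟_) (E.trans (E.sym i∼j) (∈-comprehension⁻ (i E.≟_) x∈)))
      (λ x∈ → ∈-comprehension⁺ (i E.≟_) (E.trans i∼j (∈-comprehension⁻ (j E.≟_) x∈)))

    IsClass : Pred (Subset N) 0ℓ
    IsClass B = ∃[ i ] B ≡ class i

    isClass : All IsClass classList
    isClass = All.tabulate λ B∈ →
      let i , _ , eq = ∈-map⁻ class (∈-deduplicate⁻ _≟ˢ_ (map class (allFin N)) B∈) in i , eq

    class-nonempty : ∀ {B} → IsClass B → Nonempty B
    class-nonempty (i , refl) = i , ∈-comprehension⁺ (i E.≟_) E.refl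

    class-disjoint : ∀ {B C} → IsClass B → IsClass C → B ≢ C → Empty (B ∩ C)
    class-disjoint {B} {C} (i , refl) (j , refl) B≢C (x , x∈) = B≢C
      (trans (class-cong (∈-comprehension⁻ (i E.≟_) (proj₁ (x∈p∩q⁻ B C x∈))))
        (sym (class-cong (∈-comprehension⁻ (j E.≟_) (proj₂ (x∈p∩q⁻ B C x∈))))))

    classes-disjoint : ∀ {Bs} → All IsClass Bs → Unique Bs → AllPairs (λ B C → Empty (B ∩ C)) Bs
    classes-disjoint []       []       = []
    classes-disjoint (c ∷ cs) (u ∷ us) =
      All.zipWith (uncurry (class-disjoint c)) (cs , u) ∷ classes-disjoint cs us

  classes : Partition N
  classes = record
    { blocks   = classList
    ; nonempty = All.map class-nonempty isClass
    ; disjoint = classes-disjoint isClass (DecUnique.deduplicate-! _≟ˢ_ _)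
    ; cover    = λ i → lose (∈-deduplicate⁺ _≟ˢ_ (∈-map⁺ class (∈-allFin i)))
                            (∈-comprehension⁺ (i E.≟_) E.refl)
    }

module _ {A : Set} (_≟ᴬ_ : DecidableEquality A) where

  private
    Edge : List (A × A) → Rel A 0ℓ
    Edge es x y = (x , y) ∈ es

    infix 4 _⊢_∼_
    _⊢_∼_ : List (A × A) → A → A → Set
    es ⊢ x ∼ y = EqClosure (Edge es) x y

    -- A path may use the edge {a, b} at most once, in either direction.
    Via : A → A → List (A × A) → A → A → Set
    Via a b es x y = es ⊢ x ∼ y ⊎ (es ⊢ x ∼ a × es ⊢ b ∼ y) ⊎ (es ⊢ x ∼ b × es ⊢ a ∼ y)

    prepend : ∀ {a b es x y z} → es ⊢ x ∼ y → Via a b es y z → Via a b es x z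
    prepend p (inj₁ q)              = inj₁ (p ◅◅ q)
    prepend p (inj₂ (inj₁ (q , r))) = inj₂ (inj₁ (p ◅◅ q , r))
    prepend p (inj₂ (inj₂ (q , r))) = inj₂ (inj₂ (p ◅◅ q , r))

    split : ∀ {a b es x y} → (a , b) ∷ es ⊢ x ∼ y → Via a b es x y
    split ε                       = inj₁ ε
    split (fwd (there e)   ◅ es) = prepend (fwd e ◅ ε) (split es)
    split (bwd (there e)   ◅ es) = prepend (bwd e ◅ ε) (split es)
    split (fwd (here refl) ◅ es) with split es
    ... | inj₁ p              = inj₂ (inj₁ (ε , p))
    ... | inj₂ (inj₁ (p , q)) = inj₁ (EqC.symmetric _ p ◅◅ q)
    ... | inj₂ (inj₂ (p , q)) = inj₁ q
    split (bwd (here refl) ◅ es) with split es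
    ... | inj₁ p              = inj₂ (inj₂ (ε , p))
    ... | inj₂ (inj₁ (p , q)) = inj₁ q
    ... | inj₂ (inj₂ (p , q)) = inj₁ (EqC.symmetric _ p ◅◅ q)

    unsplit : ∀ {a b es x y} → Via a b es x y → (a , b) ∷ es ⊢ x ∼ y
    unsplit (inj₁ p)              = EqC.map there p
    unsplit (inj₂ (inj₁ (p , q))) = EqC.map there p ◅◅ fwd (here refl) ◅ EqC.map there q
    unsplit (inj₂ (inj₂ (p , q))) = EqC.map there p ◅◅ bwd (here refl) ◅ EqC.map there q

    edges? : ∀ es → Decidable₂ (es ⊢_∼_)
    edges? []             x y =
      map′ (λ { refl → ε }) (λ { ε → refl ; (fwd () ◅ _) ; (bwd () ◅ _) }) (x ≟ᴬ y)
    edges? ((a , b) ∷ es) x y = map′ unsplit split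
      (edges? es x y ⊎-dec (edges? es x a ×-dec edges? es b y) ⊎-dec (edges? es x b ×-dec edges? es a y))

  eqClosure? : {R : Rel A 0ℓ} → Decidable₂ R → (xs : List A) → (∀ x → x ∈ xs) →
               Decidable₂ (EqClosure R)
  eqClosure? {R} R? xs total x y = map′
    (EqC.map (λ e → proj₂ (∈-filter⁻ (uncurry R?) {xs = cartesianProduct xs xs} e)))
    (EqC.map (λ {u} {v} r → ∈-filter⁺ (uncurry R?) (∈-cartesianProduct⁺ (total u) (total v)) r))
    (edges? (filter (uncurry R?) (cartesianProduct xs xs)) x y)

-- On {0, …, 2n-1}.
record Matching (n : ℕ) : Set where
  field
    partition : Partition (2 *ⁿ n)
    ∣pairs∣   : length (blocks partition) ≡ n
    ∣pair∣    : ∀ {B} → partition ∋ᴾ B → ∣ B ∣ ≡ 2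

open Matching public

infix 4 _∋_ _≈_

_∋_ : Matching n → Subset (2 *ⁿ n) → Set
M ∋ B = partition M ∋ᴾ B

matchingSetoid : ℕ → Setoid 0ℓ 0ℓ
matchingSetoid n = On.setoid (partitionSetoid (2 *ⁿ n)) (partition {n})

_≈_ : Rel (Matching n) 0ℓ
_≈_ {n} = Setoid._≈_ (matchingSetoid n)

-- `IsFlip M M′` : M′ is a flip of M.
IsFlip : Rel (Matching n) 0ℓ
IsFlip M M′ = ∃[ i ] ∃[ j ] ∃[ k ] ∃[ l ]
  M ∋ ⟅ i , j ⟆ × M ∋ ⟅ k , l ⟆ × ⟅ i , j ⟆ ≢ ⟅ k , l ⟆ ×
  (∀ B → M′ ∋ B ⇔ ((M ∋ B × B ≢ ⟅ i , j ⟆ × B ≢ ⟅ k , l ⟆) ⊎ B ≡ ⟅ i , l ⟆ ⊎ B ≡ ⟅ j , k ⟆))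

_⊕_ : .{{_ : NonZero N}} → Fin N → ℤ → Fin N
_⊕_ {N} i e = fromℕ< (n%ℕd<d (+ toℕ i ℤ.+ e) N)

-- `IsRotation e M M′` : M′ = M(e), for e an integer.
IsRotation : .{{_ : NonZero n}} → ℤ → Rel (Matching n) 0ℓ
IsRotation {n} e M M′ = ∀ i j → M ∋ ⟅ i , j ⟆ ⇔ M′ ∋ ⟅ i +e , j +e ⟆
  where
  _+e : Fin (2 *ⁿ n) → Fin (2 *ⁿ n)
  i +e = _⊕_ {{m*n≢0 2 n}} i e

Joined : Matching n → Matching n → Rel (Fin (2 *ⁿ n)) 0ℓ
Joined M M′ i j = M ∋ ⟅ i , j ⟆ ⊎ M′ ∋ ⟅ i , j ⟆

joined-isDecEquivalence : (M M′ : Matching n) → IsDecEquivalence (EqClosure (Joined M M′))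
joined-isDecEquivalence {n} M M′ = record
  { isEquivalence = EqC.isEquivalence _
  ; _≟_           = eqClosure? _≟_ joined? (allFin (2 *ⁿ n)) ∈-allFin
  }
  where
  open DecMembership _≟ˢ_ using (_∈?_)

  joined? : Decidable₂ (Joined M M′)
  joined? i j = (⟅ i , j ⟆ ∈? blocks (partition M)) ⊎-dec (⟅ i , j ⟆ ∈? blocks (partition M′))

Π₀ : Matching n → Matching n → Partition (2 *ⁿ n)
Π₀ M M′ = classes (joined-isDecEquivalence M M′)

-- The points 0, ½, 1, …, N-½ are encoded in increasing order by doubling:
-- i becomes 2i = combine i 0 and i+½ becomes 2i+1 = combine i 1.
integral half : Subset N → Subset (N *ⁿ 2)
integral = image (λ i → combine i (zero {1}))
half     = image (λ i → combine i (suc {1} zero))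

-- For blocks B of M and B′ of M′.
Crosses : Rel (Subset N) 0ℓ
Crosses B B′ = Cross (integral B) (half B′)

_∪½_ : Matching n → Matching n → List (Subset (2 *ⁿ n *ⁿ 2))
M ∪½ M′ = map integral (blocks (partition M)) ++ map half (blocks (partition M′))

unorderedPairs : {A : Set} → List A → List (A × A)
unorderedPairs []       = []
unorderedPairs (x ∷ xs) = map (x ,_) xs ++ unorderedPairs xs

cross? : Decidable₂ (Cross {N})
cross? B C = interleave? B C ⊎-dec interleave? C B
  where
  interleave? : Decidable₂ (Interleave {N})
  interleave? B C = any? λ i → any? λ j → any? λ k → any? λ l →
    ((i <? j) ×-dec (j <? k) ×-dec (k <? l)) ×-dec
    ((i ∈ˢ? B) ×-dec (k ∈ˢ? B)) ×-dec ((j ∈ˢ? C) ×-dec (l ∈ˢ? C))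

∣crossings∣ : List (Subset N) → ℕ
∣crossings∣ Bs = length (filter (uncurry cross?) (unorderedPairs Bs))

record IsBasketball (M M′ : Matching n) : Set where
  field
    noncrossing₁ : Noncrossing (partition M)
    noncrossing₂ : Noncrossing (partition M′)
    crossings    : ∣crossings∣ (M ∪½ M′) ≡ n

-- An n-tuple (x₁, …, xₙ) is indexed by Fin n, with xᵢ at index i-1.
first : .{{_ : NonZero n}} → Fin n
first {n} = fromℕ< (>-nonZero⁻¹ n)

_IsNext_ : Rel (Fin n) 0ℓ
s IsNext r = toℕ s ≡ 1+ (toℕ r)

IsLast : Pred (Fin n) 0ℓ
IsLast {n} s = 1+ (toℕ s) ≡ n

record Necklace (n : ℕ) .{{_ : NonZero n}} : Set where
  field
    matching    : Fin n → Matching n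
    noncrossing : ∀ s → Noncrossing (partition (matching s))
    flip        : ∀ {r s} → s IsNext r → IsFlip (matching r) (matching s)
    closed      : ∀ {s} → IsLast s → IsRotation -1ℤ (matching first) (matching s)

record IsStrongNecklace (M : Fin n → Matching n) : Set where
  field
    noncrossing : ∀ s → Noncrossing (partition (M s))
    basketball  : ∀ {r s} → r < s → IsBasketball (M r) (M s)
    transitive  : ∀ {r s t} → r < s → s < t →
                  ∀ {B C D} → M r ∋ B → M s ∋ C → M t ∋ D →
                  Crosses B C → Crosses B D → Crosses C D
    distinct    : ∀ {r s} → s IsNext r → ¬ (M s ≈ M r)

record MaximalChain (n : ℕ) : Set where
  field
    parts        : Fin n → Partition (2 *ⁿ n)
    noncrossing  : ∀ i → Noncrossing (parts i)
    twoDivisible : ∀ i → TwoDivisible (parts i)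
    -- n+1-i blocks, with i = toℕ i + 1
    ∣blocks∣     : ∀ i → length (blocks (parts i)) ≡ n ∸ⁿ toℕ i
    refines      : ∀ {i j} → j IsNext i → Refines (parts i) (parts j)

necklaceSetoid : (n : ℕ) .{{_ : NonZero n}} → Setoid 0ℓ 0ℓ
necklaceSetoid n = On.setoid (≋-setoid (matchingSetoid n) n) (Necklace.matching {n})

chainSetoid : ℕ → Setoid 0ℓ 0ℓ
chainSetoid n = On.setoid (≋-setoid (partitionSetoid (2 *ⁿ n)) n) (MaximalChain.parts {n})

{-# OPTIONS --safe #-}

-- Read a matching as a fixpoint-free involution μ of the cyclically ordered set
-- ⟨0, 2n-1⟩, and a noncrossing partition P as its cyclic successor permutation σ.
-- If M refines P, then σ⁻¹ μ σ (the rotation of M by -1 inside every block of P)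
-- is again a noncrossing matching M′, and P = Π₀(M, M′).  Along a maximal chain
-- consecutive σ differ by a transposition, so the resulting matchings are flips
-- of each other and form a necklace.
-- Conversely, a flip changes the number of classes of Π₀(M₁, Mₛ) by at most one,
-- and n-1 flips bring it from n down to 1.  Hence every flip takes place inside
-- one class of Π₀(M₁, Mₛ₊₁).  Going down from s = n, where σ is the rotation, each
-- flip determines the transposition by which σ has to be modified.
-- Finally, a pair B of M crosses the pair σ⁻¹ B of M′ and no other.  As the tuple
-- (Mᵣ, …, Mₙ, M₂(-1), …, Mᵣ(-1)) is again a necklace, the crossings between Mᵣ and
-- Mₛ are given by the composite of the transpositions from r to s, and composites
-- compose; this is the strong necklace property.

module Submission where

open import Defs
import Data.Bool.Base as Bool
open import Data.Bool.Base using (Bool; true; false; not; T)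
open import Data.Bool.Properties using (T-∧)
open import Data.Empty using (⊥; ⊥-elim)
import Data.Fin.Base as Fin
open import Data.Fin.Base using (Fin; zero; suc; toℕ; fromℕ<; combine)
open import Data.Fin.Patterns using (0F; 1F; 2F; 3F; 4F; 5F)
import Data.Fin.Properties as Fin
open import Data.Fin.Properties using (_≟_; all?; any?; toℕ-injective; toℕ<n; toℕ-fromℕ<;
  toℕ-combine; combine-monoˡ-<)
open import Data.Fin.Subset using (Subset; ∣_∣; inside; outside; ⁅_⁆; _∪_; _∩_; Nonempty; Empty)
  renaming (_∈_ to _∈ˢ_; _∉_ to _∉ˢ_; _⊆_ to _⊆ˢ_; ⊥ to ⊥ˢ)
open import Data.Fin.Subset.Properties using (∣p∣≤n; ∣⊥∣≡0; ∣⁅x⁆∣≡1; ∣p∣≤∣x∷p∣; p⊆q⇒∣p∣≤∣q∣;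
  p⊂q⇒∣p∣<∣q∣; nonempty?; Empty-unique; x∈⁅x⁆; x∈⁅y⁆⇒x≡y; x∈p∪q⁻; x∈p∪q⁺; x∈p∩q⁺; x∈p∩q⁻;
  ⊆-antisym; ∪-comm; ∉⊥; drop-there; drop-∷-Empty) renaming (_∈?_ to _∈ˢ?_)
open import Data.Integer.Base as ℤ using (-1ℤ) renaming (+_ to +ℤ_)
open import Data.Integer.DivMod using (n%ℕd<d)
open import Data.List.Base using (List; []; _∷_; _++_; length; map; filter; foldr; allFin)
open import Data.List.Membership.Propositional using (_∈_; find; lose)
open import Data.List.Membership.Propositional.Properties using (∈-map⁺; ∈-map⁻; ∈-allFin;
  ∈-deduplicate⁺; ∈-deduplicate⁻)
open import Data.List.Properties using (length-++; length-map; filter-++; filter-none)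
open import Data.List.Relation.Unary.All as All using (All; []; _∷_)
import Data.List.Relation.Unary.All.Properties as All
open import Data.List.Relation.Unary.AllPairs as AllPairs using (AllPairs; []; _∷_)
import Data.List.Relation.Unary.AllPairs.Properties as AllPairs
open import Data.List.Relation.Unary.Any using (here; there)
open import Data.List.Relation.Unary.Unique.Propositional using (Unique)
open import Data.Nat.Base using (ℕ; zero; suc; _+_; _*_; _∸_; _⊓_; _≤_; _<_; _<ᵇ_; _≡ᵇ_; z≤n; s≤s;
  NonZero; >-nonZero; >-nonZero⁻¹)
open import Data.Nat.DivMod using (m<n⇒m%n≡m)
open import Data.Nat.Divisibility using (_∣_; _∣0; ∣m∣n⇒∣m+n; ∣-refl; ∣⇒≤)
open import Data.Nat.ListAction using (sum)
import Data.Nat.Properties as ℕ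
open import Data.Product.Base using (Σ; Σ-syntax; ∃; ∃-syntax; _×_; _,_; proj₁; proj₂; swap;
  uncurry)
import Data.Sum.Base as Sum
open import Data.Sum.Base using (_⊎_; inj₁; inj₂; [_,_]′)
open import Data.Unit.Base using (⊤; tt)
open import Data.Vec.Base as Vec using (Vec; []; _∷_; lookup; tabulate; here; there)
open import Data.Vec.Properties using (lookup∘tabulate)
open import Function.Base using (_∘_; id; _on_)
open import Function.Bundles using (Bijection; Equivalence; mk⇔)
open import Level using (0ℓ)
open import Relation.Binary.Bundles using (Setoid)
open import Relation.Binary.Construct.Closure.Equivalence as EqC using (EqClosure)
import Relation.Binary.Construct.On as On
open import Relation.Binary.Core using (Rel; _⇒_)
open import Relation.Binary.Definitions using (tri<; tri≈; tri>) renaming (Decidable to Decidable₂)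
open import Relation.Binary.PropositionalEquality using (_≡_; _≢_; refl; sym; trans; cong; cong₂;
  subst; subst₂)
open import Relation.Binary.Structures using (IsEquivalence; IsDecEquivalence)
open import Relation.Nullary.Decidable using (Dec; yes; no; _because_; proof; _×-dec_; _⊎-dec_;
  _→-dec_; ¬?; decidable-stable)
open import Relation.Nullary.Negation using (¬_; contradiction)
open import Relation.Nullary.Reflects using (Reflects; ofʸ; ofⁿ; _×-reflects_; _⊎-reflects_;
  _→-reflects_)
open import Relation.Unary using (Pred; Decidable)

-- What is carried along a necklace is not a partition but the closure of every gap under σ and μ,
-- as in `IsLink`. The blocks are then the classes of `_≋_`, points that no gap separates; that
-- these are exactly the loops of μ and ν is a separate fact, `Connected`, and it is what ties σ to
-- Π₀. The descent starts at the rotation because all gaps are empty there, and each step only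
-- splits one block: two gaps are new and all others are old, so closure has to be checked for two
-- symmetric cases. The license to split is that the flipped points lie in one block, and this comes
-- from counting loops, not from geometry. The transposition of a flip depends on that flip alone
-- and not on the matching Mᵣ from which loops are counted. Hence the links for different r are
-- products of the same factors, which is why crossings compose. Each geometric step concerns at
-- most six points of the circle, given by a formula in their order, and is settled by checking all
-- rank tuples.

private
  variable
    k n N : ℕ

-- Formulas in the order of k numbers.  Such a formula holds in general as soon as
-- it holds for numbers below k: replace each entry of a tuple by its rank.

infix 7 _≺_ _≐_
infixr 6 _∧_
infixr 5 _∨_
infixr 4 _⊃_

data Form (k : ℕ) : Set where
  _≺_ _≐_     : Fin k → Fin k → Form k
  false′      : Form k
  _∧_ _∨_ _⊃_ : Form k → Form k → Form k

⟦_⟧ : ∀ {k} → Form k → Vec ℕ k → Set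
⟦ i ≺ j ⟧ ρ  = lookup ρ i < lookup ρ j
⟦ i ≐ j ⟧ ρ  = lookup ρ i ≡ lookup ρ j
⟦ false′ ⟧ ρ = ⊥
⟦ A ∧ B ⟧ ρ  = ⟦ A ⟧ ρ × ⟦ B ⟧ ρ
⟦ A ∨ B ⟧ ρ  = ⟦ A ⟧ ρ ⊎ ⟦ B ⟧ ρ
⟦ A ⊃ B ⟧ ρ  = ⟦ A ⟧ ρ → ⟦ B ⟧ ρ

eval : ∀ {k} → Form k → Vec ℕ k → Bool
eval (i ≺ j) ρ  = lookup ρ i <ᵇ lookup ρ j
eval (i ≐ j) ρ  = lookup ρ i ≡ᵇ lookup ρ j
eval false′ ρ   = false
eval (A ∧ B) ρ  = eval A ρ Bool.∧ eval B ρ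
eval (A ∨ B) ρ  = eval A ρ Bool.∨ eval B ρ
eval (A ⊃ B) ρ  = not (eval A ρ) Bool.∨ eval B ρ

eval-reflects : ∀ {k} (A : Form k) (ρ : Vec ℕ k) → Reflects (⟦ A ⟧ ρ) (eval A ρ)
eval-reflects (i ≺ j) ρ = proof (lookup ρ i ℕ.<? lookup ρ j)
eval-reflects (i ≐ j) ρ = proof (lookup ρ i ℕ.≟ lookup ρ j)
eval-reflects false′ ρ  = ofⁿ λ ()
eval-reflects (A ∧ B) ρ = eval-reflects A ρ ×-reflects eval-reflects B ρ
eval-reflects (A ∨ B) ρ = eval-reflects A ρ ⊎-reflects eval-reflects B ρ
eval-reflects (A ⊃ B) ρ = eval-reflects A ρ →-reflects eval-reflects B ρ

⟦_⟧? : ∀ {k} (A : Form k) (ρ : Vec ℕ k) → Dec (⟦ A ⟧ ρ)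
⟦ A ⟧? ρ = eval A ρ because eval-reflects A ρ

allBelow : ℕ → (ℕ → Bool) → Bool
allBelow zero    f = true
allBelow (suc n) f = f n Bool.∧ allBelow n f

allBelow-elim : ∀ n {f} → T (allBelow n f) → ∀ {x} → x < n → T (f x)
allBelow-elim (suc n) {f} h {x} x<1+n with ℕ.m≤n⇒m<n∨m≡n x<1+n
... | inj₁ (s≤s x<n) = allBelow-elim n (proj₂ (Equivalence.to T-∧ h)) x<n
... | inj₂ refl      = proj₁ (Equivalence.to T-∧ h)

allTuples : ℕ → ∀ k → (Vec ℕ k → Bool) → Bool
allTuples b zero    f = f []
allTuples b (suc k) f = allBelow b λ x → allTuples b k (λ ρ → f (x ∷ ρ))

allTuples-elim : ∀ b k {f} → T (allTuples b k f) → ∀ ρ → (∀ i → lookup ρ i < b) → T (f ρ)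
allTuples-elim b zero    h []      bd = h
allTuples-elim b (suc k) h (x ∷ ρ) bd =
  allTuples-elim b k (allBelow-elim b h (bd zero)) ρ (λ i → bd (suc i))

indicator : ∀ {A : Set} → Dec A → ℕ
indicator (yes _) = 1
indicator (no _)  = 0

-- The rank by which an entry is replaced. Repeated entries count repeatedly, so ranks may skip
-- values; this is harmless because formulas read off only order and equality.
below : ∀ {k} → Vec ℕ k → ℕ → ℕ
below []      x = 0
below (z ∷ ρ) x = indicator (z ℕ.<? x) + below ρ x

below-mono : ∀ {k} (ρ : Vec ℕ k) {x y} → x ≤ y → below ρ x ≤ below ρ y
below-mono []      x≤y = z≤n
below-mono (z ∷ ρ) {x} {y} x≤y with z ℕ.<? x | z ℕ.<? y
... | yes _ | yes _ = s≤s (below-mono ρ x≤y)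
... | yes z<x | no z≮y = contradiction (ℕ.<-≤-trans z<x x≤y) z≮y
... | no _  | yes _ = ℕ.m≤n⇒m≤1+n (below-mono ρ x≤y)
... | no _  | no _  = below-mono ρ x≤y

below-strict : ∀ {k} (ρ : Vec ℕ k) i {y} → lookup ρ i < y → below ρ (lookup ρ i) < below ρ y
below-strict (z ∷ ρ) zero {y} z<y with z ℕ.<? z | z ℕ.<? y
... | yes z<z | _       = contradiction z<z (ℕ.<-irrefl refl)
... | no _    | yes _   = s≤s (below-mono ρ (ℕ.<⇒≤ z<y))
... | no _    | no z≮y  = contradiction z<y z≮y
below-strict (z ∷ ρ) (suc i) {y} h with z ℕ.<? lookup ρ i | z ℕ.<? y
... | yes _   | yes _  = s≤s (below-strict ρ i h)
... | yes z<x | no z≮y = contradiction (ℕ.<-trans z<x h) z≮y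
... | no _    | yes _  = ℕ.m≤n⇒m≤1+n (below-strict ρ i h)
... | no _    | no _   = below-strict ρ i h

-- An entry is not counted in its own rank, so the rank is strictly less than the number of entries
-- up to and including that value.
below<k : ∀ {k} (ρ : Vec ℕ k) i → below ρ (lookup ρ i) < k
below<k {k} ρ i = ℕ.<-≤-trans (below-strict ρ i (ℕ.n<1+n _)) (count≤k ρ)
  where
  count≤k : ∀ {m y} (ρ : Vec ℕ m) → below ρ y ≤ m
  count≤k []      = z≤n
  count≤k {y = y} (z ∷ ρ) with z ℕ.<? y
  ... | yes _ = s≤s (count≤k ρ)
  ... | no _  = ℕ.m≤n⇒m≤1+n (count≤k ρ)

module _ {k : ℕ} (ρ : Vec ℕ k) where

  ranks : Vec ℕ k
  ranks = tabulate (λ i → below ρ (lookup ρ i))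

  private
    at : ∀ i → lookup ranks i ≡ below ρ (lookup ρ i)
    at = lookup∘tabulate _

  mutual
    -- The two directions are proved together because `_⊃_` is contravariant in its premise.
    toRanks : (A : Form k) → ⟦ A ⟧ ρ → ⟦ A ⟧ ranks
    toRanks (i ≺ j) h = subst₂ _<_ (sym (at i)) (sym (at j)) (below-strict ρ i h)
    toRanks (i ≐ j) h = trans (at i) (trans (cong (below ρ) h) (sym (at j)))
    toRanks (A ∧ B) (a , b)  = toRanks A a , toRanks B b
    toRanks (A ∨ B) (inj₁ a) = inj₁ (toRanks A a)
    toRanks (A ∨ B) (inj₂ b) = inj₂ (toRanks B b)
    toRanks (A ⊃ B) h a = toRanks B (h (fromRanks A a))

    fromRanks : (A : Form k) → ⟦ A ⟧ ranks → ⟦ A ⟧ ρ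
    fromRanks (i ≺ j) h with lookup ρ i ℕ.<? lookup ρ j
    ... | yes p = p
    ... | no ¬p = contradiction (subst₂ _<_ (at i) (at j) h)
                    (ℕ.≤⇒≯ (below-mono ρ (ℕ.≮⇒≥ ¬p)))
    fromRanks (i ≐ j) h with ℕ.<-cmp (lookup ρ i) (lookup ρ j)
    ... | tri< a _ _ = contradiction h (ℕ.<⇒≢ (toRanks (i ≺ j) a))
    ... | tri≈ _ b _ = b
    ... | tri> _ _ c = contradiction (sym h) (ℕ.<⇒≢ (toRanks (j ≺ i) c))
    fromRanks (A ∧ B) (a , b)  = fromRanks A a , fromRanks B b
    fromRanks (A ∨ B) (inj₁ a) = inj₁ (fromRanks A a)
    fromRanks (A ∨ B) (inj₂ b) = inj₂ (fromRanks B b)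
    fromRanks (A ⊃ B) h a = fromRanks B (h (toRanks A a))

Valid : ∀ {k} → Form k → Set
Valid {k} A = T (allTuples k k (eval A))

abstract
  order : ∀ {k} (A : Form k) {_ : Valid A} (ρ : Vec ℕ k) → ⟦ A ⟧ ρ
  order {k} A {t} ρ = fromRanks ρ A (holds (eval-reflects A (ranks ρ))
    (allTuples-elim k k t (ranks ρ)
      (λ i → subst (_< k) (sym (lookup∘tabulate _ i)) (below<k ρ i))))
    where
    holds : {P : Set} {b : Bool} → Reflects P b → T b → P
    holds (ofʸ p) _ = p

-- Cyclic order and noncrossing involutions

infix 8 ¬′_

¬′_ : Form k → Form k
¬′ A = A ⊃ false′

-- Strict: false as soon as two of the points coincide.
cyc : (a b c : Fin k) → Form k
cyc a b c = a ≺ b ∧ b ≺ c ∨ b ≺ c ∧ c ≺ a ∨ c ≺ a ∧ a ≺ b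

ordering : (A : Form k) {_ : Valid A} (xs : Vec (Fin N) k) → ⟦ A ⟧ (Vec.map toℕ xs)
ordering A {t} xs = order A {t} (Vec.map toℕ xs)

Cyc : (x y z : Fin N) → Set
Cyc x y z = ⟦ cyc 0F 1F 2F ⟧ (Vec.map toℕ (x ∷ y ∷ z ∷ []))

≢ℕ : {x y : Fin N} → x ≢ y → toℕ x ≢ toℕ y
≢ℕ x≢y = x≢y ∘ toℕ-injective

-- The half-open arc [x , z); meaningful only for x ≢ z.
Arc : (x y z : Fin N) → Set
Arc x y z = toℕ y ≡ toℕ x ⊎ Cyc x y z

cyc? : (x y z : Fin N) → Dec (Cyc x y z)
cyc? x y z = ⟦ cyc 0F 1F 2F ⟧? (Vec.map toℕ (x ∷ y ∷ z ∷ []))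

¬cyc-xxy : {x y : Fin N} → ¬ Cyc x x y
¬cyc-xxy {x = x} {y} = ordering (¬′ cyc 0F 0F 1F) (x ∷ y ∷ [])

¬cyc-xyy : {x y : Fin N} → ¬ Cyc x y y
¬cyc-xyy {x = x} {y} = ordering (¬′ cyc 0F 1F 1F) (x ∷ y ∷ [])

¬cyc-xyx : {x y : Fin N} → ¬ Cyc x y x
¬cyc-xyx {x = x} {y} = ordering (¬′ cyc 0F 1F 0F) (x ∷ y ∷ [])

cyc-rotate : {x y z : Fin N} → Cyc x y z → Cyc y z x
cyc-rotate {x = x} {y} {z} = ordering (cyc 0F 1F 2F ⊃ cyc 1F 2F 0F) (x ∷ y ∷ z ∷ [])

cyc-asym : {x y z : Fin N} → Cyc x y z → ¬ Cyc z y x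
cyc-asym {x = x} {y} {z} = ordering (cyc 0F 1F 2F ⊃ ¬′ cyc 2F 1F 0F) (x ∷ y ∷ z ∷ [])

cyc-total : {x y z : Fin N} → x ≢ y → y ≢ z → x ≢ z → Cyc x y z ⊎ Cyc z y x
cyc-total {x = x} {y} {z} p q r =
  ordering (¬′ (0F ≐ 1F) ⊃ ¬′ (1F ≐ 2F) ⊃ ¬′ (0F ≐ 2F) ⊃ cyc 0F 1F 2F ∨ cyc 2F 1F 0F)
    (x ∷ y ∷ z ∷ []) (≢ℕ p) (≢ℕ q) (≢ℕ r)

cyc-<-middle : {x y z : Fin N} → toℕ x < toℕ z → Cyc x y z → toℕ x < toℕ y × toℕ y < toℕ z
cyc-<-middle {x = x} {y} {z} =
  ordering (0F ≺ 2F ⊃ cyc 0F 1F 2F ⊃ 0F ≺ 1F ∧ 1F ≺ 2F) (x ∷ y ∷ z ∷ [])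

-- Only the open arc from x to μ x is mentioned; the complementary arc is the same condition at μ x.
record IsNCInvolution (μ : Fin N → Fin N) : Set where
  field
    involutive  : ∀ x → μ (μ x) ≡ x
    fixpoint    : ∀ x → μ x ≢ x
    noncrossing : ∀ {x y} → Cyc x y (μ x) → Cyc x (μ y) (μ x)

  injective : ∀ {x y} → μ x ≡ μ y → x ≡ y
  injective {x} {y} eq = trans (sym (involutive x)) (trans (cong μ eq) (involutive y))

-- σ is the cyclic successor permutation of a noncrossing partition refined by
-- μ; the gaps (z , σ z) of that partition are unions of its blocks.
record IsLink (μ ν σ σ⁻ : Fin N → Fin N) : Set where
  field
    σσ⁻       : ∀ x → σ (σ⁻ x) ≡ x
    σ⁻σ       : ∀ x → σ⁻ (σ x) ≡ x
    σ-moves   : ∀ x → σ x ≢ x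
    conjugate : ∀ x → σ (ν x) ≡ μ (σ x)
    gap-σ     : ∀ {z x} → Cyc z x (σ z) → Cyc z (σ x) (σ z)
    gap-μ     : ∀ {z x} → Cyc z x (σ z) → Cyc z (μ x) (σ z)

-- Blocks, connectedness and crossings of a link

module Link {μ ν σ σ⁻ : Fin N → Fin N} (isInv : IsNCInvolution μ) (isLink : IsLink μ ν σ σ⁻) where

  open IsNCInvolution isInv
  open IsLink isLink public

  σ-injective : ∀ {x y} → σ x ≡ σ y → x ≡ y
  σ-injective {x} {y} eq = trans (sym (σ⁻σ x)) (trans (cong σ⁻ eq) (σ⁻σ y))

  infix 4 _≋_

  -- The blocks seen from outside: no gap separates x from y. The equivalence laws are then
  -- immediate, and invariance under σ, μ and ν is checked gap by gap, without orbits.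
  _≋_ : Rel (Fin N) 0ℓ
  x ≋ y = ∀ z → (Cyc z x (σ z) → Cyc z y (σ z)) × (Cyc z y (σ z) → Cyc z x (σ z))

  ≋-refl : ∀ {x} → x ≋ x
  ≋-refl z = id , id

  ≋-sym : ∀ {x y} → x ≋ y → y ≋ x
  ≋-sym e z = swap (e z)

  ≋-trans : ∀ {x y w} → x ≋ y → y ≋ w → x ≋ w
  ≋-trans e f z = proj₁ (f z) ∘ proj₁ (e z) , proj₂ (e z) ∘ proj₂ (f z)

  ≋-isEquivalence : IsEquivalence _≋_
  ≋-isEquivalence = record { refl = ≋-refl ; sym = ≋-sym ; trans = ≋-trans }

  -- For the way back: if σ x is in the gap at z and x ≢ z is not, then the gap at x contains z but
  -- not σ z.
  ≋σ : ∀ x → x ≋ σ x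
  ≋σ x z = gap-σ , back
    where
    back : Cyc z (σ x) (σ z) → Cyc z x (σ z)
    back h with x ≟ z
    ... | yes refl = ⊥-elim (¬cyc-xyy h)
    ... | no  x≢z  =
      ordering (cyc 0F 3F 1F ⊃ ¬′ (2F ≐ 0F) ⊃ (cyc 2F 0F 3F ⊃ cyc 2F 1F 3F) ⊃ cyc 0F 2F 1F)
        (z ∷ σ z ∷ x ∷ σ x ∷ []) h (≢ℕ x≢z) gap-σ

  ≋σ⁻ : ∀ x → x ≋ σ⁻ x
  ≋σ⁻ x = ≋-sym (subst (σ⁻ x ≋_) (σσ⁻ x) (≋σ (σ⁻ x)))

  ≋μ : ∀ x → x ≋ μ x
  ≋μ x z = gap-μ , (λ h → subst (λ y → Cyc z y (σ z)) (involutive x) (gap-μ h))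

  ≋ν : ∀ x → x ≋ ν x
  ≋ν x = ≋-trans (≋-trans (≋σ x) (≋μ (σ x)))
           (≋-sym (subst (ν x ≋_) (conjugate x) (≋σ (ν x))))

  gap-empty : ∀ {x y} → x ≋ y → ¬ Cyc x y (σ x)
  gap-empty {x} e h = ¬cyc-xxy (proj₂ (e x) h)

  gap⁻-empty : ∀ {x y} → x ≋ y → ¬ Cyc (σ⁻ x) y x
  gap⁻-empty {x} {y} e h =
    gap-empty (≋-trans (≋-sym (≋σ⁻ x)) e) (subst (Cyc (σ⁻ x) y) (sym (σσ⁻ x)) h)

  σ⁻-moves : ∀ x → σ⁻ x ≢ x
  σ⁻-moves x eq = σ-moves x (trans (cong σ (sym eq)) (σσ⁻ x))

  conjugate⁻ : ∀ x → σ⁻ (μ x) ≡ ν (σ⁻ x)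
  conjugate⁻ x = trans (cong σ⁻ (trans (cong μ (sym (σσ⁻ x))) (sym (conjugate (σ⁻ x))))) (σ⁻σ _)

  -- A gap is an arc: if it contains a and c, it contains one of the two arcs between them, and with
  -- it b or d.
  ≋-noncrossing : ∀ {a b c d} → Cyc a b c → Cyc c d a → a ≋ c → b ≋ d → a ≋ b
  ≋-noncrossing {a} {b} {c} {d} abc cda ac bd z = to , from
    where
    to : Cyc z a (σ z) → Cyc z b (σ z)
    to h = [ id , proj₂ (bd z) ]′
      (ordering (cyc 0F 1F 2F ⊃ cyc 2F 3F 0F ⊃ cyc 4F 0F 5F ⊃ cyc 4F 2F 5F ⊃
                 cyc 4F 1F 5F ∨ cyc 4F 3F 5F)
        (a ∷ b ∷ c ∷ d ∷ z ∷ σ z ∷ []) abc cda h (proj₁ (ac z) h))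

    from : Cyc z b (σ z) → Cyc z a (σ z)
    from h = [ id , proj₂ (ac z) ]′
      (ordering (cyc 0F 1F 2F ⊃ cyc 2F 3F 0F ⊃ cyc 4F 1F 5F ⊃ cyc 4F 3F 5F ⊃
                 cyc 4F 0F 5F ∨ cyc 4F 2F 5F)
        (a ∷ b ∷ c ∷ d ∷ z ∷ σ z ∷ []) abc cda h (proj₁ (bd z) h))

  -- Otherwise x would lie strictly between σ⁻ w and w, in a gap next to its own block. The linear
  -- order thus serves as a measure for walking down a block by σ⁻.
  σ⁻-descends : ∀ {x w} → toℕ x < toℕ w → w ≋ x → toℕ x ≤ toℕ (σ⁻ w) × toℕ (σ⁻ w) < toℕ w
  σ⁻-descends {x} {w} x<w w≋x =
    let le , lt = ordering
          (0F ≺ 1F ⊃ ¬′ (2F ≐ 1F) ⊃ ¬′ cyc 2F 0F 1F ⊃ ¬′ (2F ≺ 0F) ∧ 2F ≺ 1F)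
          (x ∷ w ∷ σ⁻ w ∷ []) x<w (≢ℕ (σ⁻-moves w)) (gap⁻-empty w≋x)
    in ℕ.≮⇒≥ le , lt

  -- With `≋μ` and `≋ν` this makes `_≋_` the least equivalence containing the pairs of μ and of ν.
  -- The relation is arbitrary so that the result applies to loops as well as to the pairs of a
  -- single involution.
  module Connected {_∼_ : Rel (Fin N) 0ℓ} (isEq : IsEquivalence _∼_)
                   (∼μ : ∀ x → x ∼ μ x) (∼ν : ∀ x → x ∼ ν x) where

    private
      module E = IsEquivalence isEq

      Tame : Fin N → Set
      Tame x = x ∼ σ⁻ x

      -- σ⁻ carries the pair of x under μ to a pair of ν, so it suffices to treat one end of each
      -- pair.
      tame-μ : ∀ {x} → Tame x → Tame (μ x)
      tame-μ {x} t = E.trans (E.sym (∼μ x))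
        (subst (x ∼_) (sym (conjugate⁻ x)) (E.trans t (∼ν (σ⁻ x))))

      -- The conclusion concerns σ⁻ w, so that w itself need not be tame: the walk will start at the
      -- end of an arc, where tameness is the point at issue.
      walk : ∀ {x m : Fin N} → (∀ {y} → toℕ x < toℕ y → toℕ y < toℕ m → Tame y) →
             ∀ b {w} → toℕ w < b → toℕ x < toℕ w → toℕ w ≤ toℕ m → w ≋ x → σ⁻ w ∼ x
      walk {x} tame (suc b) {w} (s≤s w≤b) x<w w≤m w≋x with x ≟ σ⁻ w | σ⁻-descends x<w w≋x
      ... | yes eq | _       = E.reflexive (sym eq)
      ... | no neq | le , lt =
        E.trans (tame x<e (ℕ.<-≤-trans lt w≤m))
          (walk tame b (ℕ.<-≤-trans lt w≤b) x<e (ℕ.≤-trans (ℕ.<⇒≤ lt) w≤m)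
            (≋-trans (≋-sym (≋σ⁻ w)) w≋x))
        where x<e = ℕ.≤∧≢⇒< le (≢ℕ neq)

      shorter : ∀ {x y z w} → x < y → y < z → z < w → z ∸ y < w ∸ x
      shorter {x} {y} {z} {w} x<y y<z z<w =
        ℕ.<-trans (ℕ.∸-monoˡ-< z<w (ℕ.<⇒≤ y<z)) (ℕ.∸-monoʳ-< x<y (ℕ.<⇒≤ (ℕ.<-trans y<z z<w)))

      -- Induction on the length of the arc from x to μ x: the arcs nested in it
      -- are tame, so σ⁻ leads from μ x back to x through ∼.
      tame-arc : ∀ b {x} → toℕ (μ x) ∸ toℕ x < b → toℕ x < toℕ (μ x) → Tame x
      tame-arc (suc b) {x} (s≤s len) x<μx = subst Tame (involutive x) (tame-μ
        (E.trans (E.sym (∼μ x)) (E.sym (walk inner _ ℕ.≤-refl x<μx ℕ.≤-refl (≋-sym (≋μ x))))))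
        where
        inner : ∀ {y} → toℕ x < toℕ y → toℕ y < toℕ (μ x) → Tame y
        inner {y} x<y y<μx with cyc-<-middle x<μx (noncrossing (inj₁ (x<y , y<μx)))
                              | ℕ.<-cmp (toℕ y) (toℕ (μ y))
        ... | _ , lt | tri< a _ _ = tame-arc b (ℕ.<-≤-trans (shorter x<y a lt) len) a
        ... | _      | tri≈ _ e _ = ⊥-elim (fixpoint y (sym (toℕ-injective e)))
        ... | lt , _ | tri> _ _ a = subst Tame (involutive y) (tame-μ (tame-arc b
          (ℕ.<-≤-trans (subst (λ z → toℕ z ∸ toℕ (μ y) < toℕ (μ x) ∸ toℕ x) (sym (involutive y)) (shorter lt a y<μx)) len)
          (subst (λ z → toℕ (μ y) < toℕ z) (sym (involutive y)) a)))

      tame : ∀ x → Tame x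
      tame x with ℕ.<-cmp (toℕ x) (toℕ (μ x))
      ... | tri< a _ _ = tame-arc _ ℕ.≤-refl a
      ... | tri≈ _ e _ = ⊥-elim (fixpoint x (sym (toℕ-injective e)))
      ... | tri> _ _ a = subst Tame (involutive x) (tame-μ (tame-arc _ ℕ.≤-refl
        (subst (λ z → toℕ (μ x) < toℕ z) (sym (involutive x)) a)))

      descend : ∀ {x y} → toℕ x < toℕ y → y ≋ x → x ∼ y
      descend x<y y≋x = E.sym (E.trans (tame _) (walk (λ _ _ → tame _) _ ℕ.≤-refl x<y ℕ.≤-refl y≋x))

    connected : ∀ {x y} → x ≋ y → x ∼ y
    connected {x} {y} x≋y with ℕ.<-cmp (toℕ x) (toℕ y)
    ... | tri< a _ _ = descend a (≋-sym x≋y)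
    ... | tri≈ _ e _ = E.reflexive (toℕ-injective e)
    ... | tri> _ _ a = E.sym (descend a x≋y)

  -- Outside that arc, σ⁻ (μ x) would leave x in the gap ending at μ x, although x is in the block
  -- of μ x.
  cross-σ⁻ : ∀ x → Arc x (σ⁻ (μ x)) (μ x)
  cross-σ⁻ x = ordering
    (¬′ (1F ≐ 0F) ⊃ ¬′ (2F ≐ 1F) ⊃ ¬′ cyc 2F 0F 1F ⊃ 2F ≐ 0F ∨ cyc 0F 2F 1F)
    (x ∷ μ x ∷ σ⁻ (μ x) ∷ []) (≢ℕ (fixpoint x)) (≢ℕ (σ⁻-moves (μ x)))
    (gap⁻-empty (≋-sym (≋μ x)))

  private
    -- The gap at z would contain x but not μ x.
    no-overshoot : ∀ {x z} → Cyc x (σ z) (μ x) → ¬ Arc (μ x) z x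
    no-overshoot {x} {z} h arc = ordering
      (cyc 0F 3F 1F ⊃ 2F ≐ 1F ∨ cyc 1F 2F 0F ⊃ (cyc 2F 0F 3F ⊃ cyc 2F 1F 3F) ⊃ false′)
      (x ∷ μ x ∷ z ∷ σ z ∷ []) h arc gap-μ

  -- The points y and ν y lie on different sides of the pair of x, but σ y and σ (ν y) = μ (σ y) lie
  -- on the same side unless they are that pair. So σ would carry one of y, ν y across the pair,
  -- which `no-overshoot` forbids.
  cross-unique : ∀ {x y} → Arc x y (μ x) → Arc (μ x) (ν y) x → σ y ≡ x ⊎ σ y ≡ μ x
  cross-unique {x} {y} xy yx with σ y ≟ x | σ y ≟ μ x
  ... | yes e | _     = inj₁ e
  ... | no _  | yes e = inj₂ e
  ... | no n₁ | no n₂ with cyc-total (n₁ ∘ sym) n₂ (fixpoint x ∘ sym)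
  ... | inj₁ h = ⊥-elim (no-overshoot (subst (λ z → Cyc x z (μ x)) (sym (conjugate y)) (noncrossing h)) yx)
  ... | inj₂ h = ⊥-elim (no-overshoot {μ x} {y} (subst (Cyc (μ x) (σ y)) (sym (involutive x)) h)
                   (subst (λ z → Arc z y (μ x)) (sym (involutive x)) xy))

-- Flips

transpose : (a b : Fin N) → Fin N → Fin N
transpose a b x with x ≟ a | x ≟ b
... | yes _ | _     = b
... | no _  | yes _ = a
... | no _  | no _  = x

transpose-left : (a b : Fin N) → transpose a b a ≡ b
transpose-left a b with a ≟ a | a ≟ b
... | yes _ | _ = refl
... | no a≢a | _ = ⊥-elim (a≢a refl)

transpose-right : (a b : Fin N) → transpose a b b ≡ a
transpose-right a b with b ≟ a | b ≟ b
... | yes b≡a | _      = b≡a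
... | no _    | yes _  = refl
... | no _    | no b≢b = ⊥-elim (b≢b refl)

transpose-fixes : {a b x : Fin N} → x ≢ a → x ≢ b → transpose a b x ≡ x
transpose-fixes {a = a} {b} {x} x≢a x≢b with x ≟ a | x ≟ b
... | yes x≡a | _       = ⊥-elim (x≢a x≡a)
... | no _    | yes x≡b = ⊥-elim (x≢b x≡b)
... | no _    | no _    = refl

transpose-elim : (P : Fin N → Fin N → Set) {a b : Fin N} → P a b → P b a →
                 (∀ {x} → x ≢ a → x ≢ b → P x x) → ∀ x → P x (transpose a b x)
transpose-elim P {a} {b} Pab Pba Pxx x with x ≟ a | x ≟ b
... | yes refl | _        = Pab
... | no _     | yes refl = Pba
... | no x≢a   | no x≢b   = Pxx x≢a x≢b

transpose-involutive : (a b x : Fin N) → transpose a b (transpose a b x) ≡ x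
transpose-involutive a b = transpose-elim (λ x y → transpose a b y ≡ x)
  (transpose-right a b) (transpose-left a b) transpose-fixes

record Exchange (μ ν : Fin N → Fin N) : Set where
  field
    a u b v : Fin N
    μa  : μ a ≡ u
    μb  : μ b ≡ v
    νa  : ν a ≡ v
    νb  : ν b ≡ u
    off : ∀ {x} → x ≢ a → x ≢ b → x ≢ u → x ≢ v → μ x ≡ ν x

-- Every exchange between noncrossing involutions has its four points in the
-- order a, v, b, u up to swapping (a , b) with (u , v); in this order it is the
-- transposition of a and b that modifies the partition.
record Flip (μ ν : Fin N → Fin N) : Set where
  field
    exchange : Exchange μ ν
  open Exchange exchange public
  field
    avb : Cyc a v b
    bua : Cyc b u a

flip-swap : {μ ν : Fin N → Fin N} → Flip μ ν → Flip μ ν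
flip-swap f = record
  { exchange = record
    { a = b ; u = v ; b = a ; v = u ; μa = μb ; μb = μa ; νa = νb ; νb = νa
    ; off = λ p q r s → off q p s r }
  ; avb = bua ; bua = avb }
  where open Flip f

-- Composing σ with the transposition of a and b cuts their block into σ a, ..., b and σ b, ..., a.
-- The new gaps are (a , σ b) and (b , σ a); `Side` treats the first, and `flip-swap` turns the
-- second into the first.
module Unflip {μ ν ν′ σ σ⁻ : Fin N → Fin N}
  (μ-inv : IsNCInvolution μ) (ν-inv : IsNCInvolution ν) (ν′-inv : IsNCInvolution ν′)
  (isLink : IsLink μ ν′ σ σ⁻) where

  open Link μ-inv isLink
  private
    module ν  = IsNCInvolution ν-inv
    module ν′ = IsNCInvolution ν′-inv

  module Side (flp : Flip ν ν′) (a≋b : Flip.a flp ≋ Flip.b flp) where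
    open Flip flp renaming (μa to νa≡u; μb to νb≡v; νa to ν′a≡v; νb to ν′b≡u)

    a≢b : a ≢ b
    a≢b e = ¬cyc-xyx (subst (Cyc a v) (sym e) avb)

    ν′v≡a : ν′ v ≡ a
    ν′v≡a = trans (cong ν′ (sym ν′a≡v)) (ν′.involutive a)

    -- Otherwise u, which lies in (b , a), is in a gap next to its own block.
    σb≢a : σ b ≢ a
    σb≢a e = gap-empty (subst (b ≋_) ν′b≡u (≋ν b)) (subst (Cyc b u) (sym e) bua)

    private
      ¬bab : ¬ Cyc b a (σ b)
      ¬bab = gap-empty (≋-sym a≋b)

      σa≢σb : σ a ≢ σ b
      σa≢σb = a≢b ∘ σ-injective

    σa-in : σ a ≢ b → Cyc a (σ a) (σ b)
    σa-in σa≢b = ordering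
      (¬′ (0F ≐ 1F) ⊃ ¬′ (2F ≐ 3F) ⊃ ¬′ (2F ≐ 0F) ⊃ ¬′ (3F ≐ 1F) ⊃ ¬′ (3F ≐ 0F) ⊃
       ¬′ cyc 0F 1F 2F ⊃ ¬′ cyc 1F 0F 3F ⊃ cyc 0F 2F 3F)
      (a ∷ b ∷ σ a ∷ σ b ∷ []) (≢ℕ a≢b) (≢ℕ σa≢σb) (≢ℕ (σ-moves a)) (≢ℕ (σ-moves b)) (≢ℕ σb≢a)
      (gap-empty a≋b) ¬bab

    -- For y in (a , b), σ y cannot lie beyond b up to a, since the gap at y would contain b without
    -- a. For y in (b , σ b), that old gap is closed under σ.
    σ-in : ∀ {y} → y ≢ b → Cyc a y (σ b) → Cyc a (σ y) (σ b)
    σ-in {y} y≢b h = ordering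
      (¬′ (0F ≐ 1F) ⊃ cyc 0F 3F 2F ⊃ ¬′ (3F ≐ 1F) ⊃ ¬′ (4F ≐ 2F) ⊃ ¬′ cyc 1F 0F 2F ⊃
       (cyc 1F 3F 2F ⊃ cyc 1F 4F 2F) ⊃ (cyc 3F 1F 4F ⊃ cyc 3F 0F 4F) ⊃ cyc 0F 4F 2F)
      (a ∷ b ∷ σ b ∷ y ∷ σ y ∷ []) (≢ℕ a≢b) h (≢ℕ y≢b) (≢ℕ (y≢b ∘ σ-injective)) ¬bab
      gap-σ (proj₂ (a≋b y))

    gap-στ : ∀ {y} → σ a ≢ b → Cyc a y (σ b) → Cyc a (σ (transpose a b y)) (σ b)
    gap-στ σa≢b = transpose-elim (λ y z → Cyc a y (σ b) → Cyc a (σ z) (σ b))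
      (λ h → ⊥-elim (¬cyc-xxy h)) (λ _ → σa-in σa≢b) (λ _ y≢b → σ-in y≢b) _

    private
      pull : ∀ {y} → y ≢ σ b → Cyc a y b ⊎ y ≡ b → Arc a (σ⁻ y) b
      pull {y} y≢σb y∈ = ordering
        (¬′ (0F ≐ 1F) ⊃ cyc 0F 2F 1F ∨ 2F ≐ 1F ⊃ ¬′ (3F ≐ 2F) ⊃ ¬′ (3F ≐ 1F) ⊃
         (cyc 3F 0F 2F ⊃ cyc 3F 1F 2F) ⊃ 3F ≐ 0F ∨ cyc 0F 3F 1F)
        (a ∷ b ∷ y ∷ σ⁻ y ∷ []) (≢ℕ a≢b) ([ inj₁ , inj₂ ∘ cong toℕ ]′ y∈) (≢ℕ (σ⁻-moves y))
        (≢ℕ λ e → y≢σb (trans (sym (σσ⁻ y)) (cong σ e)))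
        (subst (λ w → Cyc (σ⁻ y) a w → Cyc (σ⁻ y) b w) (σσ⁻ y) (proj₁ (a≋b (σ⁻ y))))

      -- The point v is the partner of a under ν′ and of b under ν. Points between a and v are
      -- confined by the pair {a , v} of ν′, points between v and b by the pair {v , b} of ν, where
      -- both involutions agree.
      across : ∀ {y} → Arc a y b → Arc a (ν′ y) b
      across {y} (inj₁ e) =
        inj₂ (subst (λ z → Cyc a z b) (sym (trans (cong ν′ (toℕ-injective e)) ν′a≡v)) avb)
      across {y} (inj₂ h) with ordering
        (cyc 0F 2F 1F ⊃ cyc 0F 3F 1F ⊃ cyc 0F 2F 3F ∨ 2F ≐ 3F ∨ cyc 3F 2F 1F)
        (a ∷ b ∷ y ∷ v ∷ []) h avb
      ... | inj₁ ayv = inj₂ (ordering (cyc 0F 2F 3F ⊃ cyc 0F 3F 1F ⊃ cyc 0F 2F 1F)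
        (a ∷ b ∷ ν′ y ∷ v ∷ [])
        (subst (Cyc a (ν′ y)) ν′a≡v (ν′.noncrossing (subst (Cyc a y) (sym ν′a≡v) ayv))) avb)
      ... | inj₂ (inj₁ e) = inj₁ (cong toℕ (trans (cong ν′ (toℕ-injective e)) ν′v≡a))
      ... | inj₂ (inj₂ vyb) = inj₂ (ordering (cyc 3F 2F 1F ⊃ cyc 0F 3F 1F ⊃ cyc 0F 2F 1F)
        (a ∷ b ∷ ν′ y ∷ v ∷ []) nc avb)
        where
        νy≡ν′y : ν y ≡ ν′ y
        νy≡ν′y = off (λ { refl → ¬cyc-xxy h }) (λ { refl → ¬cyc-xyy h })
                     (λ { refl → cyc-asym h bua }) (λ { refl → ¬cyc-xxy vyb })
        ν-v : ν v ≡ b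
        ν-v = trans (cong ν (sym νb≡v)) (ν.involutive b)
        nc : Cyc v (ν′ y) b
        nc = subst₂ (Cyc v) νy≡ν′y ν-v (ν.noncrossing (subst (Cyc v y) (sym ν-v) vyb))

      push : ∀ {y} → Arc a y b → Cyc a (σ y) b ⊎ toℕ (σ y) ≡ toℕ b
      push {y} y∈ = ordering
        (¬′ (0F ≐ 1F) ⊃ (2F ≐ 0F ∨ cyc 0F 2F 1F) ⊃ ¬′ (3F ≐ 2F) ⊃
         (cyc 2F 1F 3F ⊃ cyc 2F 0F 3F) ⊃ cyc 0F 3F 1F ∨ 3F ≐ 1F)
        (a ∷ b ∷ y ∷ σ y ∷ []) (≢ℕ a≢b) y∈ (≢ℕ (σ-moves y)) (proj₂ (a≋b y))

    -- Points of the old gap at b stay there. The others fill (a , b], on which μ = σ ν′ σ⁻ is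
    -- followed in three steps: `pull` leads into [a , b), `across` preserves it, and `push` returns
    -- to (a , b].
    gap-μ′ : ∀ {y} → Cyc a y (σ b) → Cyc a (μ y) (σ b)
    gap-μ′ {y} h with cyc? b y (σ b)
    ... | yes byσb = ordering
      (cyc 0F 3F 2F ⊃ ¬′ (0F ≐ 1F) ⊃ ¬′ cyc 1F 0F 2F ⊃ cyc 1F 4F 2F ⊃ cyc 0F 4F 2F)
      (a ∷ b ∷ σ b ∷ y ∷ μ y ∷ []) h (≢ℕ a≢b) ¬bab (gap-μ byσb)
    ... | no ¬byσb = ordering
      (¬′ (0F ≐ 1F) ⊃ ¬′ (2F ≐ 0F) ⊃ ¬′ (2F ≐ 1F) ⊃ ¬′ cyc 1F 0F 2F ⊃
       cyc 0F 3F 1F ∨ 3F ≐ 1F ⊃ cyc 0F 3F 2F)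
      (a ∷ b ∷ σ b ∷ μ y ∷ []) (≢ℕ a≢b) (≢ℕ σb≢a) (≢ℕ (σ-moves b)) ¬bab
      (subst (λ z → Cyc a z b ⊎ toℕ z ≡ toℕ b) (trans (conjugate _) (cong μ (σσ⁻ y)))
        (push (across (pull (λ { refl → ¬cyc-xyy h }) y∈))))
      where
      y∈ : Cyc a y b ⊎ y ≡ b
      y∈ with y ≟ b
      ... | yes e = inj₂ e
      ... | no  n = inj₁ (ordering
        (cyc 0F 3F 2F ⊃ ¬′ (3F ≐ 1F) ⊃ ¬′ (0F ≐ 1F) ⊃ ¬′ (2F ≐ 1F) ⊃ ¬′ cyc 1F 0F 2F ⊃ ¬′ cyc 1F 3F 2F ⊃ cyc 0F 3F 1F)
        (a ∷ b ∷ σ b ∷ y ∷ []) h (≢ℕ n) (≢ℕ a≢b) (≢ℕ (σ-moves b)) ¬bab ¬byσb)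

  module _ (flp : Flip ν ν′) (a≋b : Flip.a flp ≋ Flip.b flp) where
    open Flip flp renaming (μa to νa≡u; μb to νb≡v; νa to ν′a≡v; νb to ν′b≡u)
    private
      module A = Side flp a≋b
      module B = Side (flip-swap flp) (≋-sym a≋b)

      τ : Fin N → Fin N
      τ = transpose a b

      τ≋ : ∀ y → τ y ≋ y
      τ≋ = transpose-elim (λ y z → z ≋ y) (≋-sym a≋b) a≋b (λ _ _ → ≋-refl)

      u≢a : u ≢ a
      u≢a e = ν.fixpoint a (trans νa≡u e)
      v≢b : v ≢ b
      v≢b e = ν.fixpoint b (trans νb≡v e)
      u≢b : u ≢ b
      u≢b e = ν′.fixpoint b (trans ν′b≡u e)
      v≢a : v ≢ a
      v≢a e = ν′.fixpoint a (trans ν′a≡v e)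

      -- A flip exchanges the roles of a and b, that is, it is conjugation by their transposition;
      -- therefore σ ∘ τ conjugates ν to μ.
      τν : ∀ x → τ (ν x) ≡ ν′ (τ x)
      τν x with x ≟ u | x ≟ v
      ... | yes refl | _ = trans (cong τ (trans (cong ν (sym νa≡u)) (ν.involutive a)))
        (trans (transpose-left a b) (sym (trans (cong ν′ (transpose-fixes u≢a u≢b))
          (trans (cong ν′ (sym ν′b≡u)) (ν′.involutive b)))))
      ... | no _ | yes refl = trans (cong τ (trans (cong ν (sym νb≡v)) (ν.involutive b)))
        (trans (transpose-right a b) (sym (trans (cong ν′ (transpose-fixes v≢a v≢b))
          (trans (cong ν′ (sym ν′a≡v)) (ν′.involutive a)))))
      ... | no x≢u | no x≢v = transpose-elim (λ x y → x ≢ u → x ≢ v → τ (ν x) ≡ ν′ y)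
        (λ _ _ → trans (cong τ νa≡u) (trans (transpose-fixes u≢a u≢b) (sym ν′b≡u)))
        (λ _ _ → trans (cong τ νb≡v) (trans (transpose-fixes v≢a v≢b) (sym ν′a≡v)))
        (λ {x} x≢a x≢b x≢u x≢v → trans
          (transpose-fixes (λ e → x≢u (trans (sym (ν.involutive x)) (trans (cong ν e) νa≡u)))
                           (λ e → x≢v (trans (sym (ν.involutive x)) (trans (cong ν e) νb≡v))))
          (off x≢a x≢b x≢u x≢v)) x x≢u x≢v

      gap : ∀ {z x y} → (z ≢ a → z ≢ b → Cyc z x (σ z) → Cyc z y (σ z)) →
            (Cyc a x (σ b) → Cyc a y (σ b)) → (Cyc b x (σ a) → Cyc b y (σ a)) →
            Cyc z x (σ (τ z)) → Cyc z y (σ (τ z))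
      gap {z} {x} {y} other at-a at-b =
        transpose-elim (λ z w → (z ≢ a → z ≢ b → Cyc z x (σ z) → Cyc z y (σ z)) →
                          Cyc z x (σ w) → Cyc z y (σ w))
          (λ _ → at-a) (λ _ → at-b) (λ p q o → o p q) z other

    unflip : IsLink μ ν (σ ∘ transpose a b) (transpose a b ∘ σ⁻)
    unflip = record
      { σσ⁻       = λ x → trans (cong σ (transpose-involutive a b (σ⁻ x))) (σσ⁻ x)
      ; σ⁻σ       = λ x → trans (cong τ (σ⁻σ (τ x))) (transpose-involutive a b x)
      ; σ-moves   = transpose-elim (λ x y → σ y ≢ x) A.σb≢a B.σb≢a (λ _ _ → σ-moves _)
      ; conjugate = λ x → trans (cong σ (τν x)) (conjugate (τ x))
      ; gap-σ     = λ {z} {x} → gap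
          (λ _ _ h → gap-σ (proj₂ (τ≋ x z) h))
          (A.gap-στ B.σb≢a)
          (λ h → subst (λ w → Cyc b (σ w) (σ a)) (transpose-comm x) (B.gap-στ A.σb≢a h))
      ; gap-μ     = gap (λ _ _ → gap-μ) A.gap-μ′ B.gap-μ′
      }
      where
      transpose-comm : ∀ x → transpose b a x ≡ transpose a b x
      transpose-comm = transpose-elim (λ x y → transpose b a x ≡ y)
        (transpose-right b a) (transpose-left b a) (λ p q → transpose-fixes q p)

-- Noncrossing equivalences and their successor permutations

minimal : {P : Pred (Fin N) 0ℓ} → Decidable P → (f : Fin N → ℕ) → ∃ P →
          ∃[ x ] P x × (∀ y → P y → f x ≤ f y)
minimal {N} {P} P? f (x , px) = go (suc (f x)) x px ℕ.≤-refl
  where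
  go : ∀ b x → P x → f x < b → ∃[ x ] P x × (∀ y → P y → f x ≤ f y)
  go (suc b) x px (s≤s fx≤b) with any? (λ y → P? y ×-dec (f y ℕ.<? f x))
  ... | yes (y , py , fy<fx) = go b y py (ℕ.<-≤-trans fy<fx fx≤b)
  ... | no  none = x , px , λ y py → ℕ.≮⇒≥ λ lt → none (y , py , lt)

module _ {Q : Pred (Fin N) 0ℓ} (Q? : Decidable Q) (x : Fin N) (other : ∃[ y ] Q y × y ≢ x) where

  private
    -- These unroll the circle at x into a line, in either direction: points reached only after
    -- passing 0 are raised by N.
    after before : Fin N → ℕ
    after y with x Fin.<? y
    ... | yes _ = toℕ y
    ... | no  _ = N + toℕ y
    before y with y Fin.<? x
    ... | yes _ = N ∸ toℕ y
    ... | no  _ = N + (N ∸ toℕ y)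

    after-mono : ∀ {y z} → Cyc x y z → after y < after z
    after-mono {y} {z} h with x Fin.<? y | x Fin.<? z
    ... | yes p | yes q = proj₂ (cyc-<-middle q h)
    ... | yes p | no q  = ℕ.<-≤-trans (toℕ<n y) (ℕ.m≤m+n N _)
    ... | no p  | yes q = contradiction (proj₁ (cyc-<-middle q h)) p
    ... | no p  | no q  = ℕ.+-monoʳ-< N
      (ordering (cyc 0F 1F 2F ⊃ ¬′ (0F ≺ 1F) ⊃ 1F ≺ 2F) (x ∷ y ∷ z ∷ []) h p)

    before-mono : ∀ {y z} → Cyc z y x → before y < before z
    before-mono {y} {z} h with y Fin.<? x | z Fin.<? x
    ... | yes p | yes q = ℕ.∸-monoʳ-< (proj₁ (cyc-<-middle q h)) (ℕ.<⇒≤ (toℕ<n y))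
    ... | yes p | no q  = ℕ.≤-<-trans (ℕ.m∸n≤m N (toℕ y)) (ℕ.m<m+n N (ℕ.m<n⇒0<n∸m (toℕ<n z)))
    ... | no p  | yes q = contradiction (proj₂ (cyc-<-middle q h)) p
    ... | no p  | no q  = ℕ.+-monoʳ-< N (ℕ.∸-monoʳ-<
      (ordering (cyc 2F 1F 0F ⊃ ¬′ (1F ≺ 0F) ⊃ 2F ≺ 1F) (x ∷ y ∷ z ∷ []) h p) (ℕ.<⇒≤ (toℕ<n y)))

    Q≢x? : Decidable (λ y → Q y × y ≢ x)
    Q≢x? y = Q? y ×-dec ¬? (y ≟ x)

  abstract
    nearest-after : ∃[ a ] (Q a × a ≢ x) × (∀ {z} → Cyc x z a → ¬ Q z)
    nearest-after = let a , qa , min = minimal Q≢x? after other in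
      a , qa , λ {z} h qz → ℕ.<⇒≱ (after-mono h) (min z (qz , λ { refl → ¬cyc-xxy h }))

    nearest-before : ∃[ a ] (Q a × a ≢ x) × (∀ {z} → Cyc a z x → ¬ Q z)
    nearest-before = let a , qa , min = minimal Q≢x? before other in
      a , qa , λ {z} h qz → ℕ.<⇒≱ (before-mono h) (min z (qz , λ { refl → ¬cyc-xyy h }))

record Next (_∼_ : Rel (Fin N) 0ℓ) (x y : Fin N) : Set where
  constructor next
  field
    related  : x ∼ y
    distinct : x ≢ y
    between  : ∀ {z} → Cyc x z y → ¬ x ∼ z

next-unique : {_∼_ : Rel (Fin N) 0ℓ} {x y z : Fin N} → Next _∼_ x y → Next _∼_ x z → y ≡ z
next-unique {x = x} {y} {z} (next xy x≢y bxy) (next xz x≢z bxz) with y ≟ z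
... | yes e = e
... | no  n with cyc-total x≢z (n ∘ sym) x≢y
... | inj₁ h = ⊥-elim (bxy h xz)
... | inj₂ h = ⊥-elim (bxz (cyc-rotate (cyc-rotate h)) xy)

next-cong : {_∼_ _≋_ : Rel (Fin N) 0ℓ} → _∼_ ⇒ _≋_ → _≋_ ⇒ _∼_ →
            ∀ {x y} → Next _∼_ x y → Next _≋_ x y
next-cong to from (next r d b) = next (to r) d (λ h → b h ∘ from)

-- Each successor stays within the arc up to the next of the three points: A in (a , b], B in (b ,
-- c], C in (c , a].
next-cyc : {_∼_ : Rel (Fin N) 0ℓ} {a b c A B C : Fin N} →
           Next _∼_ a A → Next _∼_ b B → Next _∼_ c C → a ∼ b → b ∼ c → c ∼ a →
           Cyc a b c → Cyc A B C
next-cyc {a = a} {b} {c} {A} {B} {C} aA bB cC ab bc ca h = ordering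
  (cyc 0F 1F 2F ⊃ ¬′ (0F ≐ 3F) ⊃ ¬′ (1F ≐ 4F) ⊃ ¬′ (2F ≐ 5F) ⊃
   ¬′ cyc 0F 1F 3F ⊃ ¬′ cyc 1F 2F 4F ⊃ ¬′ cyc 2F 0F 5F ⊃ cyc 3F 4F 5F)
  (a ∷ b ∷ c ∷ A ∷ B ∷ C ∷ []) h
  (≢ℕ (Next.distinct aA)) (≢ℕ (Next.distinct bB)) (≢ℕ (Next.distinct cC))
  (λ k → Next.between aA k ab) (λ k → Next.between bB k bc) (λ k → Next.between cC k ca)

link-next : {μ ν σ σ⁻ : Fin N → Fin N} (i : IsNCInvolution μ) (l : IsLink μ ν σ σ⁻) →
            ∀ x → Next (Link._≋_ i l) x (σ x)
link-next i l x = next (≋σ x) (σ-moves x ∘ sym) (λ h e → gap-empty e h)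
  where open Link i l

record IsNCEquivalence (_∼_ : Rel (Fin N) 0ℓ) : Set where
  field
    isDecEquivalence : IsDecEquivalence _∼_
    noncrossing      : ∀ {a b c d} → Cyc a b c → Cyc c d a → a ∼ c → b ∼ d → a ∼ b
  open IsDecEquivalence isDecEquivalence public
    using (_≟_) renaming (refl to ∼-refl; sym to ∼-sym; trans to ∼-trans)

module Successor {_∼_ : Rel (Fin N) 0ℓ} (isNC : IsNCEquivalence _∼_)
                 {μ : Fin N → Fin N} (isInv : IsNCInvolution μ) (∼μ : ∀ x → x ∼ μ x) where

  open IsNCEquivalence isNC hiding (_≟_)
  private
    module E = IsNCEquivalence isNC
    module μ = IsNCInvolution isInv

    other : ∀ x → ∃[ y ] x ∼ y × y ≢ x
    other x = μ x , ∼μ x , μ.fixpoint x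

  σ σ⁻ : Fin N → Fin N
  σ x  = proj₁ (nearest-after (x E.≟_) x (other x))
  σ⁻ x = proj₁ (nearest-before (x E.≟_) x (other x))

  σ-next : ∀ x → Next _∼_ x (σ x)
  σ-next x = let _ , (r , d) , b = nearest-after (x E.≟_) x (other x) in next r (d ∘ sym) b

  σ⁻-next : ∀ x → Next _∼_ (σ⁻ x) x
  σ⁻-next x = let _ , (r , d) , b = nearest-before (x E.≟_) x (other x) in
    next (∼-sym r) d (λ h e → b h (∼-trans r e))

  private
    σσ⁻ : ∀ x → σ (σ⁻ x) ≡ x
    σσ⁻ x = next-unique (σ-next (σ⁻ x)) (σ⁻-next x)

    σ⁻σ : ∀ x → σ⁻ (σ x) ≡ x
    σ⁻σ x with σ⁻ (σ x) ≟ x | σ-next x | σ⁻-next (σ x)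
    ... | yes e | _ | _ = e
    ... | no  n | next xX x≢X bx | next yX y≢X by with cyc-total n x≢X y≢X
    ... | inj₁ h = ⊥-elim (by h (∼-trans yX (∼-sym xX)))
    ... | inj₂ h = ⊥-elim (bx (cyc-rotate h) (∼-trans xX (∼-sym yX)))

    -- If y were outside, the chords x-y and z-σ z would cross, so that x would belong to the block
    -- of z while lying in its gap.
    gap-closed : ∀ {z x y} → x ∼ y → Cyc z x (σ z) → Cyc z y (σ z)
    gap-closed {z} {x} {y} x∼y h with cyc? z y (σ z) | σ-next z
    ... | yes h′ | _ = h′
    ... | no  n  | next zZ z≢Z bz = ⊥-elim (bz h (noncrossing h
      (ordering (cyc 0F 1F 3F ⊃ ¬′ cyc 0F 2F 3F ⊃ ¬′ (2F ≐ 0F) ⊃ ¬′ (2F ≐ 3F) ⊃ cyc 3F 2F 0F)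
        (z ∷ x ∷ y ∷ σ z ∷ []) h n
        (≢ℕ λ { refl → bz h (∼-sym x∼y) }) (≢ℕ λ { refl → bz h (∼-trans zZ (∼-sym x∼y)) }))
      zZ x∼y))

  ν : Fin N → Fin N
  ν = σ⁻ ∘ μ ∘ σ

  link : IsLink μ ν σ σ⁻
  link = record
    { σσ⁻       = σσ⁻
    ; σ⁻σ       = σ⁻σ
    ; σ-moves   = λ x → Next.distinct (σ-next x) ∘ sym
    ; conjugate = λ x → σσ⁻ (μ (σ x))
    ; gap-σ     = gap-closed (Next.related (σ-next _))
    ; gap-μ     = gap-closed (∼μ _)
    }

  ∼⇒≋ : _∼_ ⇒ Link._≋_ isInv link
  ∼⇒≋ e z = gap-closed e , gap-closed (∼-sym e)

  ∼ν : ∀ x → x ∼ ν x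
  ∼ν x = ∼-trans (∼-trans (Next.related (σ-next x)) (∼μ (σ x))) (∼-sym (Next.related (σ⁻-next _)))

  private
    open Link isInv link using (conjugate)

    σ-cyc : ∀ {a b c} → a ∼ b → b ∼ c → Cyc a b c → Cyc (σ a) (σ b) (σ c)
    σ-cyc ab bc = next-cyc (σ-next _) (σ-next _) (σ-next _) ab bc (∼-sym (∼-trans ab bc))

  ν-isNC : IsNCInvolution ν
  ν-isNC = record
    { involutive  = inv
    ; fixpoint    = λ x e → μ.fixpoint (σ x) (trans (sym (conjugate x)) (cong σ e))
    ; noncrossing = nc
    }
    where
    inv : ∀ x → ν (ν x) ≡ x
    inv x = trans (cong (σ⁻ ∘ μ) (conjugate x)) (trans (cong σ⁻ (μ.involutive (σ x))) (σ⁻σ x))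

    -- Crossing pairs of ν would have all four points in one class, because the classes do not
    -- cross. There σ preserves the cyclic order and would carry the crossing over to μ.
    nc : ∀ {x y} → Cyc x y (ν x) → Cyc x (ν y) (ν x)
    nc {x} {y} h with cyc? x (ν y) (ν x)
    ... | yes h′ = h′
    ... | no  n  = ⊥-elim (cyc-asym
      (μ.noncrossing (subst (Cyc (σ x) (σ y)) (conjugate x) (σ-cyc xy (∼-trans (∼-sym xy) (∼ν x)) h)))
      (subst₂ (λ w v → Cyc w v (σ x)) (conjugate x) (conjugate y)
        (σ-cyc (∼-trans (∼-sym (∼ν x)) (∼-trans xy (∼ν y))) (∼-sym (∼-trans xy (∼ν y))) back)))
      where
      back : Cyc (ν x) (ν y) x
      back = ordering (cyc 0F 1F 2F ⊃ ¬′ cyc 0F 3F 2F ⊃ ¬′ (3F ≐ 0F) ⊃ ¬′ (3F ≐ 2F) ⊃ cyc 2F 3F 0F)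
        (x ∷ y ∷ ν x ∷ ν y ∷ []) h n
        (≢ℕ λ e → ¬cyc-xyy (subst (Cyc x y) (trans (cong ν (sym e)) (inv y)) h))
        (≢ℕ λ e → ¬cyc-xxy (subst (λ z → Cyc z y (ν x)) (trans (sym (inv x)) (trans (cong ν (sym e)) (inv y))) h))
      xy : x ∼ y
      xy = noncrossing h back (∼ν x) (∼ν y)

-- As the classes of p and q do not cross, their union is, in cyclic order, one run of each. The
-- points a and b are the last ones of the runs of p and of q. There, and only there, σQ passes from
-- one class to the other, and swapping the two passages closes each run.
module Merge {P Q : Rel (Fin N) 0ℓ} (P-nc : IsNCEquivalence P) (Q-nc : IsNCEquivalence Q)
  {σP σQ : Fin N → Fin N} (P-next : ∀ x → Next P x (σP x)) (Q-next : ∀ x → Next Q x (σQ x))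
  (σQ-injective : ∀ {x y} → σQ x ≡ σQ y → x ≡ y)
  (P⇒Q : P ⇒ Q) {p q : Fin N} (¬Ppq : ¬ P p q) (Qpq : Q p q)
  (Q⇒P+pq : ∀ {x y} → Q x y → P x y ⊎ (P x p × P q y) ⊎ (P x q × P p y)) where

  private
    module P = IsNCEquivalence P-nc
    module Q = IsNCEquivalence Q-nc

    before-q = nearest-before (p P.≟_) q (p , P.∼-refl , λ { refl → ¬Ppq P.∼-refl })

  a : Fin N
  a = proj₁ before-q

  private
    Ppa : P p a
    Ppa = proj₁ (proj₁ (proj₂ before-q))

    apart : ∀ {x y} → P p x → P q y → x ≢ y
    apart px qy refl = ¬Ppq (P.∼-trans px (P.∼-sym qy))

    before-a = nearest-before (q P.≟_) a (q , P.∼-refl , apart Ppa P.∼-refl ∘ sym)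

  b : Fin N
  b = proj₁ before-a

  private
    Pqb : P q b
    Pqb = proj₁ (proj₁ (proj₂ before-a))

    ¬-aq : ∀ {z} → P p z → ¬ Cyc a z q
    ¬-aq pz h = proj₂ (proj₂ before-q) h pz

    ¬-ba : ∀ {z} → P q z → ¬ Cyc b z a
    ¬-ba qz h = proj₂ (proj₂ before-a) h qz

    module σQ x = Next (Q-next x)

    Q-p : ∀ {x} → P p x → Q p x
    Q-p = P⇒Q
    Q-q : ∀ {x} → P q x → Q p x
    Q-q qx = Q.∼-trans Qpq (P⇒Q qx)

    ¬gap : ∀ {x y} → Q p x → Q p y → ¬ Cyc x y (σQ x)
    ¬gap px py h = σQ.between _ h (Q.∼-trans (Q.∼-sym px) py)

    split : ∀ {x} → Q p x → P p x ⊎ P q x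
    split px with Q⇒P+pq px
    ... | inj₁ h = inj₁ h
    ... | inj₂ (inj₁ (_ , h)) = inj₂ h
    ... | inj₂ (inj₂ (h , _)) = ⊥-elim (¬Ppq h)

    Q-σQ : ∀ {x} → Q p x → Q p (σQ x)
    Q-σQ px = Q.∼-trans px (σQ.related _)

    past : ∀ {x y z : Fin N} → z ≢ x → z ≢ y → y ≢ x → ¬ Cyc x z y → Cyc x y z
    past {x} {y} {z} p q r = ordering
      (¬′ (2F ≐ 0F) ⊃ ¬′ (2F ≐ 1F) ⊃ ¬′ (1F ≐ 0F) ⊃ ¬′ cyc 0F 2F 1F ⊃ cyc 0F 1F 2F)
      (x ∷ y ∷ z ∷ []) (≢ℕ p) (≢ℕ q) (≢ℕ r)

    q-σa : P q (σQ a)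
    q-σa with split (Q-σQ (Q-p Ppa))
    ... | inj₂ h = h
    ... | inj₁ h = ⊥-elim (¬gap (Q-p Ppa) Qpq (past (σQ.distinct a ∘ sym)
      (apart h P.∼-refl) (apart Ppa P.∼-refl ∘ sym) (¬-aq h)))

    p-σb : P p (σQ b)
    p-σb with split (Q-σQ (Q-q Pqb))
    ... | inj₁ h = h
    ... | inj₂ h = ⊥-elim (¬gap (Q-q Pqb) (Q-p Ppa) (past (σQ.distinct b ∘ sym)
      (apart Ppa h ∘ sym) (apart Ppa Pqb) (¬-ba h)))

    crossed : ∀ {z} → P p z → Cyc a q z → Cyc z b a → ⊥
    crossed pz h h′ = ¬Ppq (P.∼-trans Ppa
      (P.noncrossing h h′ (P.∼-trans (P.∼-sym Ppa) pz) Pqb))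

    σP-a : Next P a (σQ b)
    σP-a = next (P.∼-trans (P.∼-sym Ppa) p-σb) a≢σb none
      where
      a≢σb : a ≢ σQ b
      a≢σb e = let h , h′ = ordering
                     (¬′ (1F ≐ 0F) ⊃ ¬′ (1F ≐ 2F) ⊃ ¬′ (1F ≐ 3F) ⊃ ¬′ (0F ≐ 2F) ⊃ ¬′ (0F ≐ 3F) ⊃
                      ¬′ cyc 0F 1F 2F ⊃ ¬′ cyc 3F 1F 0F ⊃ cyc 0F 2F 1F ∧ cyc 1F 3F 0F)
                     (a ∷ σP a ∷ q ∷ b ∷ []) (≢ℕ (Next.distinct (P-next a) ∘ sym))
                     (≢ℕ (apart pσ P.∼-refl)) (≢ℕ (apart pσ Pqb)) (≢ℕ (apart Ppa P.∼-refl))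
                     (≢ℕ (apart Ppa Pqb)) (¬-aq pσ)
                     (subst (λ z → ¬ Cyc b (σP a) z) (sym e) (¬gap (Q-q Pqb) (Q-p pσ)))
               in crossed pσ h h′
        where
        pσ : P p (σP a)
        pσ = P.∼-trans Ppa (Next.related (P-next a))

      none : ∀ {z} → Cyc a z (σQ b) → ¬ P a z
      none {z} h az = let h₁ , h₂ = ordering
                            (cyc 0F 4F 3F ⊃ ¬′ cyc 0F 4F 1F ⊃ ¬′ (4F ≐ 1F) ⊃ ¬′ (4F ≐ 2F) ⊃ ¬′ (2F ≐ 0F) ⊃ ¬′ (1F ≐ 0F) ⊃
                             ¬′ (3F ≐ 2F) ⊃ ¬′ cyc 2F 4F 3F ⊃ ¬′ cyc 2F 0F 3F ⊃ cyc 0F 1F 4F ∧ cyc 4F 2F 0F)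
                            (a ∷ q ∷ b ∷ σQ b ∷ z ∷ []) h (¬-aq pz) (≢ℕ (apart pz P.∼-refl)) (≢ℕ (apart pz Pqb))
                            (≢ℕ (apart Ppa Pqb ∘ sym)) (≢ℕ (apart Ppa P.∼-refl ∘ sym)) (≢ℕ (σQ.distinct b ∘ sym))
                            (¬gap (Q-q Pqb) (Q-p pz)) (¬gap (Q-q Pqb) (Q-p Ppa))
                      in crossed pz h₁ h₂
        where
        pz : P p z
        pz = P.∼-trans Ppa az

    σP-b : Next P b (σQ a)
    σP-b = next (P.∼-trans (P.∼-sym Pqb) q-σa) b≢σa none
      where
      b≢σa : b ≢ σQ a
      b≢σa e = ordering
        (¬′ (2F ≐ 0F) ⊃ ¬′ (2F ≐ 1F) ⊃ ¬′ (0F ≐ 1F) ⊃ ¬′ cyc 1F 2F 0F ⊃ ¬′ cyc 0F 2F 1F ⊃ false′)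
        (a ∷ b ∷ σP b ∷ []) (≢ℕ (apart Ppa qσ ∘ sym)) (≢ℕ (Next.distinct (P-next b) ∘ sym))
        (≢ℕ (apart Ppa Pqb)) (¬-ba qσ)
        (subst (λ z → ¬ Cyc a (σP b) z) (sym e) (¬gap (Q-p Ppa) (Q-q qσ)))
        where
        qσ : P q (σP b)
        qσ = P.∼-trans Pqb (Next.related (P-next b))

      none : ∀ {z} → Cyc b z (σQ a) → ¬ P b z
      none {z} h bz = ordering
        (cyc 1F 3F 2F ⊃ ¬′ cyc 1F 3F 0F ⊃ ¬′ (3F ≐ 0F) ⊃ ¬′ (0F ≐ 1F) ⊃ ¬′ cyc 0F 1F 2F ⊃ ¬′ cyc 0F 3F 2F ⊃ ¬′ (2F ≐ 0F) ⊃ false′)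
        (a ∷ b ∷ σQ a ∷ z ∷ []) h (¬-ba qz) (≢ℕ (apart Ppa qz ∘ sym)) (≢ℕ (apart Ppa Pqb))
        (¬gap (Q-p Ppa) (Q-q Pqb)) (¬gap (Q-p Ppa) (Q-q qz)) (≢ℕ (σQ.distinct a ∘ sym))
        where
        qz : P q z
        qz = P.∼-trans Pqb bz

    -- The arcs from x to σQ x and from y to σQ y contain no other points of the merged class, so
    -- x-y and σQ x-σQ y are crossing chords unless all four are P-related. With y taken as a or b,
    -- this excludes a second passage in the same direction.
    arcs-cross : ∀ {x y} → Q p x → Q p y → x ≢ y → P x y → P (σQ x) (σQ y) → P x (σQ x)
    arcs-cross {x} {y} px py x≢y xy XY with x P.≟ σQ x
    ... | yes h = h
    ... | no  n = let h₁ , h₂ = ordering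
                        (¬′ (0F ≐ 2F) ⊃ ¬′ (1F ≐ 3F) ⊃ ¬′ (0F ≐ 3F) ⊃ ¬′ (1F ≐ 2F) ⊃ ¬′ (0F ≐ 1F) ⊃ ¬′ (2F ≐ 3F) ⊃
                         ¬′ cyc 0F 2F 1F ⊃ ¬′ cyc 0F 3F 1F ⊃ ¬′ cyc 2F 0F 3F ⊃ ¬′ cyc 2F 1F 3F ⊃
                         cyc 0F 1F 2F ∧ cyc 2F 3F 0F)
                        (x ∷ σQ x ∷ y ∷ σQ y ∷ []) (≢ℕ x≢y) (≢ℕ (x≢y ∘ σQ-injective))
                        (≢ℕ λ e → n (subst (λ z → P z (σQ x)) (sym e) (P.∼-sym XY)))
                        (≢ℕ λ e → n (subst (P x) (sym e) xy)) (≢ℕ (σQ.distinct x)) (≢ℕ (σQ.distinct y))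
                        (¬gap px py) (¬gap px (Q-σQ py)) (¬gap py px) (¬gap py (Q-σQ px))
                  in P.noncrossing h₁ h₂ xy XY

    σP-other : ∀ {x} → x ≢ a → x ≢ b → Next P x (σQ x)
    σP-other {x} x≢a x≢b = next rel (σQ.distinct x) (λ h → σQ.between x h ∘ P⇒Q)
      where
      rel : P x (σQ x)
      rel with Q⇒P+pq (σQ.related x)
      ... | inj₁ h = h
      ... | inj₂ (inj₁ (xp , qy)) = arcs-cross (Q-p (P.∼-sym xp)) (Q-p Ppa) x≢a
        (P.∼-trans xp Ppa) (P.∼-trans (P.∼-sym qy) q-σa)
      ... | inj₂ (inj₂ (xq , py)) = arcs-cross (Q-q (P.∼-sym xq)) (Q-q Pqb) x≢b
        (P.∼-trans xq Pqb) (P.∼-trans (P.∼-sym py) p-σb)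

  ¬Pab : ¬ P a b
  ¬Pab h = ¬Ppq (P.∼-trans Ppa (P.∼-trans h (P.∼-sym Pqb)))

  successor-transpose : ∀ x → σP x ≡ σQ (transpose a b x)
  successor-transpose = transpose-elim (λ x y → σP x ≡ σQ y)
    (next-unique (P-next a) σP-a) (next-unique (P-next b) σP-b)
    (λ x≢a x≢b → next-unique (P-next _) (σP-other x≢a x≢b))

-- Counting classes

∣p∣≤1+∣q∣ : (p q : Subset N) (x : Fin N) → (∀ {y} → y ∈ˢ p → y ≢ x → y ∈ˢ q) → ∣ p ∣ ≤ suc ∣ q ∣
∣p∣≤1+∣q∣ (outside ∷ p) (t ∷ q) zero h = ℕ.m≤n⇒m≤1+n (ℕ.≤-trans
  (p⊆q⇒∣p∣≤∣q∣ λ y∈ → drop-there (h (there y∈) λ ())) (∣p∣≤∣x∷p∣ t q))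
∣p∣≤1+∣q∣ (inside  ∷ p) (t ∷ q) zero h = s≤s (ℕ.≤-trans
  (p⊆q⇒∣p∣≤∣q∣ λ y∈ → drop-there (h (there y∈) λ ())) (∣p∣≤∣x∷p∣ t q))
∣p∣≤1+∣q∣ (outside ∷ p) (t ∷ q) (suc x) h = ℕ.≤-trans
  (∣p∣≤1+∣q∣ p q x λ y∈ y≢x → drop-there (h (there y∈) (y≢x ∘ Fin.suc-injective)))
  (s≤s (∣p∣≤∣x∷p∣ t q))
∣p∣≤1+∣q∣ (inside  ∷ p) (inside ∷ q) (suc x) h = s≤s
  (∣p∣≤1+∣q∣ p q x λ y∈ y≢x → drop-there (h (there y∈) (y≢x ∘ Fin.suc-injective)))
∣p∣≤1+∣q∣ (inside  ∷ p) (outside ∷ q) (suc x) h = contradiction (h here λ ()) λ ()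

module _ {_∼_ : Rel (Fin N) 0ℓ} (isDecEq : IsDecEquivalence _∼_) where

  private module E = IsDecEquivalence isDecEq

  -- Classes are counted by their least elements: the leaders of a coarser relation are among those
  -- of a finer one, so counts compare by inclusion of subsets.
  IsLeader : Pred (Fin N) 0ℓ
  IsLeader x = ∀ y → y ∼ x → toℕ x ≤ toℕ y

  isLeader? : Decidable IsLeader
  isLeader? x = all? λ y → (y E.≟ x) →-dec (x Fin.≤? y)

  leaders : Subset N
  leaders = comprehension isLeader?

  ∣classes∣ : ℕ
  ∣classes∣ = ∣ leaders ∣

  abstract
    leader : ∀ x → ∃[ y ] y ∼ x × IsLeader y
    leader x = let m , m∼x , least = minimal (E._≟ x) toℕ (x , E.refl) in
      m , m∼x , λ y y∼m → least y (E.trans y∼m m∼x)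

  leader-unique : ∀ {x y} → IsLeader x → IsLeader y → x ∼ y → x ≡ y
  leader-unique lx ly x∼y = toℕ-injective (ℕ.≤-antisym (lx _ (E.sym x∼y)) (ly _ x∼y))

  module Glue (a b : Fin N) where

    private
      redirect : Fin N → Fin N
      redirect x with x E.≟ b
      ... | yes _ = a
      ... | no  _ = x

    -- Pulling back along a map that sends the class of b to a gives the equivalence laws and
    -- decidability for free.
    Glued : Rel (Fin N) 0ℓ
    Glued = _∼_ on redirect

    glued-isDecEquivalence : IsDecEquivalence Glued
    glued-isDecEquivalence = On.isDecEquivalence redirect isDecEq

    glued : Glued a b
    glued with a E.≟ b | b E.≟ b
    ... | yes _ | yes _ = E.refl
    ... | no _  | yes _ = E.refl
    ... | _     | no n  = ⊥-elim (n E.refl)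

    ∼⇒glued : _∼_ ⇒ Glued
    ∼⇒glued {x} {y} h with x E.≟ b | y E.≟ b
    ... | yes _ | yes _ = E.refl
    ... | yes p | no n  = ⊥-elim (n (E.trans (E.sym h) p))
    ... | no n  | yes p = ⊥-elim (n (E.trans h p))
    ... | no _  | no _  = h

    glued-elim : ∀ {x y} → Glued x y → x ∼ y ⊎ (x ∼ a × b ∼ y) ⊎ (x ∼ b × a ∼ y)
    glued-elim {x} {y} h with x E.≟ b | y E.≟ b
    ... | yes p | yes q = inj₁ (E.trans p (E.sym q))
    ... | yes p | no _  = inj₂ (inj₂ (p , h))
    ... | no _  | yes q = inj₂ (inj₁ (h , E.sym q))
    ... | no _  | no _  = inj₁ h

module _ {E F : Rel (Fin N) 0ℓ} (E-eq : IsDecEquivalence E) (F-eq : IsDecEquivalence F) (E⇒F : E ⇒ F) where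

  private
    module E = IsDecEquivalence E-eq
    module F = IsDecEquivalence F-eq

    leaders-⊆ : leaders F-eq ⊆ˢ leaders E-eq
    leaders-⊆ x∈ = ∈-comprehension⁺ (isLeader? E-eq)
      (λ y e → ∈-comprehension⁻ (isLeader? F-eq) x∈ y (E⇒F e))

  ∣classes∣-anti : ∣classes∣ F-eq ≤ ∣classes∣ E-eq
  ∣classes∣-anti = p⊆q⇒∣p∣≤∣q∣ leaders-⊆

  -- The leaders of the two joined E-classes fall into one F-class, so at least one of them ceases
  -- to lead.
  ∣classes∣-strict : ∀ {x y} → F x y → ¬ E x y → ∣classes∣ F-eq < ∣classes∣ E-eq
  ∣classes∣-strict {x} {y} Fxy ¬Exy with leader E-eq x | leader E-eq y
  ... | m , mx , lm | w , wy , lw with isLeader? F-eq m | isLeader? F-eq w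
  ... | no n  | _     = p⊂q⇒∣p∣<∣q∣ (leaders-⊆ , m , ∈-comprehension⁺ (isLeader? E-eq) lm ,
                          n ∘ ∈-comprehension⁻ (isLeader? F-eq))
  ... | yes _ | no n  = p⊂q⇒∣p∣<∣q∣ (leaders-⊆ , w , ∈-comprehension⁺ (isLeader? E-eq) lw ,
                          n ∘ ∈-comprehension⁻ (isLeader? F-eq))
  ... | yes p | yes q with refl ← leader-unique F-eq p q (F.trans (E⇒F mx) (F.trans Fxy (F.sym (E⇒F wy))))
    = ⊥-elim (¬Exy (E.trans (E.sym mx) wy))

  ∣classes∣-≡⇒⊇ : ∣classes∣ E-eq ≤ ∣classes∣ F-eq → F ⇒ E
  ∣classes∣-≡⇒⊇ le {x} {y} Fxy with x E.≟ y
  ... | yes e = e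
  ... | no  n = ⊥-elim (ℕ.<⇒≱ (∣classes∣-strict Fxy n) le)

∣classes∣-cong : {E F : Rel (Fin N) 0ℓ} (E-eq : IsDecEquivalence E) (F-eq : IsDecEquivalence F) →
                 E ⇒ F → F ⇒ E → ∣classes∣ E-eq ≡ ∣classes∣ F-eq
∣classes∣-cong E-eq F-eq E⇒F F⇒E = ℕ.≤-antisym (∣classes∣-anti F-eq E-eq F⇒E) (∣classes∣-anti E-eq F-eq E⇒F)

∣classes∣-total : {E : Rel (Fin N) 0ℓ} (E-eq : IsDecEquivalence E) → (∀ x y → E x y) → ∣classes∣ E-eq ≤ 1
∣classes∣-total {zero}  E-eq total = z≤n
∣classes∣-total {suc N} E-eq total = subst (∣classes∣ E-eq ≤_) (∣⁅x⁆∣≡1 {suc N} zero)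
  (p⊆q⇒∣p∣≤∣q∣ {q = ⁅ zero ⁆} λ {x} x∈ → subst (_∈ˢ ⁅ zero ⁆)
    (sym (toℕ-injective (ℕ.n≤0⇒n≡0 (∈-comprehension⁻ (isLeader? E-eq) x∈ zero (total zero x))))) (x∈⁅x⁆ zero))

-- Gluing can dethrone only the larger of the two leaders.
∣classes∣-glue : {E : Rel (Fin N) 0ℓ} (E-eq : IsDecEquivalence E) (a b : Fin N) →
  ∣classes∣ E-eq ≤ suc (∣classes∣ (Glue.glued-isDecEquivalence E-eq a b))
∣classes∣-glue E-eq a b with leader E-eq a | leader E-eq b
... | la , la∼a , lla | lb , lb∼b , llb = ∣p∣≤1+∣q∣ (leaders E-eq) (leaders J.glued-isDecEquivalence) m
  λ x∈ x≢m → ∈-comprehension⁺ (isLeader? J.glued-isDecEquivalence)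
    (λ y → stays (∈-comprehension⁻ (isLeader? E-eq) x∈) x≢m y)
  where
  module E = IsDecEquivalence E-eq
  module J = Glue E-eq a b

  larger : ∃[ m ] (m ≡ la × toℕ lb ≤ toℕ la ⊎ m ≡ lb × toℕ la ≤ toℕ lb)
  larger with ℕ.≤-total (toℕ la) (toℕ lb)
  ... | inj₁ h = lb , inj₂ (refl , h)
  ... | inj₂ h = la , inj₁ (refl , h)

  m = proj₁ larger

  stays : ∀ {x} → IsLeader E-eq x → x ≢ m → IsLeader J.glued-isDecEquivalence x
  stays {x} lx x≢m y h with J.glued-elim h
  ... | inj₁ e = lx y e
  ... | inj₂ (inj₁ (ya , bx)) with leader-unique E-eq lx llb (E.trans (E.sym bx) (E.sym lb∼b)) | proj₂ larger
  ... | refl | inj₁ (_ , lb≤la) = ℕ.≤-trans lb≤la (lla y (E.trans ya (E.sym la∼a)))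
  ... | refl | inj₂ (m≡lb , _)  = ⊥-elim (x≢m (sym m≡lb))
  stays {x} lx x≢m y h | inj₂ (inj₂ (yb , ax))
    with leader-unique E-eq lx lla (E.trans (E.sym ax) (E.sym la∼a)) | proj₂ larger
  ... | refl | inj₂ (_ , la≤lb) = ℕ.≤-trans la≤lb (llb y (E.trans yb (E.sym lb∼b)))
  ... | refl | inj₁ (m≡la , _)  = ⊥-elim (x≢m (sym m≡la))

glue-monotone : {E F : Rel (Fin N) 0ℓ} (E-eq : IsDecEquivalence E) (F-eq : IsDecEquivalence F) (a b : Fin N) →
  E ⇒ Glue.Glued F-eq a b → Glue.Glued E-eq a b ⇒ Glue.Glued F-eq a b
glue-monotone E-eq F-eq a b E⇒J h with Glue.glued-elim E-eq a b h
... | inj₁ e = E⇒J e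
... | inj₂ (inj₁ (e , f)) = J.trans (E⇒J e) (J.trans (Glue.glued F-eq a b) (E⇒J f))
  where module J = IsDecEquivalence (Glue.glued-isDecEquivalence F-eq a b)
... | inj₂ (inj₂ (e , f)) = J.trans (E⇒J e) (J.trans (J.sym (Glue.glued F-eq a b)) (E⇒J f))
  where module J = IsDecEquivalence (Glue.glued-isDecEquivalence F-eq a b)

-- Loops of two involutions, and how an exchange changes their number

Meander : (μ ν : Fin N → Fin N) → Rel (Fin N) 0ℓ
Meander μ ν = EqClosure (λ x y → y ≡ μ x ⊎ y ≡ ν x)

meander-isDecEquivalence : (μ ν : Fin N → Fin N) → IsDecEquivalence (Meander μ ν)
meander-isDecEquivalence {N} μ ν = record
  { isEquivalence = EqC.isEquivalence _
  ; _≟_           = eqClosure? _≟_ (λ x y → (y ≟ μ x) ⊎-dec (y ≟ ν x)) (allFin N) ∈-allFin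
  }

∣loops∣ : (μ ν : Fin N → Fin N) → ℕ
∣loops∣ μ ν = ∣classes∣ (meander-isDecEquivalence μ ν)

meanderˡ : {μ ν : Fin N → Fin N} → ∀ x → Meander μ ν x (μ x)
meanderˡ x = EqC.return (inj₁ refl)

meanderʳ : {μ ν : Fin N → Fin N} → ∀ x → Meander μ ν x (ν x)
meanderʳ x = EqC.return (inj₂ refl)

meander-fold : {μ ν : Fin N → Fin N} {_∼_ : Rel (Fin N) 0ℓ} → IsEquivalence _∼_ →
               (∀ x → x ∼ μ x) → (∀ x → x ∼ ν x) → Meander μ ν ⇒ _∼_
meander-fold isEq ∼μ ∼ν = EqC.fold isEq λ { (inj₁ refl) → ∼μ _ ; (inj₂ refl) → ∼ν _ }

exchange-sym : {μ ν : Fin N → Fin N} → Exchange μ ν → Exchange ν μ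
exchange-sym e = record
  { a = a ; u = v ; b = b ; v = u ; μa = νa ; μb = νb ; νa = μa ; νb = μb
  ; off = λ p q r s → sym (off p q s r) }
  where open Exchange e

module _ {μ ν ν′ : Fin N → Fin N} (ν-inv : IsNCInvolution ν) (ex : Exchange ν ν′) where

  open Exchange ex renaming (μa to νa≡u; μb to νb≡v; νa to ν′a≡v; νb to ν′b≡u)
  private
    module ν = IsNCInvolution ν-inv
    D = meander-isDecEquivalence μ ν′
    module J = Glue D a b
    module JE = IsDecEquivalence J.glued-isDecEquivalence

    to : ∀ x {y} → y ≡ ν′ x → J.Glued x y
    to x refl = J.∼⇒glued (meanderʳ x)

    au : J.Glued a (ν a)
    au = JE.trans J.glued (to b (trans νa≡u (sym ν′b≡u)))

    bv : J.Glued b (ν b)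
    bv = JE.trans (JE.sym J.glued) (to a (trans νb≡v (sym ν′a≡v)))

    ∼ν : ∀ x → J.Glued x (ν x)
    ∼ν x with x ≟ a | x ≟ b | x ≟ u | x ≟ v
    ... | yes refl | _ | _ | _ = au
    ... | no _ | yes refl | _ | _ = bv
    ... | no _ | no _ | yes refl | _ =
      subst (J.Glued u) (trans (sym (ν.involutive a)) (cong ν νa≡u)) (JE.sym (subst (J.Glued a) νa≡u au))
    ... | no _ | no _ | no _ | yes refl =
      subst (J.Glued v) (trans (sym (ν.involutive b)) (cong ν νb≡v)) (JE.sym (subst (J.Glued b) νb≡v bv))
    ... | no x≢a | no x≢b | no x≢u | no x≢v = to x (off x≢a x≢b x≢u x≢v)

  -- Once a and b are identified, the old pairs {a , u}, {b , v} and the new pairs {a , v}, {b , u}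
  -- connect the same points.
  exchange-glued : Meander μ ν ⇒ J.Glued
  exchange-glued = meander-fold JE.isEquivalence (J.∼⇒glued ∘ meanderˡ) ∼ν

module _ {μ ν ν′ : Fin N → Fin N} (ν-inv : IsNCInvolution ν) (ν′-inv : IsNCInvolution ν′)
         (ex : Exchange ν ν′) where

  open Exchange ex using (a; b)
  private
    D D′ : IsDecEquivalence _
    D  = meander-isDecEquivalence μ ν
    D′ = meander-isDecEquivalence μ ν′

    J⇒J : Glue.Glued D′ a b ⇒ Glue.Glued D a b
    J⇒J = glue-monotone D′ D a b (exchange-glued ν′-inv (exchange-sym ex))

  -- Gluing a and b costs at most one loop of μ and ν, and the result is at least as coarse as the
  -- loops of μ and ν′.
  loops-step : ∣loops∣ μ ν ≤ suc (∣loops∣ μ ν′)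
  loops-step = ℕ.≤-trans (∣classes∣-glue D a b) (s≤s (ℕ.≤-trans
    (∣classes∣-anti (Glue.glued-isDecEquivalence D′ a b) (Glue.glued-isDecEquivalence D a b) J⇒J)
    (∣classes∣-anti D′ (Glue.glued-isDecEquivalence D′ a b) (Glue.∼⇒glued D′ a b))))

  -- Were a and b not connected, joining them would lose a loop of μ and ν′,
  -- leaving too few for the loops of μ and ν.
  loops-drop : ∣loops∣ μ ν′ < ∣loops∣ μ ν → Meander μ ν′ a b
  loops-drop drop with IsDecEquivalence._≟_ D′ a b
  ... | yes h = h
  ... | no  n = ⊥-elim (ℕ.<⇒≱ drop (ℕ.≤-trans (∣classes∣-glue D a b) (ℕ.≤-trans
    (s≤s (∣classes∣-anti (Glue.glued-isDecEquivalence D′ a b) (Glue.glued-isDecEquivalence D a b) J⇒J))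
    (∣classes∣-strict D′ (Glue.glued-isDecEquivalence D′ a b) (Glue.∼⇒glued D′ a b) (Glue.glued D′ a b) n))))

-- Rotation, and necklaces as sequences of involutions

Full : Rel (Fin N) 0ℓ
Full _ _ = ⊤

module Rotation (N : ℕ) .{{_ : NonZero N}} (1<N : 1 < N) where

  c⁻ : Fin N → Fin N
  c⁻ x = x ⊕ -1ℤ

  private
    %-small : ∀ {m n} .{{_ : NonZero n}} → m < n → +ℤ m ℤ.%ℕ n ≡ m
    %-small = m<n⇒m%n≡m

    -1%ℕ : ∀ n .{{_ : NonZero n}} → 1 < n → suc (-1ℤ ℤ.%ℕ n) ≡ n
    -1%ℕ (suc (suc n)) _ = refl
    -1%ℕ (suc zero) (s≤s ())

  toℕ-c⁻ : ∀ x → toℕ x ≡ suc (toℕ (c⁻ x)) ⊎ toℕ x ≡ 0 × suc (toℕ (c⁻ x)) ≡ N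
  toℕ-c⁻ x with toℕ x | toℕ<n x | toℕ-fromℕ< (n%ℕd<d (+ℤ toℕ x ℤ.+ -1ℤ) N)
  ... | zero  | _     | e = inj₂ (refl , trans (cong suc e) (-1%ℕ N 1<N))
  ... | suc m | 1+m<N | e = inj₁ (cong suc (sym (trans e (%-small (ℕ.<-trans (ℕ.n<1+n m) 1+m<N)))))

  c : Fin N → Fin N
  c x with suc (toℕ x) ℕ.<? N
  ... | yes p = fromℕ< p
  ... | no  _ = fromℕ< (>-nonZero⁻¹ N)

  toℕ-c : ∀ x → toℕ (c x) ≡ suc (toℕ x) ⊎ toℕ (c x) ≡ 0 × suc (toℕ x) ≡ N
  toℕ-c x with suc (toℕ x) ℕ.<? N
  ... | yes p = inj₁ (toℕ-fromℕ< p)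
  ... | no ¬p = inj₂ (toℕ-fromℕ< _ , ℕ.≤-antisym (toℕ<n x) (ℕ.≮⇒≥ ¬p))

  abstract
    cc⁻ : ∀ x → c (c⁻ x) ≡ x
    cc⁻ x with toℕ-c⁻ x | toℕ-c (c⁻ x)
    ... | inj₁ p       | inj₁ q       = toℕ-injective (trans q (sym p))
    ... | inj₁ p       | inj₂ (_ , q) = contradiction (trans p q) (ℕ.<⇒≢ (toℕ<n x))
    ... | inj₂ (_ , p) | inj₁ q       = contradiction (trans q p) (ℕ.<⇒≢ (toℕ<n _))
    ... | inj₂ (p , _) | inj₂ (q , _) = toℕ-injective (trans q (sym p))

    c⁻c : ∀ x → c⁻ (c x) ≡ x
    c⁻c x with toℕ-c x | toℕ-c⁻ (c x)
    ... | inj₁ p       | inj₁ q       = toℕ-injective (ℕ.suc-injective (trans (sym q) p))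
    ... | inj₁ p       | inj₂ (q , _) = contradiction (trans (sym p) q) λ ()
    ... | inj₂ (p , _) | inj₁ q       = contradiction (trans (sym q) p) λ ()
    ... | inj₂ (_ , p) | inj₂ (_ , q) = toℕ-injective (ℕ.suc-injective (trans q (sym p)))

    c-moves : ∀ x → c x ≢ x
    c-moves x e with toℕ-c x
    ... | inj₁ p       = contradiction (trans (sym (cong toℕ e)) p) (ℕ.<⇒≢ (ℕ.n<1+n _))
    ... | inj₂ (p , q) = contradiction (trans (cong suc (trans (sym p) (cong toℕ e))) q) (ℕ.<⇒≢ 1<N)

    c-gap : ∀ {x y} → ¬ Cyc x y (c x)
    c-gap {x} {y} h with toℕ (c x) | toℕ-c x | toℕ<n y
    c-gap (inj₁ (p , q))        | _ | inj₁ refl       | _ = ℕ.<⇒≱ p (ℕ.≤-pred q)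
    c-gap (inj₂ (inj₁ (p , q))) | _ | inj₁ refl       | _ = ℕ.<⇒≱ q (ℕ.n≤1+n _)
    c-gap (inj₂ (inj₂ (p , q))) | _ | inj₁ refl       | _ = ℕ.<⇒≱ p (ℕ.n≤1+n _)
    c-gap {y = y} (inj₂ (inj₂ (p , q))) | _ | inj₂ (refl , e) | y<N =
      ℕ.<⇒≱ q (ℕ.≤-pred (subst (toℕ y <_) (sym e) y<N))

  c-next : ∀ x → Next Full x (c x)
  c-next x = next tt (c-moves x ∘ sym) (λ h _ → c-gap h)

  c⁻-injective : ∀ {x y} → c⁻ x ≡ c⁻ y → x ≡ y
  c⁻-injective {x} {y} e = trans (sym (cc⁻ x)) (trans (cong c e) (cc⁻ y))

  c-cyc : ∀ {x y z} → Cyc x y z → Cyc (c x) (c y) (c z)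
  c-cyc = next-cyc (c-next _) (c-next _) (c-next _) tt tt tt

  c⁻-cyc : ∀ {x y z} → Cyc x y z → Cyc (c⁻ x) (c⁻ y) (c⁻ z)
  c⁻-cyc {x} {y} {z} h with cyc-total {x = c⁻ x} {c⁻ y} {c⁻ z}
    (λ e → ¬cyc-xxy (subst (λ w → Cyc w y z) (c⁻-injective e) h))
    (λ e → ¬cyc-xyy (subst (λ w → Cyc x w z) (c⁻-injective e) h))
    (λ e → ¬cyc-xyx (subst (λ w → Cyc w y z) (c⁻-injective e) h))
  ... | inj₁ h′ = h′
  ... | inj₂ h′ = ⊥-elim (cyc-asym h (subst₂ (λ a b → Cyc a b x) (cc⁻ z) (cc⁻ y)
    (subst (Cyc (c (c⁻ z)) (c (c⁻ y))) (cc⁻ x) (c-cyc h′))))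

  rotate : (Fin N → Fin N) → Fin N → Fin N
  rotate μ = c⁻ ∘ μ ∘ c

  rotate-isNC : {μ : Fin N → Fin N} → IsNCInvolution μ → IsNCInvolution (rotate μ)
  rotate-isNC {μ} i = record
    { involutive  = λ x → trans (cong (c⁻ ∘ μ) (cc⁻ _)) (trans (cong c⁻ (involutive _)) (c⁻c x))
    ; fixpoint    = λ x e → fixpoint (c x) (trans (sym (cc⁻ _)) (cong c e))
    ; noncrossing = λ {x} {y} h → subst (λ w → Cyc w (rotate μ y) (rotate μ x)) (c⁻c x)
        (c⁻-cyc (noncrossing (subst (Cyc (c x) (c y)) (cc⁻ _) (c-cyc h))))
    }
    where open IsNCInvolution i

  rotate-flip : {μ ν : Fin N → Fin N} → Flip μ ν → Flip (rotate μ) (rotate ν)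
  rotate-flip {μ} {ν} f = record
    { exchange = record
      { a = c⁻ a ; u = c⁻ u ; b = c⁻ b ; v = c⁻ v
      ; μa = at {μ} μa ; μb = at {μ} μb ; νa = at {ν} νa ; νb = at {ν} νb
      ; off = λ p q r s → cong c⁻ (off (p ∘ back) (q ∘ back) (r ∘ back) (s ∘ back))
      }
    ; avb = c⁻-cyc avb
    ; bua = c⁻-cyc bua
    }
    where
    open Flip f
    at : ∀ {μ x y} → μ x ≡ y → rotate μ (c⁻ x) ≡ c⁻ y
    at {μ} e = cong c⁻ (trans (cong μ (cc⁻ _)) e)
    back : ∀ {x y} → c x ≡ y → x ≡ c⁻ y
    back {x} e = trans (sym (c⁻c x)) (cong c⁻ e)

  -- All gaps of the rotation are empty, so closure is vacuous and there is a single block.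
  rotation-link : {μ ν : Fin N → Fin N} → (∀ x → c (ν x) ≡ μ (c x)) → IsLink μ ν c c⁻
  rotation-link e = record
    { σσ⁻ = cc⁻ ; σ⁻σ = c⁻c ; σ-moves = c-moves ; conjugate = e
    ; gap-σ = ⊥-elim ∘ c-gap ; gap-μ = ⊥-elim ∘ c-gap }

  -- Here k is n-1 and `g` is used at the indices 0, ..., 2k. For each r ≤ k the window g r, ..., g
  -- (k + r) is a necklace, and `j` counts the flips made since its start.
  module Sequence
    (k : ℕ) (g : ℕ → Fin N → Fin N)
    (g-isNC : ∀ i → IsNCInvolution (g i))
    (g-flip : ∀ i → i < k + k → Flip (g i) (g (suc i)))
    (closed : ∀ r → r ≤ k → ∀ x → c (g (k + r) x) ≡ g r (c x))
    (∣pairs∣ : ∀ r → r ≤ k → ∣loops∣ (g r) (g r) ≡ suc k)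
    where

    private
      Π : ℕ → ℕ → Rel (Fin N) 0ℓ
      Π r j = Meander (g r) (g (j + r))

      Π-isDec : ∀ r j → IsDecEquivalence (Π r j)
      Π-isDec r j = meander-isDecEquivalence (g r) (g (j + r))

      ∣Π∣ : ℕ → ℕ → ℕ
      ∣Π∣ r j = ∣loops∣ (g r) (g (j + r))

      in-range : ∀ {r j} → r ≤ k → j < k → j + r < k + k
      in-range r≤k j<k = ℕ.+-mono-<-≤ j<k r≤k

    -- Counted from the start of the window, each flip loses at most one loop. `∣Π∣-last` uses the
    -- same step from the end, and the two bounds meet.
    ∣Π∣-first : ∀ {r} → r ≤ k → ∀ j → j ≤ k → suc k ≤ j + ∣Π∣ r j
    ∣Π∣-first r≤k zero    _   = ℕ.≤-reflexive (sym (∣pairs∣ _ r≤k))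
    ∣Π∣-first r≤k (suc j) j<k = ℕ.≤-trans (∣Π∣-first r≤k j (ℕ.<⇒≤ j<k))
      (ℕ.≤-trans (ℕ.+-monoʳ-≤ j (loops-step (g-isNC _) (g-isNC _) (Flip.exchange (g-flip _ (in-range r≤k j<k)))))
        (ℕ.≤-reflexive (ℕ.+-suc j _)))

    private
      -- A matching and its rotation form one loop: no gap of the rotation separates any points, so
      -- `Connected` joins them all.
      Π-last : ∀ {r} → r ≤ k → ∀ x y → Π r k x y
      Π-last {r} r≤k x y = Link.Connected.connected (g-isNC r) (rotation-link (closed r r≤k))
        (IsDecEquivalence.isEquivalence (Π-isDec r k)) meanderˡ meanderʳ
        (λ z → ⊥-elim ∘ c-gap , ⊥-elim ∘ c-gap)

    ∣Π∣-last : ∀ {r} → r ≤ k → ∀ l j → l + j ≡ k → ∣Π∣ r j ≤ suc l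
    ∣Π∣-last {r} r≤k zero    .k refl = ∣classes∣-total (Π-isDec r k) (Π-last r≤k)
    ∣Π∣-last {r} r≤k (suc l) j e = ℕ.≤-trans
      (loops-step (g-isNC _) (g-isNC _) (Flip.exchange (g-flip (j + r) (in-range r≤k (subst (j <_) e (ℕ.m<n+m j (s≤s z≤n)))))))
      (s≤s (∣Π∣-last r≤k l (suc j) (trans (ℕ.+-suc l j) e)))

    ∣Π∣-exact : ∀ {r} → r ≤ k → ∀ j → j ≤ k → j + ∣Π∣ r j ≡ suc k
    ∣Π∣-exact r≤k j j≤k = ℕ.≤-antisym
      (ℕ.≤-trans (ℕ.+-monoʳ-≤ j (∣Π∣-last r≤k (k ∸ j) j (ℕ.m∸n+n≡m j≤k)))
        (ℕ.≤-reflexive (trans (ℕ.+-suc j (k ∸ j)) (cong suc (ℕ.m+[n∸m]≡n j≤k)))))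
      (∣Π∣-first r≤k j j≤k)

    flip-connected : ∀ {r} → r ≤ k → ∀ {j} → j < k → (f : Flip (g (j + r)) (g (suc j + r))) →
                     Π r (suc j) (Flip.a f) (Flip.b f)
    flip-connected {r} r≤k {j} j<k f = loops-drop (g-isNC _) (g-isNC _) (Flip.exchange f)
      (ℕ.+-cancelˡ-≤ j _ _ (ℕ.≤-reflexive (trans (ℕ.+-suc j _)
        (trans (∣Π∣-exact r≤k (suc j) j<k) (sym (∣Π∣-exact r≤k j (ℕ.<⇒≤ j<k)))))))

    -- The old loops are contained in the new ones with a and b glued, and a and b are already in
    -- one new loop.
    Π-increases : ∀ {r} → r ≤ k → ∀ {j} → j < k → Π r j ⇒ Π r (suc j)
    Π-increases {r} r≤k {j} j<k h with Glue.glued-elim (Π-isDec r (suc j)) a b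
        (exchange-glued (g-isNC _) exchange h)
      where open Flip (g-flip (j + r) (in-range r≤k j<k))
    ... | inj₁ e = e
    ... | inj₂ (inj₁ (p , q)) = D.trans p (D.trans (flip-connected r≤k j<k (g-flip (j + r) (in-range r≤k j<k))) q)
      where module D = IsDecEquivalence (Π-isDec r (suc j))
    ... | inj₂ (inj₂ (p , q)) = D.trans p (D.trans (D.sym (flip-connected r≤k j<k (g-flip (j + r) (in-range r≤k j<k)))) q)
      where module D = IsDecEquivalence (Π-isDec r (suc j))

    private
      -- The identity is a default value for indices at which there is no flip.
      τ : ℕ → Fin N → Fin N
      τ i with i ℕ.<? k + k
      ... | yes p = transpose (Flip.a (g-flip i p)) (Flip.b (g-flip i p))
      ... | no  _ = id

      -- The composite of the transpositions of the flips i, ..., i + l - 1, with that of flip i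
      -- acting first.
      U U⁻ : ℕ → ℕ → Fin N → Fin N
      U zero    i = id
      U (suc l) i = U l (suc i) ∘ τ i
      U⁻ zero    i = id
      U⁻ (suc l) i = τ i ∘ U⁻ l (suc i)

      U-+ : ∀ l m i x → U (l + m) i x ≡ U l (m + i) (U m i x)
      U-+ l zero    i x = cong (λ w → U w i x) (ℕ.+-identityʳ l)
      U-+ l (suc m) i x = trans (cong (λ w → U w i x) (ℕ.+-suc l m))
        (trans (U-+ l m (suc i) (τ i x)) (cong (λ w → U l w (U m (suc i) (τ i x))) (ℕ.+-suc m i)))

    link : ∀ {r} → r ≤ k → ∀ l j → l + j ≡ k → IsLink (g r) (g (j + r)) (c ∘ U l (j + r)) (U⁻ l (j + r) ∘ c⁻)
    link r≤k zero    j refl = rotation-link (closed _ r≤k)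
    link {r} r≤k (suc l) j e with link r≤k l (suc j) (trans (ℕ.+-suc l j) e) | j + r ℕ.<? k + k
    ... | L | no  n = contradiction (in-range r≤k (subst (j <_) e (ℕ.m<n+m j (s≤s z≤n)))) n
    ... | L | yes p = Unflip.unflip (g-isNC r) (g-isNC (j + r)) (g-isNC (suc j + r)) L (g-flip (j + r) p)
      (meander-fold ≋-isEquivalence ≋μ ≋ν (flip-connected r≤k (subst (j <_) e (ℕ.m<n+m j (s≤s z≤n))) (g-flip (j + r) p)))
      where
      open Link (g-isNC r) L

    strand : ℕ → ℕ → Fin N → Fin N
    strand r m = U m r

    strand-+ : ∀ r m l x → strand r (l + m) x ≡ strand (m + r) l (strand r m x)
    strand-+ r m l x = U-+ l m r x

    private
      -- With no flip made, μ and ν coincide and the blocks are the pairs of `g r`. A successor that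
      -- moves every point within its pair is the partner.
      full-turn : ∀ {r} → r ≤ k → ∀ x → c (U k r x) ≡ g r x
      full-turn {r} r≤k x with Link.Connected.connected (g-isNC r) L pair-isEquivalence (λ _ → inj₂ refl) (λ _ → inj₂ refl)
                                 (Link.≋σ (g-isNC r) L x)
        where
        L = link r≤k k 0 (ℕ.+-identityʳ k)
        open IsNCInvolution (g-isNC r)
        pair-isEquivalence : IsEquivalence (λ x y → y ≡ x ⊎ y ≡ g r x)
        pair-isEquivalence = record
          { refl = inj₁ refl
          ; sym = λ { (inj₁ refl) → inj₁ refl ; (inj₂ refl) → inj₂ (sym (involutive _)) }
          ; trans = λ { (inj₁ refl) h → h ; (inj₂ refl) (inj₁ refl) → inj₂ refl
                      ; (inj₂ refl) (inj₂ refl) → inj₁ (involutive _) } }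
      ... | inj₁ e = contradiction e (IsLink.σ-moves (link r≤k k 0 (ℕ.+-identityʳ k)) x)
      ... | inj₂ e = e

    module Crossings {r m} (r≤k : r ≤ k) (m≤k : m ≤ k) where

      private
        l+m≡k : k ∸ m + m ≡ k
        l+m≡k = ℕ.m∸n+n≡m m≤k
        open Link (g-isNC r) (link r≤k (k ∸ m) m l+m≡k)
        module r = IsNCInvolution (g-isNC r)

        V = strand r m

        -- The full turn is the strand over m flips followed by the σ of the link at m. So V x = σ⁻
        -- (g r x), the crossing point found in `cross-σ⁻`.
        σV : ∀ x → c (U (k ∸ m) (m + r) (V x)) ≡ g r x
        σV x = trans (cong c (sym (U-+ (k ∸ m) m r x)))
          (trans (cong (λ w → c (U w r x)) l+m≡k) (full-turn r≤k x))

        V≡σ⁻ : ∀ x → V x ≡ U⁻ (k ∸ m) (m + r) (c⁻ (g r x))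
        V≡σ⁻ x = trans (sym (σ⁻σ (V x))) (cong (U⁻ (k ∸ m) (m + r) ∘ c⁻) (σV x))

        gV : ∀ x → g (m + r) (V x) ≡ V (g r x)
        gV x = trans (cong (g (m + r)) (V≡σ⁻ x)) (trans (sym (conjugate⁻ (g r x))) (sym (V≡σ⁻ (g r x))))

      crosses-strand : ∀ x → Arc x (V x) (g r x) × Arc (g r x) (g (m + r) (V x)) x
      crosses-strand x =
        subst (λ w → Arc x w (g r x)) (sym (V≡σ⁻ x)) (cross-σ⁻ x) ,
        subst₂ (Arc (g r x)) (sym (trans (gV x) (V≡σ⁻ (g r x)))) (r.involutive x) (cross-σ⁻ (g r x))

      crosses-only-strand : ∀ {x y} → Arc x y (g r x) → Arc (g r x) (g (m + r) y) x →
                            y ≡ V x ⊎ y ≡ g (m + r) (V x)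
      crosses-only-strand {x} {y} p q with cross-unique p q
      ... | inj₂ e = inj₁ (σ-injective (trans e (sym (σV x))))
      ... | inj₁ e = inj₂ (trans (σ-injective (trans e (sym (trans (σV (g r x)) (r.involutive x))))) (sym (gV x)))

-- Subsets and partitions

∣p∣≡1+∣q∣ : {p q : Subset N} {x : Fin N} → x ∈ˢ p → x ∉ˢ q → q ⊆ˢ p →
            (∀ {y} → y ∈ˢ p → y ≢ x → y ∈ˢ q) → ∣ p ∣ ≡ suc ∣ q ∣
∣p∣≡1+∣q∣ {p = p} {q} {x} x∈p x∉q q⊆p h =
  ℕ.≤-antisym (∣p∣≤1+∣q∣ p q x h) (p⊂q⇒∣p∣<∣q∣ (q⊆p , x , x∈p , x∉q))

infixl 6 _∖_

_∖_ : Subset N → Fin N → Subset N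
p ∖ x = comprehension (λ y → (y ∈ˢ? p) ×-dec ¬? (y ≟ x))

module _ (p : Subset N) (x : Fin N) where

  ∈-∖⁺ : ∀ {y} → y ∈ˢ p → y ≢ x → y ∈ˢ p ∖ x
  ∈-∖⁺ y∈p y≢x = ∈-comprehension⁺ (λ y → (y ∈ˢ? p) ×-dec ¬? (y ≟ x)) (y∈p , y≢x)

  ∈-∖⁻ : ∀ {y} → y ∈ˢ p ∖ x → y ∈ˢ p × y ≢ x
  ∈-∖⁻ = ∈-comprehension⁻ (λ y → (y ∈ˢ? p) ×-dec ¬? (y ≟ x))

∣∖∣ : {p : Subset N} {x : Fin N} → x ∈ˢ p → ∣ p ∣ ≡ suc ∣ p ∖ x ∣
∣∖∣ {p = p} {x} x∈p = ∣p∣≡1+∣q∣ x∈p (λ h → proj₂ (∈-∖⁻ p x h) refl) (proj₁ ∘ ∈-∖⁻ p x) (∈-∖⁺ p x)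

∣enumerated∣ : (xs : List (Fin N)) (p : Subset N) → Unique xs →
               (∀ {x} → x ∈ xs → x ∈ˢ p) → (∀ {x} → x ∈ˢ p → x ∈ xs) → ∣ p ∣ ≡ length xs
∣enumerated∣ {N} [] p [] _ ⊆xs = trans (cong ∣_∣ (Empty-unique λ (x , x∈p) → contradiction (⊆xs x∈p) λ ())) (∣⊥∣≡0 N)
∣enumerated∣ (x ∷ xs) p (x∉xs ∷ u) xs⊆ ⊆xs = trans (∣∖∣ (xs⊆ (here refl))) (cong suc (∣enumerated∣ xs (p ∖ x) u
  (λ y∈ → ∈-∖⁺ p x (xs⊆ (there y∈)) (All.lookup x∉xs y∈ ∘ sym))
  (λ y∈ → let y∈p , y≢x = ∈-∖⁻ p x y∈ in tail y≢x (⊆xs y∈p))))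
  where
  tail : ∀ {y} → y ≢ x → y ∈ x ∷ xs → y ∈ xs
  tail n (here e)  = contradiction e n
  tail n (there h) = h

involution-even : {μ : Fin N → Fin N} → (∀ x → μ (μ x) ≡ x) → (∀ x → μ x ≢ x) →
                  ∀ b (p : Subset N) → ∣ p ∣ < b → (∀ {x} → x ∈ˢ p → μ x ∈ˢ p) → 2 ∣ ∣ p ∣
involution-even {N} {μ} inv fpf (suc b) p (s≤s len) closed with nonempty? p
... | no  e = subst (2 ∣_) (sym (trans (cong ∣_∣ (Empty-unique e)) (∣⊥∣≡0 N))) (2 ∣0)
... | yes (x , x∈p) = subst (2 ∣_) (sym size)
  (∣m∣n⇒∣m+n ∣-refl (involution-even inv fpf b p″ (ℕ.<-≤-trans (subst (∣ p″ ∣ <_) (sym size) (ℕ.m≤n+m _ 1)) len) closed″))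
  where
  p′ p″ : Subset N
  p′ = p ∖ x
  p″ = p′ ∖ μ x
  size : ∣ p ∣ ≡ 2 + ∣ p″ ∣
  size = trans (∣∖∣ x∈p) (cong suc (∣∖∣ (∈-∖⁺ p x (closed x∈p) (fpf x))))
  closed″ : ∀ {y} → y ∈ˢ p″ → μ y ∈ˢ p″
  closed″ {y} y∈ = let y∈p′ , y≢μx = ∈-∖⁻ p′ (μ x) y∈ ; y∈p , y≢x = ∈-∖⁻ p x y∈p′ in
    ∈-∖⁺ p′ (μ x) (∈-∖⁺ p x (closed y∈p) (λ e → y≢μx (trans (sym (inv y)) (cong μ e))))
      (λ e → y≢x (trans (sym (inv y)) (trans (cong μ e) (inv x))))

module _ (f : Fin N → Fin k) where

  ∈-image⁺ : ∀ {B x} → x ∈ˢ B → f x ∈ˢ image f B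
  ∈-image⁺ {B} {x} x∈ = ∈-comprehension⁺ (λ y → any? (λ x → (x ∈ˢ? B) ×-dec (f x ≟ y))) (x , x∈ , refl)

  ∈-image⁻ : ∀ {B y} → y ∈ˢ image f B → ∃[ x ] x ∈ˢ B × f x ≡ y
  ∈-image⁻ {B} = ∈-comprehension⁻ (λ y → any? (λ x → (x ∈ˢ? B) ×-dec (f x ≟ y)))

module _ {i j : Fin N} where

  ∈-pair⁻ : ∀ {x} → x ∈ˢ ⟅ i , j ⟆ → x ≡ i ⊎ x ≡ j
  ∈-pair⁻ x∈ with x∈p∪q⁻ ⁅ i ⁆ ⁅ j ⁆ x∈
  ... | inj₁ h = inj₁ (x∈⁅y⁆⇒x≡y i h)
  ... | inj₂ h = inj₂ (x∈⁅y⁆⇒x≡y j h)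

  ∈-pairˡ : i ∈ˢ ⟅ i , j ⟆
  ∈-pairˡ = x∈p∪q⁺ (inj₁ (x∈⁅x⁆ i))

  ∈-pairʳ : j ∈ˢ ⟅ i , j ⟆
  ∈-pairʳ = x∈p∪q⁺ (inj₂ (x∈⁅x⁆ j))

pair-comm : (i j : Fin N) → ⟅ i , j ⟆ ≡ ⟅ j , i ⟆
pair-comm i j = ∪-comm ⁅ i ⁆ ⁅ j ⁆

pair-injectiveʳ : {i j k : Fin N} → ⟅ i , j ⟆ ≡ ⟅ i , k ⟆ → j ≡ k
pair-injectiveʳ {i = i} {j} {k} e with ∈-pair⁻ {i = i} {k} (subst (j ∈ˢ_) e (∈-pairʳ {i = i}))
... | inj₂ h    = h
... | inj₁ refl with ∈-pair⁻ {i = i} {i} (subst (k ∈ˢ_) (sym e) (∈-pairʳ {i = i}))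
... | inj₁ h = sym h
... | inj₂ h = sym h

∣pair∣≡2 : {i j : Fin N} → i ≢ j → ∣ ⟅ i , j ⟆ ∣ ≡ 2
∣pair∣≡2 {i = i} {j} i≢j = ∣enumerated∣ (i ∷ j ∷ []) _ ((i≢j ∷ []) ∷ [] ∷ [])
  (λ { (here refl) → ∈-pairˡ {j = j} ; (there (here refl)) → ∈-pairʳ {i = i} })
  (λ x∈ → [ here , (λ e → there (here e)) ]′ (∈-pair⁻ x∈))

∣singleton∣≢2 : (i : Fin N) → ∣ ⟅ i , i ⟆ ∣ ≢ 2
∣singleton∣≢2 i e with () ← trans (sym e) (∣enumerated∣ (i ∷ []) ⟅ i , i ⟆ ([] ∷ [])
  (λ { (here refl) → ∈-pairˡ {j = i} }) (λ x∈ → here ([ id , id ]′ (∈-pair⁻ {i = i} {i} x∈))))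

∣p∣≡2⇒pair : {p : Subset N} {x : Fin N} → ∣ p ∣ ≡ 2 → x ∈ˢ p → ∃[ y ] p ≡ ⟅ x , y ⟆
∣p∣≡2⇒pair {p = p} {x} ∣p∣≡2 x∈p with any? (λ y → (y ∈ˢ? p) ×-dec ¬? (y ≟ x))
... | no  none = contradiction (trans (sym ∣p∣≡2) (∣enumerated∣ (x ∷ []) p ([] ∷ [])
      (λ { (here refl) → x∈p })
      (λ {y} y∈ → here (decidable-stable (y ≟ x) λ y≢x → none (y , y∈ , y≢x))))) λ ()
... | yes (y , y∈p , y≢x) = y , ⊆-antisym into (λ z∈ → [ (λ { refl → x∈p }) , (λ { refl → y∈p }) ]′ (∈-pair⁻ z∈))
  where
  into : p ⊆ˢ ⟅ x , y ⟆
  into {z} z∈p with z ∈ˢ? ⟅ x , y ⟆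
  ... | yes h = h
  ... | no  n = contradiction (trans (∣pair∣≡2 (y≢x ∘ sym)) (sym ∣p∣≡2))
    (ℕ.<⇒≢ (p⊂q⇒∣p∣<∣q∣ ((λ w∈ → [ (λ { refl → x∈p }) , (λ { refl → y∈p }) ]′ (∈-pair⁻ w∈)) , z , z∈p , n)))

AllPairs-lookup : {A : Set} {R : Rel A 0ℓ} {xs : List A} → AllPairs R xs →
                  ∀ {x y} → x ∈ xs → y ∈ xs → x ≡ y ⊎ R x y ⊎ R y x
AllPairs-lookup (r ∷ rs) (here refl) (here refl) = inj₁ refl
AllPairs-lookup (r ∷ rs) (here refl) (there y∈)  = inj₂ (inj₁ (All.lookup r y∈))
AllPairs-lookup (r ∷ rs) (there x∈)  (here refl) = inj₂ (inj₂ (All.lookup r x∈))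
AllPairs-lookup (r ∷ rs) (there x∈)  (there y∈)  = AllPairs-lookup rs x∈ y∈

-- Partitions as equivalence relations

Same : Partition N → Rel (Fin N) 0ℓ
Same P x y = ∃[ B ] P ∋ᴾ B × x ∈ˢ B × y ∈ˢ B

module _ (P : Partition N) where

  block-unique : ∀ {B C x} → P ∋ᴾ B → P ∋ᴾ C → x ∈ˢ B → x ∈ˢ C → B ≡ C
  block-unique {B} {C} {x} B∈ C∈ x∈B x∈C with AllPairs-lookup (disjoint P) B∈ C∈
  ... | inj₁ e        = e
  ... | inj₂ (inj₁ e) = contradiction (x , x∈p∩q⁺ (x∈B , x∈C)) e
  ... | inj₂ (inj₂ e) = contradiction (x , x∈p∩q⁺ (x∈C , x∈B)) e

  block-of : ∀ x → ∃[ B ] P ∋ᴾ B × x ∈ˢ B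
  block-of x = find (cover P x)

  same-∈ : ∀ {B x y} → P ∋ᴾ B → x ∈ˢ B → Same P x y → y ∈ˢ B
  same-∈ {y = y} B∈ x∈B (C , C∈ , x∈C , y∈C) = subst (y ∈ˢ_) (block-unique C∈ B∈ x∈C x∈B) y∈C

  same-isDecEquivalence : IsDecEquivalence (Same P)
  same-isDecEquivalence = record
    { isEquivalence = record
      { refl  = λ {x} → let B , B∈ , x∈ = block-of x in B , B∈ , x∈ , x∈
      ; sym   = λ (B , B∈ , x∈ , y∈) → B , B∈ , y∈ , x∈
      ; trans = λ (B , B∈ , x∈ , y∈) yz → B , B∈ , x∈ , same-∈ B∈ y∈ yz
      }
    ; _≟_ = λ x y → dec x y (block-of x)
    }
    where
    dec : ∀ x y → ∃[ B ] P ∋ᴾ B × x ∈ˢ B → Dec (Same P x y)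
    dec x y (B , B∈ , x∈) with y ∈ˢ? B
    ... | yes y∈ = yes (B , B∈ , x∈ , y∈)
    ... | no  y∉ = no (y∉ ∘ same-∈ B∈ x∈)

  private
    representatives : ∀ {Bs} → All Nonempty Bs → List (Fin N)
    representatives []                 = []
    representatives (_∷_ {B} ne nes) = proj₁ (minimal (_∈ˢ? B) toℕ ne) ∷ representatives nes

    Least : Subset N → Fin N → Set
    Least B x = x ∈ˢ B × (∀ y → y ∈ˢ B → toℕ x ≤ toℕ y)

    ∈-representatives⁻ : ∀ {Bs x} (nes : All Nonempty Bs) → x ∈ representatives nes → ∃[ B ] B ∈ Bs × Least B x
    ∈-representatives⁻ (_∷_ {B} ne nes) (here refl) = B , here refl , proj₂ (minimal (_∈ˢ? B) toℕ ne)
    ∈-representatives⁻ (ne ∷ nes) (there x∈) = let B , B∈ , l = ∈-representatives⁻ nes x∈ in B , there B∈ , l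

    ∈-representatives⁺ : ∀ {Bs B} (nes : All Nonempty Bs) → B ∈ Bs → ∃[ x ] x ∈ representatives nes × Least B x
    ∈-representatives⁺ (_∷_ {B} ne nes) (here refl) = _ , here refl , proj₂ (minimal (_∈ˢ? B) toℕ ne)
    ∈-representatives⁺ (ne ∷ nes) (there B∈) = let x , x∈ , l = ∈-representatives⁺ nes B∈ in x , there x∈ , l

    representatives-! : ∀ {Bs} (nes : All Nonempty Bs) → AllPairs (λ B C → Empty (B ∩ C)) Bs → Unique (representatives nes)
    representatives-! [] [] = []
    representatives-! (_∷_ {B} ne nes) (d ∷ ds) = All.tabulate (λ {x} x∈ e →
        let C , C∈ , x∈C , _ = ∈-representatives⁻ nes x∈
        in All.lookup d C∈ (x , x∈p∩q⁺ (subst (_∈ˢ B) e (proj₁ (proj₂ (minimal (_∈ˢ? B) toℕ ne))) , x∈C)))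
      ∷ representatives-! nes ds

    length-representatives : ∀ {Bs} (nes : All Nonempty Bs) → length (representatives nes) ≡ length Bs
    length-representatives []         = refl
    length-representatives (_ ∷ nes) = cong suc (length-representatives nes)

  ∣blocks∣≡∣classes∣ : length (blocks P) ≡ ∣classes∣ same-isDecEquivalence
  ∣blocks∣≡∣classes∣ = trans (sym (length-representatives (nonempty P))) (sym
    (∣enumerated∣ (representatives (nonempty P)) (leaders same-isDecEquivalence)
      (representatives-! (nonempty P) (disjoint P))
      (λ x∈ → let B , B∈ , x∈B , least = ∈-representatives⁻ (nonempty P) x∈ in
        ∈-comprehension⁺ (isLeader? same-isDecEquivalence)
          (λ y y∼x → least y (same-∈ B∈ x∈B (IsDecEquivalence.sym same-isDecEquivalence y∼x))))
      (λ {x} x∈ → let B , B∈ , x∈B = block-of x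
                      r , r∈ , r∈B , least = ∈-representatives⁺ (nonempty P) B∈
                  in subst (_∈ representatives (nonempty P))
                       (toℕ-injective (ℕ.≤-antisym (least x x∈B)
                         (∈-comprehension⁻ (isLeader? same-isDecEquivalence) x∈ r (B , B∈ , r∈B , x∈B)))) r∈)))

same-⊆⇒block : (P Q : Partition N) → Same P ⇒ Same Q → Same Q ⇒ Same P → ∀ {B} → P ∋ᴾ B → Q ∋ᴾ B
same-⊆⇒block P Q P⇒Q Q⇒P {B} B∈ with All.lookup (nonempty P) B∈
... | x , x∈B with block-of Q x
... | C , C∈ , x∈C = subst (Q ∋ᴾ_) (⊆-antisym
  (λ y∈C → same-∈ P B∈ x∈B (Q⇒P (C , C∈ , x∈C , y∈C)))
  (λ y∈B → same-∈ Q C∈ x∈C (P⇒Q (B , B∈ , x∈B , y∈B)))) C∈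

same⇒≈ᴾ : (P Q : Partition N) → Same P ⇒ Same Q → Same Q ⇒ Same P → P ≈ᴾ Q
same⇒≈ᴾ P Q P⇒Q Q⇒P = mk⇔ (same-⊆⇒block P Q P⇒Q Q⇒P) (same-⊆⇒block Q P Q⇒P P⇒Q)

≈ᴾ⇒same : (P Q : Partition N) → P ≈ᴾ Q → Same P ⇒ Same Q
≈ᴾ⇒same P Q e (B , B∈ , h) = B , Equivalence.to e B∈ , h

same-isNC : (P : Partition N) → Noncrossing P → IsNCEquivalence (Same P)
same-isNC {N} P nc = record { isDecEquivalence = same-isDecEquivalence P ; noncrossing = go }
  where
  open IsDecEquivalence (same-isDecEquivalence P) using () renaming (refl to ∼-refl; sym to ∼-sym; trans to ∼-trans)
  linear : ∀ {a b c d} → toℕ a < toℕ b → toℕ b < toℕ c → toℕ c < toℕ d → Same P a c → Same P b d → Same P a b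
  linear {a} {b} {c} {d} ab bc cd (B , B∈ , a∈ , c∈) (C , C∈ , b∈ , d∈) with B ≟ˢ C
  ... | yes refl = B , B∈ , a∈ , b∈
  ... | no  B≢C  = ⊥-elim (nc B∈ C∈ B≢C (inj₁ (a , b , c , d , (ab , bc , cd) , (a∈ , c∈) , (b∈ , d∈))))
  go : ∀ {a b c d} → Cyc a b c → Cyc c d a → Same P a c → Same P b d → Same P a b
  -- Interleaving is defined by the linear order. Four points in cyclic order become increasing
  -- after one of the four rotations.
  go {a} {b} {c} {d} h h′ ac bd with ordering
    (cyc 0F 1F 2F ⊃ cyc 2F 3F 0F ⊃ (0F ≺ 1F ∧ 1F ≺ 2F ∧ 2F ≺ 3F) ∨ (1F ≺ 2F ∧ 2F ≺ 3F ∧ 3F ≺ 0F)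
      ∨ (2F ≺ 3F ∧ 3F ≺ 0F ∧ 0F ≺ 1F) ∨ (3F ≺ 0F ∧ 0F ≺ 1F ∧ 1F ≺ 2F)) (a ∷ b ∷ c ∷ d ∷ []) h h′
  ... | inj₁ (p , q , r) = linear p q r ac bd
  ... | inj₂ (inj₁ (p , q , r)) = ∼-trans ac (∼-sym (linear p q r bd (∼-sym ac)))
  ... | inj₂ (inj₂ (inj₁ (p , q , r))) = ∼-trans (∼-trans ac (linear p q r (∼-sym ac) (∼-sym bd))) (∼-sym bd)
  ... | inj₂ (inj₂ (inj₂ (p , q , r))) = ∼-sym (∼-trans bd (linear p q r (∼-sym bd) ac))

isNC⇒noncrossing : (P : Partition N) →
  (∀ {a b c d} → Cyc a b c → Cyc c d a → Same P a c → Same P b d → Same P a b) → Noncrossing P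
isNC⇒noncrossing {N} P nc {B} {C} B∈ C∈ B≢C = [ no-interleave B∈ C∈ B≢C , no-interleave C∈ B∈ (B≢C ∘ sym) ]′
  where
  no-interleave : ∀ {B C} → P ∋ᴾ B → P ∋ᴾ C → B ≢ C → ¬ Interleave B C
  no-interleave {B} {C} B∈ C∈ B≢C (i , j , k , l , (ij , jk , kl) , (i∈ , k∈) , (j∈ , l∈)) =
    B≢C (block-unique P B∈ C∈ (same-∈ P B∈ i∈ (nc (inj₁ (ij , jk)) (inj₂ (inj₂ (ℕ.<-trans ij jk , kl)))
      (B , B∈ , i∈ , k∈) (C , C∈ , j∈ , l∈))) j∈)

module _ {_∼_ : Rel (Fin N) 0ℓ} (isDecEq : IsDecEquivalence _∼_) where

  private module E = IsDecEquivalence isDecEq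

  same-classes⁻ : Same (classes isDecEq) ⇒ _∼_
  same-classes⁻ (B , B∈ , x∈ , y∈)
    with i , _ , refl ← ∈-map⁻ (class isDecEq) (∈-deduplicate⁻ _≟ˢ_ (map (class isDecEq) (allFin N)) B∈) =
    E.trans (E.sym (∈-comprehension⁻ (i E.≟_) x∈)) (∈-comprehension⁻ (i E.≟_) y∈)

  same-classes⁺ : _∼_ ⇒ Same (classes isDecEq)
  same-classes⁺ {x} x∼y = class isDecEq x ,
    ∈-deduplicate⁺ _≟ˢ_ (∈-map⁺ (class isDecEq) (∈-allFin x)) ,
    ∈-comprehension⁺ (x E.≟_) E.refl , ∈-comprehension⁺ (x E.≟_) x∼y

∣p∪q∣-disjoint : (p q : Subset N) → Empty (p ∩ q) → ∣ p ∪ q ∣ ≡ ∣ p ∣ + ∣ q ∣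
∣p∪q∣-disjoint []               []               _ = refl
∣p∪q∣-disjoint (outside ∷ p) (outside ∷ q) e = ∣p∪q∣-disjoint p q (drop-∷-Empty e)
∣p∪q∣-disjoint (outside ∷ p) (inside ∷ q)  e =
  trans (cong suc (∣p∪q∣-disjoint p q (drop-∷-Empty e))) (sym (ℕ.+-suc ∣ p ∣ ∣ q ∣))
∣p∪q∣-disjoint (inside ∷ p)  (outside ∷ q) e = cong suc (∣p∪q∣-disjoint p q (drop-∷-Empty e))
∣p∪q∣-disjoint (inside ∷ p)  (inside ∷ q)  e = contradiction (zero , here) e

sum-sizes : {Bs : List (Subset N)} → AllPairs (λ B C → Empty (B ∩ C)) Bs → sum (map ∣_∣ Bs) ≤ N
sum-sizes {N} {Bs} ds = ℕ.≤-trans (ℕ.≤-reflexive (sizes ds)) (∣p∣≤n (foldr _∪_ ⊥ˢ Bs))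
  where
  apart : ∀ {B} Bs → All (λ C → Empty (B ∩ C)) Bs → Empty (B ∩ foldr _∪_ ⊥ˢ Bs)
  apart {B} Bs d (x , x∈) with x∈p∩q⁻ B _ x∈
  apart []       []       (x , x∈) | _ , x∈⊥ = ∉⊥ x∈⊥
  apart {B} (C ∷ Bs) (e ∷ d) (x , x∈) | x∈B , x∈∪ with x∈p∪q⁻ C _ x∈∪
  ... | inj₁ x∈C  = e (x , x∈p∩q⁺ (x∈B , x∈C))
  ... | inj₂ x∈Bs = apart Bs d (x , x∈p∩q⁺ (x∈B , x∈Bs))
  sizes : ∀ {Bs} → AllPairs (λ B C → Empty (B ∩ C)) Bs → sum (map ∣_∣ Bs) ≡ ∣ foldr _∪_ ⊥ˢ Bs ∣
  sizes []       = sym (∣⊥∣≡0 N)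
  sizes (_∷_ {B} {Bs} d ds) = trans (cong (∣ B ∣ +_) (sizes ds)) (sym (∣p∪q∣-disjoint B _ (apart Bs d)))

-- Used for the first partition of a chain: n disjoint nonempty blocks of even size in 2n points
-- leave room only for pairs.
sizes-tight : {Bs : List (Subset N)} → All (λ B → 2 ≤ ∣ B ∣) Bs → sum (map ∣_∣ Bs) ≤ 2 * length Bs → All (λ B → ∣ B ∣ ≡ 2) Bs
sizes-tight []       _  = []
sizes-tight {Bs = B ∷ Bs} (h ∷ hs) le = ℕ.≤-antisym B≤2 h ∷ sizes-tight hs rest
  where
  at-least : ∀ {Bs} → All (λ B → 2 ≤ ∣ B ∣) Bs → 2 * length Bs ≤ sum (map ∣_∣ Bs)
  at-least []       = z≤n
  at-least {B ∷ Bs} (h ∷ hs) = ℕ.≤-trans (ℕ.≤-reflexive (ℕ.*-suc 2 (length Bs))) (ℕ.+-mono-≤ h (at-least hs))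
  le′ : ∣ B ∣ + sum (map ∣_∣ Bs) ≤ 2 + 2 * length Bs
  le′ = ℕ.≤-trans le (ℕ.≤-reflexive (ℕ.*-suc 2 (length Bs)))
  B≤2 : ∣ B ∣ ≤ 2
  B≤2 = ℕ.+-cancelʳ-≤ (2 * length Bs) _ _ (ℕ.≤-trans (ℕ.+-monoʳ-≤ ∣ B ∣ (at-least hs)) le′)
  rest : sum (map ∣_∣ Bs) ≤ 2 * length Bs
  rest = ℕ.+-cancelˡ-≤ 2 _ _ (ℕ.≤-trans (ℕ.+-monoˡ-≤ _ h) le′)

module NC-pairs {_∼_ : Rel (Fin N) 0ℓ} (isNC : IsNCEquivalence _∼_) {μ : Fin N → Fin N}
  (involutive : ∀ x → μ (μ x) ≡ x) (fixpoint : ∀ x → μ x ≢ x)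
  (∼μ : ∀ x → x ∼ μ x) (∼⇒μ : ∀ {x y} → x ∼ y → y ≡ x ⊎ y ≡ μ x) where

  isNCInvolution : IsNCInvolution μ
  isNCInvolution = record { involutive = involutive ; fixpoint = fixpoint ; noncrossing = nc }
    where
    back : ∀ {x y} → Cyc x y (μ x) → ¬ Cyc x (μ y) (μ x) → Cyc (μ x) (μ y) x
    back {x} {y} h ¬h = ordering
      (cyc 0F 1F 2F ⊃ ¬′ cyc 0F 3F 2F ⊃ ¬′ (3F ≐ 0F) ⊃ ¬′ (3F ≐ 2F) ⊃ cyc 2F 3F 0F)
      (x ∷ y ∷ μ x ∷ μ y ∷ []) h ¬h
      (≢ℕ λ e → ¬cyc-xyy (subst (Cyc x y) (trans (cong μ (sym e)) (involutive y)) h))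
      (≢ℕ λ e → ¬cyc-xxy (subst (λ z → Cyc z y (μ x))
        (trans (sym (involutive x)) (trans (cong μ (sym e)) (involutive y))) h))

    nc : ∀ {x y} → Cyc x y (μ x) → Cyc x (μ y) (μ x)
    nc {x} {y} h with cyc? x (μ y) (μ x)
    ... | yes h′ = h′
    ... | no  ¬h with ∼⇒μ (IsNCEquivalence.noncrossing isNC h (back h ¬h) (∼μ x) (∼μ y))
    ... | inj₁ refl = ⊥-elim (¬cyc-xxy h)
    ... | inj₂ refl = ⊥-elim (¬cyc-xyy h)

pairs-noncrossing : {_∼_ : Rel (Fin N) 0ℓ} {μ : Fin N → Fin N} → IsNCInvolution μ →
  (∀ {x y} → x ∼ y → y ≡ x ⊎ y ≡ μ x) →
  ∀ {a b c d} → Cyc a b c → Cyc c d a → a ∼ c → b ∼ d → a ∼ b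
pairs-noncrossing i ∼⇒μ h h′ ac bd with ∼⇒μ ac | ∼⇒μ bd
... | inj₁ refl | _         = ⊥-elim (¬cyc-xyx h)
... | inj₂ refl | inj₁ refl = ⊥-elim (cyc-asym h h′)
... | inj₂ refl | inj₂ refl = ⊥-elim (cyc-asym (IsNCInvolution.noncrossing i h) h′)

-- Matchings

module _ (M : Matching n) where

  private
    P = partition M

  abstract
    partner-pair : ∀ x → ∃[ y ] M ∋ ⟅ x , y ⟆
    partner-pair x with block-of P x
    ... | B , B∈ , x∈ with ∣p∣≡2⇒pair (∣pair∣ M B∈) x∈
    ... | y , refl = y , B∈

  partner : Fin (2 * n) → Fin (2 * n)
  partner x = proj₁ (partner-pair x)

  ∋-partner : ∀ x → M ∋ ⟅ x , partner x ⟆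
  ∋-partner x = proj₂ (partner-pair x)

  ∋⇒partner : ∀ {x y} → M ∋ ⟅ x , y ⟆ → partner x ≡ y
  ∋⇒partner {x} {y} h = pair-injectiveʳ
    (block-unique P (∋-partner x) h (∈-pairˡ {j = partner x}) (∈-pairˡ {j = y}))

  ∋⇒block : ∀ {B x} → M ∋ B → x ∈ˢ B → B ≡ ⟅ x , partner x ⟆
  ∋⇒block {x = x} B∈ x∈ = block-unique P B∈ (∋-partner x) x∈ (∈-pairˡ {j = partner x})

  partner-involutive : ∀ x → partner (partner x) ≡ x
  partner-involutive x = ∋⇒partner (subst (M ∋_) (pair-comm x (partner x)) (∋-partner x))

  partner-fixpoint : ∀ x → partner x ≢ x
  partner-fixpoint x e = ∣singleton∣≢2 x (∣pair∣ M (subst (λ y → M ∋ ⟅ x , y ⟆) e (∋-partner x)))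

  same-partner : ∀ x → Same P x (partner x)
  same-partner x = _ , ∋-partner x , ∈-pairˡ {j = partner x} , ∈-pairʳ {i = x}

  same⇒partner : ∀ {x y} → Same P x y → y ≡ x ⊎ y ≡ partner x
  same⇒partner {x} {y} h = ∈-pair⁻ (same-∈ P (∋-partner x) (∈-pairˡ {j = partner x}) h)

  partner-isNC : Noncrossing P → IsNCInvolution partner
  partner-isNC nc = NC-pairs.isNCInvolution (same-isNC P nc)
    partner-involutive partner-fixpoint same-partner same⇒partner

  isNC-partner⇒noncrossing : IsNCInvolution partner → Noncrossing P
  isNC-partner⇒noncrossing i = isNC⇒noncrossing P (pairs-noncrossing i same⇒partner)

∋-mono : (M M′ : Matching n) → (∀ x → partner M x ≡ partner M′ x) → ∀ {B} → M ∋ B → M′ ∋ B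
∋-mono M M′ e {B} B∈ with All.lookup (nonempty (partition M)) B∈
... | x , x∈ = subst (M′ ∋_) (sym (trans (∋⇒block M B∈ x∈) (cong ⟅ x ,_⟆ (e x)))) (∋-partner M′ x)

partner⇒≈ : (M M′ : Matching n) → (∀ x → partner M x ≡ partner M′ x) → M ≈ M′
partner⇒≈ M M′ e = mk⇔ (∋-mono M M′ e) (∋-mono M′ M (sym ∘ e))

≈⇒partner : (M M′ : Matching n) → M ≈ M′ → ∀ x → partner M x ≡ partner M′ x
≈⇒partner M M′ e x = sym (∋⇒partner M′ (Equivalence.to e (∋-partner M x)))

joined⇒partner : (M M′ : Matching n) → ∀ {x y} → Joined M M′ x y → y ≡ partner M x ⊎ y ≡ partner M′ x
joined⇒partner M M′ = Sum.map (sym ∘ ∋⇒partner M) (sym ∘ ∋⇒partner M′)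

meander⇒same : (M M′ : Matching n) → Meander (partner M) (partner M′) ⇒ Same (Π₀ M M′)
meander⇒same M M′ = same-classes⁺ (joined-isDecEquivalence M M′) ∘
  EqC.map λ { (inj₁ refl) → inj₁ (∋-partner M _) ; (inj₂ refl) → inj₂ (∋-partner M′ _) }

same⇒meander : (M M′ : Matching n) → Same (Π₀ M M′) ⇒ Meander (partner M) (partner M′)
same⇒meander M M′ = EqC.map (joined⇒partner M M′) ∘ same-classes⁻ (joined-isDecEquivalence M M′)

-- The inequality is kept apart because an `Exchange` may be degenerate, with a ≡ b and u ≡ v.
isFlip⇒exchange : (M M′ : Matching n) → IsFlip M M′ →
                  Σ (Exchange (partner M) (partner M′)) λ e → Exchange.a e ≢ Exchange.b e
isFlip⇒exchange M M′ (i , j , k , l , ij∈ , kl∈ , ij≢kl , ∈⇔) = record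
  { a = i ; u = j ; b = k ; v = l
  ; μa = ∋⇒partner M ij∈
  ; μb = ∋⇒partner M kl∈
  ; νa = ∋⇒partner M′ (Equivalence.from (∈⇔ _) (inj₂ (inj₁ refl)))
  ; νb = ∋⇒partner M′ (subst (M′ ∋_) (pair-comm j k) (Equivalence.from (∈⇔ _) (inj₂ (inj₂ refl))))
  ; off = λ {x} x≢i x≢k x≢j x≢l → sym (∋⇒partner M′ (Equivalence.from (∈⇔ _) (inj₁
      (∋-partner M x , avoids x≢i x≢j , avoids x≢k x≢l))))
  } , λ { refl → ij≢kl (block-unique (partition M) ij∈ kl∈ (∈-pairˡ {j = j}) (∈-pairˡ {j = l})) }
  where
  avoids : ∀ {x y i j} → x ≢ i → x ≢ j → ⟅ x , y ⟆ ≢ ⟅ i , j ⟆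
  avoids {x} {y} x≢i x≢j e = [ x≢i , x≢j ]′ (∈-pair⁻ (subst (x ∈ˢ_) e (∈-pairˡ {j = y})))

exchange⇒isFlip : (M M′ : Matching n) (e : Exchange (partner M) (partner M′)) →
                  Exchange.a e ≢ Exchange.b e → IsFlip M M′
exchange⇒isFlip M M′ e a≢b =
  a , u , b , v , au∈ , bv∈ , au≢bv , λ B → mk⇔ to (from B)
  where
  open Exchange e
  au∈ : M ∋ ⟅ a , u ⟆
  au∈ = subst (λ y → M ∋ ⟅ a , y ⟆) μa (∋-partner M a)
  bv∈ : M ∋ ⟅ b , v ⟆
  bv∈ = subst (λ y → M ∋ ⟅ b , y ⟆) μb (∋-partner M b)
  av∈ : M′ ∋ ⟅ a , v ⟆
  av∈ = subst (λ y → M′ ∋ ⟅ a , y ⟆) νa (∋-partner M′ a)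
  bu∈ : M′ ∋ ⟅ b , u ⟆
  bu∈ = subst (λ y → M′ ∋ ⟅ b , y ⟆) νb (∋-partner M′ b)

  u≢b : u ≢ b
  u≢b refl = partner-fixpoint M′ b νb

  au≢bv : ⟅ a , u ⟆ ≢ ⟅ b , v ⟆
  au≢bv eq = [ a≢b ∘ sym , u≢b ∘ sym ]′ (∈-pair⁻ (subst (b ∈ˢ_) (sym eq) (∈-pairˡ {j = v})))

  at : ∀ {B} (M : Matching _) {x i j} → M ∋ B → x ∈ˢ B → M ∋ ⟅ i , j ⟆ → x ≡ i ⊎ x ≡ j → B ≡ ⟅ i , j ⟆
  at M {i = i} {j} B∈ x∈ ij∈ (inj₁ refl) = block-unique (partition M) B∈ ij∈ x∈ (∈-pairˡ {j = j})
  at M {i = i} {j} B∈ x∈ ij∈ (inj₂ refl) = block-unique (partition M) B∈ ij∈ x∈ (∈-pairʳ {i = i})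

  block-off : ∀ {B x} {M₁ M₂ : Matching _} → M₁ ∋ B → x ∈ˢ B → partner M₁ x ≡ partner M₂ x → M₂ ∋ B
  block-off {x = x} {M₁} {M₂} B∈ x∈ eq = subst (M₂ ∋_)
    (sym (trans (∋⇒block M₁ B∈ x∈) (cong ⟅ x ,_⟆ eq))) (∋-partner M₂ x)

  to : ∀ {B} → M′ ∋ B → (M ∋ B × B ≢ ⟅ a , u ⟆ × B ≢ ⟅ b , v ⟆) ⊎ B ≡ ⟅ a , v ⟆ ⊎ B ≡ ⟅ u , b ⟆
  to {B} B∈ with All.lookup (nonempty (partition M′)) B∈
  ... | x , x∈ with x ≟ a | x ≟ b | x ≟ u | x ≟ v
  ... | yes e | _ | _ | _ = inj₂ (inj₁ (at M′ B∈ x∈ av∈ (inj₁ e)))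
  ... | no _ | yes e | _ | _ = inj₂ (inj₂ (trans (at M′ B∈ x∈ bu∈ (inj₁ e)) (pair-comm b u)))
  ... | no _ | no _ | yes e | _ = inj₂ (inj₂ (trans (at M′ B∈ x∈ bu∈ (inj₂ e)) (pair-comm b u)))
  ... | no _ | no _ | no _ | yes e = inj₂ (inj₁ (at M′ B∈ x∈ av∈ (inj₂ e)))
  ... | no x≢a | no x≢b | no x≢u | no x≢v = inj₁
    ( block-off {M₁ = M′} {M} B∈ x∈ (sym (off x≢a x≢b x≢u x≢v))
    , (λ { refl → [ x≢a , x≢u ]′ (∈-pair⁻ x∈) }) , (λ { refl → [ x≢b , x≢v ]′ (∈-pair⁻ x∈) }))

  from : ∀ B → (M ∋ B × B ≢ ⟅ a , u ⟆ × B ≢ ⟅ b , v ⟆) ⊎ B ≡ ⟅ a , v ⟆ ⊎ B ≡ ⟅ u , b ⟆ → M′ ∋ B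
  from B (inj₂ (inj₁ refl)) = av∈
  from B (inj₂ (inj₂ refl)) = subst (M′ ∋_) (pair-comm b u) bu∈
  from B (inj₁ (B∈ , B≢au , B≢bv)) with All.lookup (nonempty (partition M)) B∈
  ... | x , x∈ = block-off {M₁ = M} {M′} B∈ x∈ (off
    (λ e → B≢au (at M B∈ x∈ au∈ (inj₁ e))) (λ e → B≢bv (at M B∈ x∈ bv∈ (inj₁ e)))
    (λ e → B≢au (at M B∈ x∈ au∈ (inj₂ e))) (λ e → B≢bv (at M B∈ x∈ bv∈ (inj₂ e))))

-- Four distinct points have six cyclic orders. Two are excluded because {a , u} and {b , v} do not
-- cross, two because {a , v} and {b , u} do not; the remaining two differ by swapping (a , b) with
-- (u , v).
exchange⇒flip : {μ ν : Fin N → Fin N} → IsNCInvolution μ → IsNCInvolution ν →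
                (e : Exchange μ ν) → Exchange.a e ≢ Exchange.b e → Flip μ ν
exchange⇒flip {μ = μ} {ν} μ-nc ν-nc e a≢b with ordering
    (¬′ (0F ≐ 2F) ⊃ ¬′ (0F ≐ 1F) ⊃ ¬′ (2F ≐ 3F) ⊃ ¬′ (0F ≐ 3F) ⊃ ¬′ (2F ≐ 1F) ⊃ ¬′ (1F ≐ 3F) ⊃
     (cyc 0F 2F 1F ⊃ cyc 0F 3F 1F) ⊃ (cyc 0F 3F 1F ⊃ cyc 0F 2F 1F) ⊃
     (cyc 0F 2F 3F ⊃ cyc 0F 1F 3F) ⊃ (cyc 0F 1F 3F ⊃ cyc 0F 2F 3F) ⊃
     (cyc 0F 3F 2F ∧ cyc 2F 1F 0F) ∨ (cyc 1F 2F 3F ∧ cyc 3F 0F 1F))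
    (a ∷ u ∷ b ∷ v ∷ [])
    (≢ℕ a≢b) (≢ℕ λ h → μ.fixpoint a (trans μa (sym h))) (≢ℕ λ h → μ.fixpoint b (trans μb (sym h)))
    (≢ℕ λ h → ν.fixpoint a (trans νa (sym h))) (≢ℕ λ h → ν.fixpoint b (trans νb (sym h)))
    (≢ℕ λ h → a≢b (μ.injective (trans μa (trans h (sym μb)))))
    (λ h → subst₂ (Cyc a) μb μa (μ.noncrossing (subst (Cyc a b) (sym μa) h)))
    (λ h → subst₂ (Cyc a) μv≡b μa (μ.noncrossing (subst (Cyc a v) (sym μa) h)))
    (λ h → subst₂ (Cyc a) νb νa (ν.noncrossing (subst (Cyc a b) (sym νa) h)))
    (λ h → subst₂ (Cyc a) νu≡b νa (ν.noncrossing (subst (Cyc a u) (sym νa) h)))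
  where
  open Exchange e
  module μ = IsNCInvolution μ-nc
  module ν = IsNCInvolution ν-nc
  μv≡b : μ v ≡ b
  μv≡b = trans (cong μ (sym μb)) (μ.involutive b)
  νu≡b : ν u ≡ b
  νu≡b = trans (cong ν (sym νb)) (ν.involutive b)
... | inj₁ (avb , bua) = record { exchange = e ; avb = avb ; bua = bua }
... | inj₂ (ubv , vau) = record
  { exchange = record
    { a = u ; u = a ; b = v ; v = b
    ; μa = trans (cong μ (sym μa)) (μ.involutive a) ; μb = trans (cong μ (sym μb)) (μ.involutive b)
    ; νa = trans (cong ν (sym νb)) (ν.involutive b) ; νb = trans (cong ν (sym νa)) (ν.involutive a)
    ; off = λ p q r s → off r s p q }
  ; avb = ubv ; bua = vau }
  where
  open Exchange e
  module μ = IsNCInvolution μ-nc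
  module ν = IsNCInvolution ν-nc

1<2*n : ∀ n → .{{NonZero n}} → 1 < 2 * n
1<2*n (suc n) = s≤s (ℕ.≤-trans (s≤s z≤n) (ℕ.m≤n+m (suc (n + 0)) n))

module _ .{{_ : NonZero n}} (M M′ : Matching n) where

  private
    instance
      2*n≢0 : NonZero (2 * n)
      2*n≢0 = ℕ.m*n≢0 2 n

    open Rotation (2 * n) (1<2*n n)

  isRotation⇒conjugate : IsRotation -1ℤ M M′ → ∀ x → c (partner M′ x) ≡ partner M (c x)
  isRotation⇒conjugate h x = trans
    (cong c (∋⇒partner M′ (subst (λ y → M′ ∋ ⟅ y , c⁻ (partner M (c x)) ⟆) (c⁻c x)
      (Equivalence.to (h (c x) (partner M (c x))) (∋-partner M (c x)))))) (cc⁻ _)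

  conjugate⇒isRotation : (∀ x → c (partner M′ x) ≡ partner M (c x)) → IsRotation -1ℤ M M′
  conjugate⇒isRotation e i j = mk⇔
    (λ ij∈ → subst (λ y → M′ ∋ ⟅ c⁻ i , y ⟆) (trans (e′ i) (cong c⁻ (∋⇒partner M ij∈))) (∋-partner M′ (c⁻ i)))
    (λ ij∈ → subst (λ y → M ∋ ⟅ i , y ⟆) (c⁻-injective (trans (sym (e′ i)) (∋⇒partner M′ ij∈))) (∋-partner M i))
    where
    e′ : ∀ i → partner M′ (c⁻ i) ≡ c⁻ (partner M i)
    e′ i = trans (sym (c⁻c _)) (cong c⁻ (trans (e (c⁻ i)) (cong (partner M) (cc⁻ i))))

-- Realizes σ⁻ ∘ μ ∘ σ as a matching by moving the blocks along σ⁻, so that the number of pairs is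
-- inherited.
module Relabel (M : Matching n) {σ σ⁻ : Fin (2 * n) → Fin (2 * n)}
  (σσ⁻ : ∀ x → σ (σ⁻ x) ≡ x) (σ⁻σ : ∀ x → σ⁻ (σ x) ≡ x) where

  private
    image⁺ : ∀ {B x} → x ∈ˢ B → σ⁻ x ∈ˢ image σ⁻ B
    image⁺ = ∈-image⁺ σ⁻

    image⁻ : ∀ {B y} → y ∈ˢ image σ⁻ B → σ y ∈ˢ B
    image⁻ {B} y∈ with ∈-image⁻ σ⁻ y∈
    ... | x , x∈ , refl = subst (_∈ˢ B) (sym (σσ⁻ x)) x∈

    image-pair : ∀ x y → image σ⁻ ⟅ x , y ⟆ ≡ ⟅ σ⁻ x , σ⁻ y ⟆
    image-pair x y = ⊆-antisym
      (λ {z} z∈ → [ (λ e → subst (_∈ˢ ⟅ σ⁻ x , σ⁻ y ⟆) (trans (cong σ⁻ (sym e)) (σ⁻σ z)) (∈-pairˡ {j = σ⁻ y}))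
                  , (λ e → subst (_∈ˢ ⟅ σ⁻ x , σ⁻ y ⟆) (trans (cong σ⁻ (sym e)) (σ⁻σ z)) (∈-pairʳ {i = σ⁻ x})) ]′
                  (∈-pair⁻ (image⁻ z∈)))
      (λ z∈ → [ (λ { refl → image⁺ (∈-pairˡ {j = y}) }) , (λ { refl → image⁺ (∈-pairʳ {i = x}) }) ]′ (∈-pair⁻ z∈))

  relabel : Matching n
  relabel = record
    { partition = record
      { blocks   = map (image σ⁻) (blocks (partition M))
      ; nonempty = All.map⁺ (All.map (λ (x , x∈) → σ⁻ x , image⁺ x∈) (nonempty (partition M)))
      ; disjoint = AllPairs.map⁺ (AllPairs.map
          (λ {B} {C} e (x , x∈) → let x∈B , x∈C = x∈p∩q⁻ (image σ⁻ B) (image σ⁻ C) x∈ in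
            e (σ x , x∈p∩q⁺ (image⁻ x∈B , image⁻ x∈C)))
          (disjoint (partition M)))
      ; cover    = λ i → let B , B∈ , σi∈ = block-of (partition M) (σ i) in
          lose (∈-map⁺ (image σ⁻) B∈) (subst (_∈ˢ image σ⁻ B) (σ⁻σ i) (image⁺ σi∈))
      }
    ; ∣pairs∣   = trans (length-map (image σ⁻) (blocks (partition M))) (∣pairs∣ M)
    ; ∣pair∣    = λ B∈ → let C , C∈ , e = ∈-map⁻ (image σ⁻) B∈ in trans (cong ∣_∣ e) (size C∈)
    }
    where
    size : ∀ {C} → M ∋ C → ∣ image σ⁻ C ∣ ≡ 2
    size {C} C∈ with All.lookup (nonempty (partition M)) C∈
    ... | x , x∈ with ∋⇒block M C∈ x∈
    ... | refl = trans (cong ∣_∣ (image-pair x (partner M x)))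
      (∣pair∣≡2 λ e → partner-fixpoint M x (trans (sym (σσ⁻ _)) (trans (cong σ (sym e)) (σσ⁻ x))))

  partner-relabel : ∀ x → partner relabel x ≡ σ⁻ (partner M (σ x))
  partner-relabel x = ∋⇒partner relabel (subst (λ y → relabel ∋ ⟅ y , σ⁻ (partner M (σ x)) ⟆) (σ⁻σ x)
    (subst (relabel ∋_) (image-pair (σ x) (partner M (σ x))) (∈-map⁺ (image σ⁻) (∋-partner M (σ x)))))

-- Crossings

private
  variable
    A B : Set

length-filter-map : {P : Pred B 0ℓ} (P? : Decidable P) (f : A → B) (xs : List A) →
                    length (filter P? (map f xs)) ≡ length (filter (P? ∘ f) xs)
length-filter-map P? f []       = refl
length-filter-map P? f (x ∷ xs) with P? (f x)
... | yes _ = cong suc (length-filter-map P? f xs)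
... | no  _ = length-filter-map P? f xs

length-filter-unique : {P : Pred A 0ℓ} (P? : Decidable P) {xs : List A} → Unique xs →
  ∀ {y} → y ∈ xs → P y → (∀ {z} → z ∈ xs → P z → z ≡ y) → length (filter P? xs) ≡ 1
length-filter-unique P? {x ∷ xs} (x∉ ∷ u) y∈ py only with P? x
... | yes px with refl ← only (here refl) px = cong (suc ∘ length) (filter-none P?
  (All.tabulate λ z∈ pz → All.lookup x∉ z∈ (sym (only (there z∈) pz))))
length-filter-unique P? {x ∷ xs} (x∉ ∷ u) (here refl) py only | no ¬px = contradiction py ¬px
length-filter-unique P? {x ∷ xs} (x∉ ∷ u) (there y∈) py only | no ¬px =
  length-filter-unique P? u y∈ py (only ∘ there)

module _ {R : Rel A 0ℓ} (R? : Decidable₂ R) where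

  private
    related : List A → ℕ
    related xs = length (filter (uncurry R?) (unorderedPairs xs))

    length-filter-pairs : ∀ x xs → related (x ∷ xs) ≡ length (filter (R? x) xs) + related xs
    length-filter-pairs x xs = trans
      (cong length (filter-++ (uncurry R?) (map (x ,_) xs) (unorderedPairs xs)))
      (trans (length-++ (filter (uncurry R?) (map (x ,_) xs)))
        (cong (_+ related xs) (length-filter-map (uncurry R?) (x ,_) xs)))

    unrelated : ∀ {xs} → AllPairs (λ x y → ¬ R x y) xs → related xs ≡ 0
    unrelated []                  = refl
    unrelated (_∷_ {x} {xs} r rs) = trans (length-filter-pairs x xs)
      (cong₂ _+_ (cong length (filter-none (R? x) r)) (unrelated rs))

  length-filter-++ : ∀ {xs ys} → AllPairs (λ x y → ¬ R x y) xs → AllPairs (λ x y → ¬ R x y) ys →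
    All (λ x → length (filter (R? x) ys) ≡ 1) xs →
    length (filter (uncurry R?) (unorderedPairs (xs ++ ys))) ≡ length xs
  length-filter-++ []       s []       = unrelated s
  length-filter-++ {x ∷ xs} {ys} (r ∷ rs) s (e ∷ es) = trans (length-filter-pairs x (xs ++ ys))
    (cong₂ _+_ (trans (cong length (filter-++ (R? x) xs ys))
      (trans (length-++ (filter (R? x) xs)) (cong₂ _+_ (cong length (filter-none (R? x) r)) e)))
      (length-filter-++ rs s es))

AllPairs-map-∈ : {R S : Rel A 0ℓ} {xs : List A} → (∀ {x y} → x ∈ xs → y ∈ xs → R x y → S x y) →
                 AllPairs R xs → AllPairs S xs
AllPairs-map-∈ f []       = []
AllPairs-map-∈ f (r ∷ rs) = All.tabulate (λ y∈ → f (here refl) (there y∈) (All.lookup r y∈))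
  ∷ AllPairs-map-∈ (λ x∈ y∈ → f (there x∈) (there y∈)) rs

module _ {f : Fin N → Fin (N * 2)} where

  cross-image⁻ : (∀ {x y} → f x Fin.< f y → toℕ x < toℕ y) → ∀ {B C} → Cross (image f B) (image f C) → Cross B C
  cross-image⁻ f⁻ = [ inj₁ ∘ interleave , inj₂ ∘ interleave ]′
    where
    interleave : ∀ {B C} → Interleave (image f B) (image f C) → Interleave B C
    interleave (i , j , k , l , (ij , jk , kl) , (i∈ , k∈) , (j∈ , l∈))
      with ∈-image⁻ f i∈ | ∈-image⁻ f j∈ | ∈-image⁻ f k∈ | ∈-image⁻ f l∈
    ... | i , i∈ , refl | j , j∈ , refl | k , k∈ , refl | l , l∈ , refl =
      i , j , k , l , (f⁻ ij , f⁻ jk , f⁻ kl) , (i∈ , k∈) , (j∈ , l∈)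

private
  lo hi : Fin N → Fin (N * 2)
  lo i = combine i (zero {1})
  hi i = combine i (suc {1} zero)

  combine⁻ : ∀ {i j : Fin N} (a : Fin 2) → combine i a Fin.< combine j a → toℕ i < toℕ j
  combine⁻ {i = i} {j} a h = ℕ.≰⇒> λ j≤i → [ (λ j<i → ℕ.<-asym h (combine-monoˡ-< {i = j} {i} a a j<i))
    , (λ e → ℕ.<-irrefl (cong (λ z → toℕ (combine z a)) (sym (toℕ-injective {i = j} {i} e))) h) ]′ (ℕ.m≤n⇒m<n∨m≡n j≤i)

  hi<lo⁺ : ∀ {i j : Fin N} → toℕ i < toℕ j → hi i Fin.< lo j
  hi<lo⁺ {i = i} {j} = combine-monoˡ-< {i = i} {j} (suc zero) zero

  lo<hi⁺ : ∀ {i j : Fin N} → toℕ i ≤ toℕ j → lo i Fin.< hi j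
  lo<hi⁺ {i = i} {j} h with ℕ.m≤n⇒m<n∨m≡n h
  ... | inj₁ lt = combine-monoˡ-< {i = i} {j} zero (suc zero) lt
  ... | inj₂ e with refl ← toℕ-injective {i = i} {j} e =
    subst₂ _<_ (sym (toℕ-combine i zero)) (sym (toℕ-combine i (suc zero))) (ℕ.+-monoʳ-< (2 * toℕ i) (s≤s z≤n))

  lo<hi⁻ : ∀ {i j : Fin N} → lo i Fin.< hi j → toℕ i ≤ toℕ j
  lo<hi⁻ {i = i} {j} h = ℕ.≮⇒≥ λ lt → ℕ.<-asym h (hi<lo⁺ {i = j} {i} lt)

  hi<lo⁻ : ∀ {i j : Fin N} → hi i Fin.< lo j → toℕ i < toℕ j
  hi<lo⁻ {i = i} {j} h = ℕ.≰⇒> λ le → ℕ.<-asym h (lo<hi⁺ {i = j} {i} le)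

-- The half-open arcs account for the shift: y + ½ lies between x and x′ exactly when y is in [x ,
-- x′).
Separates : (x x′ y y′ : Fin N) → Set
Separates x x′ y y′ = Arc x y x′ × Arc x′ y′ x

crosses⁺ : {B C : Subset N} {x x′ y y′ : Fin N} → x ≢ x′ → x ∈ˢ B → x′ ∈ˢ B → y ∈ˢ C → y′ ∈ˢ C →
           Separates x x′ y y′ → Crosses B C
crosses⁺ {x = x} {x′} {y} {y′} x≢x′ x∈ x′∈ y∈ y′∈ (p , q) with ordering
  (¬′ (0F ≐ 1F) ⊃ (2F ≐ 0F ∨ cyc 0F 2F 1F) ⊃ (3F ≐ 1F ∨ cyc 1F 3F 0F) ⊃
   (¬′ (2F ≺ 0F) ∧ 2F ≺ 1F ∧ ¬′ (3F ≺ 1F)) ∨ (3F ≺ 0F ∧ ¬′ (2F ≺ 0F) ∧ 2F ≺ 1F) ∨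
   (¬′ (3F ≺ 1F) ∧ 3F ≺ 0F ∧ ¬′ (2F ≺ 0F)) ∨ (2F ≺ 1F ∧ ¬′ (3F ≺ 1F) ∧ 3F ≺ 0F))
  (x ∷ x′ ∷ y ∷ y′ ∷ []) (≢ℕ x≢x′) p q
-- The four cases are those in which the least of x, x′, y + ½, y′ + ½ is, in turn, x, y′ + ½, x′
-- and y + ½.
... | inj₁ (a , b , c) =
  inj₁ (_ , _ , _ , _ , (lo<hi⁺ {i = x} {y} (ℕ.≮⇒≥ a) , hi<lo⁺ {i = y} {x′} b , lo<hi⁺ {i = x′} {y′} (ℕ.≮⇒≥ c)) ,
    (∈-image⁺ lo x∈ , ∈-image⁺ lo x′∈) , (∈-image⁺ hi y∈ , ∈-image⁺ hi y′∈))
... | inj₂ (inj₁ (a , b , c)) =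
  inj₂ (_ , _ , _ , _ , (hi<lo⁺ {i = y′} {x} a , lo<hi⁺ {i = x} {y} (ℕ.≮⇒≥ b) , hi<lo⁺ {i = y} {x′} c) ,
    (∈-image⁺ hi y′∈ , ∈-image⁺ hi y∈) , (∈-image⁺ lo x∈ , ∈-image⁺ lo x′∈))
... | inj₂ (inj₂ (inj₁ (a , b , c))) =
  inj₁ (_ , _ , _ , _ , (lo<hi⁺ {i = x′} {y′} (ℕ.≮⇒≥ a) , hi<lo⁺ {i = y′} {x} b , lo<hi⁺ {i = x} {y} (ℕ.≮⇒≥ c)) ,
    (∈-image⁺ lo x′∈ , ∈-image⁺ lo x∈) , (∈-image⁺ hi y′∈ , ∈-image⁺ hi y∈))
... | inj₂ (inj₂ (inj₂ (a , b , c))) =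
  inj₂ (_ , _ , _ , _ , (hi<lo⁺ {i = y} {x′} a , lo<hi⁺ {i = x′} {y′} (ℕ.≮⇒≥ b) , hi<lo⁺ {i = y′} {x} c) ,
    (∈-image⁺ hi y∈ , ∈-image⁺ hi y′∈) , (∈-image⁺ lo x′∈ , ∈-image⁺ lo x∈))

crosses⁻ : {B C : Subset N} → Crosses B C →
  ∃[ x ] ∃[ x′ ] ∃[ y ] ∃[ y′ ] x ≢ x′ × y ≢ y′ × (x ∈ˢ B × x′ ∈ˢ B) × (y ∈ˢ C × y′ ∈ˢ C) × Separates x x′ y y′
crosses⁻ {N = N} (inj₁ (i , j , k , l , (ij , jk , kl) , (i∈ , k∈) , (j∈ , l∈)))
  with ∈-image⁻ (lo {N}) i∈ | ∈-image⁻ (hi {N}) j∈ | ∈-image⁻ (lo {N}) k∈ | ∈-image⁻ (hi {N}) l∈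
... | x , x∈ , refl | y , y∈ , refl | x′ , x′∈ , refl | y′ , y′∈ , refl =
  x , x′ , y , y′ , (λ { refl → ℕ.<⇒≱ yx′ xy }) , (λ { refl → ℕ.<⇒≱ yx′ x′y′ }) , (x∈ , x′∈) , (y∈ , y′∈) ,
  ordering (¬′ (2F ≺ 0F) ⊃ 2F ≺ 1F ⊃ ¬′ (3F ≺ 1F) ⊃
    (2F ≐ 0F ∨ cyc 0F 2F 1F) ∧ (3F ≐ 1F ∨ cyc 1F 3F 0F))
    (x ∷ x′ ∷ y ∷ y′ ∷ []) (ℕ.≤⇒≯ xy) yx′ (ℕ.≤⇒≯ x′y′)
  where
  xy   = lo<hi⁻ {i = x} {y} ij
  yx′  = hi<lo⁻ {i = y} {x′} jk
  x′y′ = lo<hi⁻ {i = x′} {y′} kl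
crosses⁻ {N = N} (inj₂ (i , j , k , l , (ij , jk , kl) , (i∈ , k∈) , (j∈ , l∈)))
  with ∈-image⁻ (hi {N}) i∈ | ∈-image⁻ (lo {N}) j∈ | ∈-image⁻ (hi {N}) k∈ | ∈-image⁻ (lo {N}) l∈
... | y′ , y′∈ , refl | x , x∈ , refl | y , y∈ , refl | x′ , x′∈ , refl =
  x , x′ , y , y′ , (λ { refl → ℕ.<⇒≱ yx′ xy }) , (λ { refl → ℕ.<⇒≱ y′x xy }) , (x∈ , x′∈) , (y∈ , y′∈) ,
  ordering (3F ≺ 0F ⊃ ¬′ (2F ≺ 0F) ⊃ 2F ≺ 1F ⊃
    (2F ≐ 0F ∨ cyc 0F 2F 1F) ∧ (3F ≐ 1F ∨ cyc 1F 3F 0F))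
    (x ∷ x′ ∷ y ∷ y′ ∷ []) y′x (ℕ.≤⇒≯ xy) yx′
  where
  y′x = hi<lo⁻ {i = y′} {x} ij
  xy  = lo<hi⁻ {i = x} {y} jk
  yx′ = hi<lo⁻ {i = y} {x′} kl

module _ (M M′ : Matching n) (V : Fin (2 * n) → Fin (2 * n))
  (separates : ∀ x → Separates x (partner M x) (V x) (partner M′ (V x)))
  (separates-only : ∀ {x y} → Separates x (partner M x) y (partner M′ y) → y ≡ V x ⊎ y ≡ partner M′ (V x)) where

  V-crosses : ∀ {B D x} → M ∋ B → M′ ∋ D → x ∈ˢ B → V x ∈ˢ D → Crosses B D
  V-crosses {B} {D} {x} B∈ D∈ x∈ Vx∈ =
    crosses⁺ (partner-fixpoint M x ∘ sym) x∈ (same-∈ (partition M) B∈ x∈ (same-partner M x))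
      Vx∈ (same-∈ (partition M′) D∈ Vx∈ (same-partner M′ (V x))) (separates x)

  private
    on-strand : ∀ {D x y} → M′ ∋ D → y ∈ˢ D → Separates x (partner M x) y (partner M′ y) → V x ∈ˢ D
    on-strand {D} {x} {y} D∈ y∈ s with separates-only {x} {y} s
    ... | inj₁ refl = y∈
    ... | inj₂ refl = subst (_∈ˢ D) (partner-involutive M′ (V x)) (same-∈ (partition M′) D∈ y∈ (same-partner M′ y))

    other : ∀ (M : Matching n) {B x y} → M ∋ B → x ≢ y → x ∈ˢ B → y ∈ˢ B → y ≡ partner M x
    other M {B} {x} {y} B∈ x≢y x∈ y∈ with same⇒partner M {x} {y} (B , B∈ , x∈ , y∈)
    ... | inj₁ e = contradiction (sym e) x≢y
    ... | inj₂ e = e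

  -- Together with `V-crosses` this replaces crossing of blocks by a map on points, so that
  -- statements about crossings become statements about composites of such maps.
  crosses-V : ∀ {B D x} → M ∋ B → M′ ∋ D → x ∈ˢ B → Crosses B D → V x ∈ˢ D
  crosses-V {B} {D} {x} B∈ D∈ x∈ h with crosses⁻ h
  ... | z , z′ , y , y′ , z≢z′ , y≢y′ , (z∈ , z′∈) , (y∈ , y′∈) , (p , q)
    with same⇒partner M {z} {x} (B , B∈ , z∈ , x∈) | other M B∈ z≢z′ z∈ z′∈ | other M′ D∈ y≢y′ y∈ y′∈
  ... | inj₁ refl | refl | refl = on-strand D∈ y∈ (p , q)
  ... | inj₂ refl | refl | refl = on-strand D∈ y′∈
    ( subst (Arc x y′) (sym (partner-involutive M z)) q
    , subst₂ (λ w v → Arc w v x) (sym (partner-involutive M z)) (sym (partner-involutive M′ y)) p)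

  private
    unequal : (P : Partition (2 * n)) → ∀ {B C} → P ∋ᴾ B → P ∋ᴾ C → Empty (B ∩ C) → B ≢ C
    unequal P {B} B∈ C∈ e refl = let x , x∈ = All.lookup (nonempty P) B∈ in e (x , x∈p∩q⁺ (x∈ , x∈))

  -- Neither matching crosses itself, and each pair of M crosses precisely the pair of M′ through V
  -- x; so there is one crossing for each of the n pairs of M.
  isBasketball : Noncrossing (partition M) → Noncrossing (partition M′) → IsBasketball M M′
  isBasketball nc nc′ = record
    { noncrossing₁ = nc
    ; noncrossing₂ = nc′
    ; crossings    = trans
      (length-filter-++ cross?
        (AllPairs.map⁺ (AllPairs-map-∈ (λ B∈ C∈ e →
          nc B∈ C∈ (unequal (partition M) B∈ C∈ e) ∘ cross-image⁻ (λ {i} {j} → combine⁻ {i = i} {j} zero)) (disjoint (partition M))))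
        (AllPairs.map⁺ (AllPairs-map-∈ (λ B∈ C∈ e →
          nc′ B∈ C∈ (unequal (partition M′) B∈ C∈ e) ∘ cross-image⁻ (λ {i} {j} → combine⁻ {i = i} {j} (suc zero))) (disjoint (partition M′))))
        (All.map⁺ (All.tabulate once)))
      (trans (length-map integral (blocks (partition M))) (∣pairs∣ M))
    }
    where
    once : ∀ {B} → M ∋ B → length (filter (cross? (integral B)) (map half (blocks (partition M′)))) ≡ 1
    once {B} B∈ with All.lookup (nonempty (partition M)) B∈
    ... | x , x∈ with block-of (partition M′) (V x)
    ... | D , D∈ , Vx∈ = trans (length-filter-map (cross? (integral B)) half (blocks (partition M′)))
      (length-filter-unique (cross? (integral B) ∘ half)
        (AllPairs-map-∈ (unequal (partition M′)) (disjoint (partition M′)))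
        D∈ (V-crosses B∈ D∈ x∈ Vx∈)
        (λ C∈ h → block-unique (partition M′) C∈ D∈ (crosses-V B∈ C∈ x∈ h) Vx∈))

-- From necklaces to chains

isNC-cong : {μ ν : Fin N → Fin N} → (∀ x → μ x ≡ ν x) → IsNCInvolution μ → IsNCInvolution ν
isNC-cong {μ = μ} {ν} e i = record
  { involutive  = λ x → trans (sym (trans (e (μ x)) (cong ν (e x)))) (involutive x)
  ; fixpoint    = λ x h → fixpoint x (trans (e x) h)
  ; noncrossing = λ {x} {y} h → subst₂ (Cyc x) (e y) (e x) (noncrossing (subst (Cyc x y) (sym (e x)) h))
  }
  where open IsNCInvolution i

exchange-cong : {μ μ′ ν ν′ : Fin N → Fin N} → (∀ x → μ x ≡ μ′ x) → (∀ x → ν x ≡ ν′ x) →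
                Exchange μ ν → Exchange μ′ ν′
exchange-cong e e′ ex = record
  { a = a ; u = u ; b = b ; v = v
  ; μa = trans (sym (e a)) μa ; μb = trans (sym (e b)) μb
  ; νa = trans (sym (e′ a)) νa ; νb = trans (sym (e′ b)) νb
  ; off = λ {x} p q r s → trans (sym (e x)) (trans (off p q r s) (e′ x)) }
  where open Exchange ex

flip-congˡ : {μ μ′ ν : Fin N → Fin N} → (∀ x → μ x ≡ μ′ x) → Flip μ ν → Flip μ′ ν
flip-congˡ e f = record { exchange = exchange-cong e (λ _ → refl) exchange ; avb = avb ; bua = bua }
  where open Flip f

meander-cong : {μ μ′ ν ν′ : Fin N → Fin N} → (∀ x → μ x ≡ μ′ x) → (∀ x → ν x ≡ ν′ x) → Meander μ ν ⇒ Meander μ′ ν′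
meander-cong {μ′ = μ′} {ν′ = ν′} e e′ = meander-fold (IsDecEquivalence.isEquivalence (meander-isDecEquivalence μ′ ν′))
  (λ x → subst (Meander μ′ ν′ x) (sym (e x)) (meanderˡ x)) (λ x → subst (Meander μ′ ν′ x) (sym (e′ x)) (meanderʳ x))

refines⇒same : {P Q : Partition N} → Refines P Q → Same P ⇒ Same Q
refines⇒same r (B , B∈ , x∈ , y∈) = let C , C∈ , B⊆C = r B∈ in C , C∈ , B⊆C x∈ , B⊆C y∈

same⇒refines : (P Q : Partition N) → Same P ⇒ Same Q → Refines P Q
same⇒refines P Q P⇒Q {B} B∈ with All.lookup (nonempty P) B∈
... | x , x∈ with block-of Q x
... | C , C∈ , x∈C = C , C∈ , λ y∈ → same-∈ Q C∈ x∈C (P⇒Q (B , B∈ , x∈ , y∈))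

∣loops∣≡∣pairs∣ : (M : Matching n) → ∣loops∣ (partner M) (partner M) ≡ n
∣loops∣≡∣pairs∣ M = trans (∣classes∣-cong (meander-isDecEquivalence _ _) S
    (meander-fold (IsDecEquivalence.isEquivalence S) (same-partner M) (same-partner M))
    (λ {x} {y} h → [ (λ { refl → IsDecEquivalence.refl (meander-isDecEquivalence _ _) }) , (λ { refl → meanderˡ x }) ]′
      (same⇒partner M {x} {y} h)))
  (trans (sym (∣blocks∣≡∣classes∣ (partition M))) (∣pairs∣ M))
  where S = same-isDecEquivalence (partition M)

-- The loops are the blocks of the link, the blocks determine σ as their successor permutation, and
-- μ and σ determine ν by conjugation.
link-unique : {μ ν ν′ σ σ⁻ σ′ σ′⁻ : Fin N → Fin N} (i : IsNCInvolution μ)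
  (l : IsLink μ ν σ σ⁻) (l′ : IsLink μ ν′ σ′ σ′⁻) →
  Meander μ ν ⇒ Meander μ ν′ → Meander μ ν′ ⇒ Meander μ ν → ∀ x → ν x ≡ ν′ x
link-unique {μ = μ} {ν} {ν′} {σ} {σ⁻} {σ′} {σ′⁻} i l l′ to from x = L.σ-injective
  (trans (L.conjugate x) (trans (cong μ (σ≡σ′ x)) (trans (sym (L′.conjugate x)) (sym (σ≡σ′ (ν′ x))))))
  where
  module L  = Link i l
  module L′ = Link i l′
  D  = IsDecEquivalence.isEquivalence (meander-isDecEquivalence μ ν)
  D′ = IsDecEquivalence.isEquivalence (meander-isDecEquivalence μ ν′)

  ≋⇒≋′ : ∀ {x y} → x L.≋ y → x L′.≋ y
  ≋⇒≋′ h = meander-fold L′.≋-isEquivalence L′.≋μ L′.≋ν (to (L.Connected.connected D meanderˡ meanderʳ h))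
  ≋′⇒≋ : ∀ {x y} → x L′.≋ y → x L.≋ y
  ≋′⇒≋ h = meander-fold L.≋-isEquivalence L.≋μ L.≋ν (from (L′.Connected.connected D′ meanderˡ meanderʳ h))

  σ≡σ′ : ∀ x → σ x ≡ σ′ x
  σ≡σ′ x = next-unique (next-cong {_∼_ = L._≋_} {L′._≋_} ≋⇒≋′ ≋′⇒≋ (link-next i l x)) (link-next i l′ x)

module Positions (k : ℕ) where

  -- Truncation at k is a default value that lets matchings be indexed by all natural numbers.
  pos : ℕ → Fin (suc k)
  pos i = fromℕ< (s≤s (ℕ.m⊓n≤n i k))

  toℕ-pos : ∀ {i} → i ≤ k → toℕ (pos i) ≡ i
  toℕ-pos i≤k = trans (toℕ-fromℕ< _) (ℕ.m≤n⇒m⊓n≡m i≤k)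

  toℕ≤k : ∀ (s : Fin (suc k)) → toℕ s ≤ k
  toℕ≤k s = ℕ.≤-pred (toℕ<n s)

  pos-toℕ : ∀ s → pos (toℕ s) ≡ s
  pos-toℕ s = toℕ-injective (toℕ-pos (toℕ≤k s))

  open Rotation (2 * suc k) (1<2*n (suc k)) public

module FromNecklace {k : ℕ} (𝓝 : Necklace (suc k)) where

  open Necklace 𝓝 renaming (noncrossing to M-noncrossing) public
  open Positions k

  μ : Fin (suc k) → Fin (2 * suc k) → Fin (2 * suc k)
  μ s = partner (matching s)

  μ-isNC : ∀ s → IsNCInvolution (μ s)
  μ-isNC s = partner-isNC (matching s) (M-noncrossing s)

  μ-flip : ∀ {r s} → s IsNext r → Flip (μ r) (μ s)
  μ-flip {r} {s} succ = uncurry (exchange⇒flip (μ-isNC r) (μ-isNC s))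
    (isFlip⇒exchange (matching r) (matching s) (flip succ))

  private
    f : ℕ → Fin (2 * suc k) → Fin (2 * suc k)
    f i = μ (pos i)

    f-flip : ∀ {i} → i < k → Flip (f i) (f (suc i))
    f-flip i<k = μ-flip (trans (toℕ-pos i<k) (cong suc (sym (toℕ-pos (ℕ.<⇒≤ i<k)))))

    f-closed : ∀ x → c (f k x) ≡ f 0 (c x)
    f-closed = isRotation⇒conjugate (matching first) (matching (pos k)) (closed (cong suc (toℕ-pos ℕ.≤-refl)))

    -- The necklace extended by the rotation of M₂, …, Mₙ, so that the tuple of
    -- n matchings starting at any Mᵣ is again a necklace.
    g : ℕ → Fin (2 * suc k) → Fin (2 * suc k)
    g i with i ℕ.≤? k
    ... | yes _ = f i
    ... | no  _ = rotate (f (i ∸ k))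

    g-≤ : ∀ {i} → i ≤ k → g i ≡ f i
    g-≤ {i} i≤k with i ℕ.≤? k
    ... | yes _ = refl
    ... | no  n = contradiction i≤k n

    g-> : ∀ {i} → k < i → g i ≡ rotate (f (i ∸ k))
    g-> {i} k<i with i ℕ.≤? k
    ... | yes p = contradiction p (ℕ.<⇒≱ k<i)
    ... | no  _ = refl

    g-isNC : ∀ i → IsNCInvolution (g i)
    g-isNC i with i ℕ.≤? k
    ... | yes _ = μ-isNC _
    ... | no  _ = rotate-isNC (μ-isNC _)

    g-flip : ∀ i → i < k + k → Flip (g i) (g (suc i))
    g-flip i i<k+k with ℕ.<-cmp i k
    ... | tri< i<k _ _ = subst₂ Flip (sym (g-≤ (ℕ.<⇒≤ i<k))) (sym (g-≤ i<k)) (f-flip i<k)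
    -- At the seam, M₁(-1) is the last matching `f k` itself, so the next flip is the first one
    -- rotated.
    ... | tri≈ _ refl _ = subst₂ Flip (sym (g-≤ ℕ.≤-refl)) (sym (g-> ℕ.≤-refl))
      (subst (λ j → Flip (f k) (rotate (f j))) (sym (ℕ.m+n∸n≡m 1 k))
        (flip-congˡ (λ x → sym (trans (sym (c⁻c _)) (cong c⁻ (f-closed x)))) (rotate-flip (f-flip 0<k))))
      where
      0<k : 0 < k
      0<k = ℕ.+-cancelˡ-< k 0 k (subst (_< k + k) (sym (ℕ.+-identityʳ k)) i<k+k)
    ... | tri> _ _ k<i = subst₂ Flip (sym (g-> k<i)) (sym (g-> (ℕ.m≤n⇒m≤1+n k<i)))
      (subst (λ j → Flip (rotate (f (i ∸ k))) (rotate (f j))) (sym (ℕ.+-∸-assoc 1 (ℕ.<⇒≤ k<i)))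
        (rotate-flip (f-flip (ℕ.+-cancelʳ-< k (i ∸ k) k (subst (_< k + k) (sym (ℕ.m∸n+n≡m (ℕ.<⇒≤ k<i))) i<k+k)))))

    g-closed : ∀ r → r ≤ k → ∀ x → c (g (k + r) x) ≡ g r (c x)
    g-closed zero _ x = subst (λ h → c (h x) ≡ f 0 (c x))
      (sym (trans (cong g (ℕ.+-identityʳ k)) (g-≤ ℕ.≤-refl))) (f-closed x)
    g-closed (suc r) r<k x = subst₂ (λ h h′ → c (h x) ≡ h′ (c x))
      (sym (trans (g-> (ℕ.m<m+n k (s≤s z≤n))) (cong (λ j → rotate (f j)) (ℕ.m+n∸m≡n k (suc r)))))
      (sym (g-≤ r<k)) (cc⁻ _)

    g-pairs : ∀ r → r ≤ k → ∣loops∣ (g r) (g r) ≡ suc k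
    g-pairs r r≤k = subst (λ h → ∣loops∣ h h ≡ suc k) (sym (g-≤ r≤k)) (∣loops∣≡∣pairs∣ (matching (pos r)))

    module S = Sequence k g g-isNC g-flip g-closed g-pairs

    g-at : ∀ s {i} → i ≡ toℕ s → g i ≡ μ s
    g-at s refl = trans (g-≤ (toℕ≤k s)) (cong μ (pos-toℕ s))

    g-first : g 0 ≡ μ first
    g-first = g-≤ z≤n

  link : ∀ s → ∃[ σ ] ∃[ σ⁻ ] IsLink (μ first) (μ s) σ σ⁻
  link s = subst₂ (λ h h′ → ∃[ σ ] ∃[ σ⁻ ] IsLink h h′ σ σ⁻) g-first (g-at s (ℕ.+-identityʳ _))
    (_ , _ , S.link z≤n (k ∸ toℕ s) (toℕ s) (ℕ.m∸n+n≡m (toℕ≤k s)))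

  ∣loops∣-exact : ∀ s → ∣loops∣ (μ first) (μ s) ≡ suc k ∸ toℕ s
  ∣loops∣-exact s = trans (sym (ℕ.m+n∸m≡n (toℕ s) _)) (cong (_∸ toℕ s)
    (subst₂ (λ h h′ → toℕ s + ∣loops∣ h h′ ≡ suc k) g-first (g-at s (ℕ.+-identityʳ _))
      (S.∣Π∣-exact z≤n (toℕ s) (toℕ≤k s))))

  meander-increases : ∀ {r s} → s IsNext r → Meander (μ first) (μ r) ⇒ Meander (μ first) (μ s)
  meander-increases {r} {s} succ {x} {y} = subst₂ (λ h h′ → Meander (μ first) h x y → Meander (μ first) h′ x y)
    (g-at r (ℕ.+-identityʳ _)) (g-at s (trans (ℕ.+-identityʳ _) (sym succ)))
    (subst (λ h → Meander h (g (toℕ r + 0)) x y → Meander h (g (suc (toℕ r) + 0)) x y) g-first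
      (S.Π-increases z≤n (subst (_≤ k) succ (toℕ≤k s))))

  strand : (r s : Fin (suc k)) → Fin (2 * suc k) → Fin (2 * suc k)
  strand r s = S.strand (toℕ r) (toℕ s ∸ toℕ r)

  module _ {r s : Fin (suc k)} (r<s : r Fin.< s) where

    private
      module C = S.Crossings {toℕ r} {toℕ s ∸ toℕ r} (toℕ≤k r) (ℕ.≤-trans (ℕ.m∸n≤m (toℕ s) (toℕ r)) (toℕ≤k s))

      r-at = g-at r refl
      s-at = g-at s (ℕ.m∸n+n≡m (ℕ.<⇒≤ r<s))

    strand-separates : ∀ x → Separates x (μ r x) (strand r s x) (μ s (strand r s x))
    strand-separates = subst₂ (λ h h′ → ∀ x → Separates x (h x) (strand r s x) (h′ (strand r s x)))
      r-at s-at C.crosses-strand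

    only-strand-separates : ∀ {x y} → Separates x (μ r x) y (μ s y) → y ≡ strand r s x ⊎ y ≡ μ s (strand r s x)
    only-strand-separates {x} {y} = subst₂
      (λ h h′ → Separates x (h x) y (h′ y) → y ≡ strand r s x ⊎ y ≡ h′ (strand r s x))
      r-at s-at (uncurry C.crosses-only-strand)

    strand-crosses : ∀ {B D x} → matching r ∋ B → matching s ∋ D → x ∈ˢ B → strand r s x ∈ˢ D → Crosses B D
    strand-crosses = V-crosses (matching r) (matching s)
      (strand r s) strand-separates only-strand-separates

    crosses-strand : ∀ {B D x} → matching r ∋ B → matching s ∋ D → x ∈ˢ B → Crosses B D → strand r s x ∈ˢ D
    crosses-strand = crosses-V (matching r) (matching s)
      (strand r s) strand-separates only-strand-separates

    necklace-basketball : IsBasketball (matching r) (matching s)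
    necklace-basketball = isBasketball (matching r) (matching s) (strand r s)
      strand-separates only-strand-separates (M-noncrossing r) (M-noncrossing s)

  strand-trans : ∀ {r s t : Fin (suc k)} → r Fin.< s → s Fin.< t → ∀ x → strand r t x ≡ strand s t (strand r s x)
  strand-trans {r} {s} {t} r<s s<t x = trans
    (cong (λ m → S.strand (toℕ r) m x) (sym (ℕ.m∸n+n≡m {toℕ t ∸ toℕ r} {toℕ s ∸ toℕ r} (ℕ.∸-monoˡ-≤ (toℕ r) (ℕ.<⇒≤ s<t)))))
    (trans (cong (λ l → S.strand (toℕ r) (l + (toℕ s ∸ toℕ r)) x) diff)
      (trans (S.strand-+ (toℕ r) (toℕ s ∸ toℕ r) (toℕ t ∸ toℕ s) x)
        (cong (λ i → S.strand i (toℕ t ∸ toℕ s) (strand r s x)) (ℕ.m∸n+n≡m (ℕ.<⇒≤ r<s)))))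
    where
    diff : toℕ t ∸ toℕ r ∸ (toℕ s ∸ toℕ r) ≡ toℕ t ∸ toℕ s
    diff = trans (ℕ.∸-+-assoc (toℕ t) (toℕ r) (toℕ s ∸ toℕ r)) (cong (toℕ t ∸_) (ℕ.m+[n∸m]≡n (ℕ.<⇒≤ r<s)))

  isStrong : IsStrongNecklace matching
  isStrong = record
    { noncrossing = M-noncrossing
    ; basketball  = necklace-basketball
    ; transitive  = trans′
    ; distinct    = λ {r} {s} succ Ms≈Mr → let open Flip (μ-flip succ) in
        ¬cyc-xyx (subst (Cyc a v) (IsNCInvolution.injective (μ-isNC r)
          (trans μb (trans (sym νa) (≈⇒partner (matching s) (matching r) Ms≈Mr a)))) avb)
    }
    where
    trans′ : ∀ {r s t} → r Fin.< s → s Fin.< t → ∀ {B C D} → matching r ∋ B → matching s ∋ C → matching t ∋ D →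
             Crosses B C → Crosses B D → Crosses C D
    trans′ {r} {s} {t} r<s s<t {B} {C} {D} B∈ C∈ D∈ BC BD with All.lookup (nonempty (partition (matching r))) B∈
    -- The strands from x pass through C at s and through D at t. Since the strand from r to t
    -- continues the one from r to s, the strand starting in C at s ends in D.
    ... | x , x∈ = strand-crosses s<t C∈ D∈ (crosses-strand r<s B∈ C∈ x∈ BC)
      (subst (_∈ˢ D) (strand-trans r<s s<t x) (crosses-strand (ℕ.<-trans r<s s<t) B∈ D∈ x∈ BD))

  part : Fin (suc k) → Partition (2 * suc k)
  part s = Π₀ (matching first) (matching s)

  private
    same⇒ : ∀ s → Same (part s) ⇒ Meander (μ first) (μ s)
    same⇒ s = same⇒meander (matching first) (matching s)

    ⇒same : ∀ s → Meander (μ first) (μ s) ⇒ Same (part s)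
    ⇒same s = meander⇒same (matching first) (matching s)

    part-noncrossing : ∀ s → Noncrossing (part s)
    part-noncrossing s = isNC⇒noncrossing (part s) λ abc cda ac bd →
      ⇒same s (L.Connected.connected (IsDecEquivalence.isEquivalence (meander-isDecEquivalence (μ first) (μ s)))
        meanderˡ meanderʳ (L.≋-noncrossing abc cda (same⇒≋ ac) (same⇒≋ bd)))
      where
      module L = Link (μ-isNC first) (proj₂ (proj₂ (link s)))
      same⇒≋ : ∀ {x y} → Same (part s) x y → x L.≋ y
      same⇒≋ = meander-fold L.≋-isEquivalence L.≋μ L.≋ν ∘ same⇒ s

  chain : MaximalChain (suc k)
  chain = record
    { parts        = part
    ; noncrossing  = part-noncrossing
    ; twoDivisible = λ s {B} B∈ → involution-even (partner-involutive (matching first)) (partner-fixpoint (matching first))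
        _ B ℕ.≤-refl λ {x} x∈ → same-∈ (part s) B∈ x∈ (⇒same s (meanderˡ x))
    ; ∣blocks∣     = λ s → trans (∣blocks∣≡∣classes∣ (part s)) (trans
        (∣classes∣-cong (same-isDecEquivalence (part s)) (meander-isDecEquivalence (μ first) (μ s)) (same⇒ s) (⇒same s))
        (∣loops∣-exact s))
    ; refines      = λ {r} {s} succ → same⇒refines (part r) (part s) (⇒same s ∘ meander-increases succ ∘ same⇒ r)
    }

-- From chains to necklaces

link-congˡ : {μ μ′ ν σ σ⁻ : Fin N → Fin N} → (∀ x → μ x ≡ μ′ x) → IsLink μ ν σ σ⁻ → IsLink μ′ ν σ σ⁻
link-congˡ {σ = σ} e l = record
  { σσ⁻ = σσ⁻ ; σ⁻σ = σ⁻σ ; σ-moves = σ-moves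
  ; conjugate = λ x → trans (conjugate x) (e (σ x))
  ; gap-σ = gap-σ
  ; gap-μ = λ {z} {x} h → subst (λ y → Cyc z y (σ z)) (e x) (gap-μ h)
  }
  where open IsLink l

merge-exchange : {μ νP νQ σP σP⁻ σQ σQ⁻ : Fin N → Fin N} → IsNCInvolution μ →
  IsLink μ νP σP σP⁻ → IsLink μ νQ σQ σQ⁻ → {a b : Fin N} →
  (∀ x → σP x ≡ σQ (transpose a b x)) → νP a ≢ b → νP b ≢ a → Exchange νP νQ
merge-exchange {μ = μ} {νP} {νQ} {σP} {σP⁻} {σQ} {σQ⁻} i lP lQ {a} {b} σP≡ νa≢b νb≢a = record
  { a = a ; u = νP a ; b = b ; v = νP b ; μa = refl ; μb = refl
  ; νa = sym (agree {b} {a} νb≢a (νP-fixpoint b) (trans (σP≡ b) (cong σQ (transpose-right a b))))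
  ; νb = sym (agree {a} {b} (νP-fixpoint a) νa≢b (trans (σP≡ a) (cong σQ (transpose-left a b))))
  ; off = λ {x} x≢a x≢b x≢νa x≢νb → agree {x} {x}
      (λ e → x≢νa (trans (sym (νP-involutive x)) (cong νP e)))
      (λ e → x≢νb (trans (sym (νP-involutive x)) (cong νP e)))
      (trans (σP≡ x) (cong σQ (transpose-fixes x≢a x≢b)))
  }
  where
  module P = Link i lP
  module Q = Link i lQ
  module μ = IsNCInvolution i

  -- Both sides have the same image under σQ. As the transposition fixes νP x, that image is σP (νP
  -- x) = μ (σP x) on the left, and it is μ (σQ y) on the right.
  agree : ∀ {x y} → νP x ≢ a → νP x ≢ b → σP x ≡ σQ y → νP x ≡ νQ y
  agree {x} {y} ≢a ≢b e = Q.σ-injective (trans (cong σQ (sym (transpose-fixes ≢a ≢b))) (trans (sym (σP≡ (νP x)))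
    (trans (P.conjugate x) (trans (cong μ e) (sym (Q.conjugate y))))))

  νP-fixpoint : ∀ x → νP x ≢ x
  νP-fixpoint x e = μ.fixpoint (σP x) (trans (sym (P.conjugate x)) (cong σP e))

  νP-involutive : ∀ x → νP (νP x) ≡ x
  νP-involutive x = P.σ-injective (trans (P.conjugate (νP x)) (trans (cong μ (P.conjugate x)) (μ.involutive (σP x))))

module FromChain {k : ℕ} (𝓒 : MaximalChain (suc k)) where

  open MaximalChain 𝓒 renaming (noncrossing to P-noncrossing; ∣blocks∣ to P-∣blocks∣)
  open Positions k

  private
    P₁ : Partition (2 * suc k)
    P₁ = parts first

    ∣P₁∣ : length (blocks P₁) ≡ suc k
    ∣P₁∣ = P-∣blocks∣ first

    Same-isDec : ∀ s → IsDecEquivalence (Same (parts s))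
    Same-isDec s = same-isDecEquivalence (parts s)

    module P s = IsDecEquivalence (Same-isDec s)

    ∣P∣ : ∀ s → ∣classes∣ (Same-isDec s) ≡ suc k ∸ toℕ s
    ∣P∣ s = trans (sym (∣blocks∣≡∣classes∣ (parts s))) (P-∣blocks∣ s)

    block-sizes : All (λ B → ∣ B ∣ ≡ 2) (blocks P₁)
    block-sizes = sizes-tight (All.tabulate λ B∈ → at-least-2 B∈ (All.lookup (nonempty P₁) B∈))
      (ℕ.≤-trans (sum-sizes (disjoint P₁)) (ℕ.≤-reflexive (cong (2 *_) (sym ∣P₁∣))))
      where
      at-least-2 : ∀ {B} → P₁ ∋ᴾ B → Nonempty B → 2 ≤ ∣ B ∣
      at-least-2 B∈ (x , x∈) =
        ∣⇒≤ {{>-nonZero (subst (0 <_) (sym (∣∖∣ x∈)) (s≤s z≤n))}} (twoDivisible first B∈)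

  M₁ : Matching (suc k)
  M₁ = record { partition = P₁ ; ∣pairs∣ = ∣P₁∣ ; ∣pair∣ = All.lookup block-sizes }

  private
    μ : Fin (2 * suc k) → Fin (2 * suc k)
    μ = partner M₁

    μ-isNC : IsNCInvolution μ
    μ-isNC = partner-isNC M₁ (P-noncrossing first)

    module μ = IsNCInvolution μ-isNC

    coarser : ∀ {r s} → s IsNext r → Same (parts r) ⇒ Same (parts s)
    coarser {r} {s} succ = refines⇒same {P = parts r} {parts s} (refines succ)

    first-refines : ∀ i → i ≤ k → Same P₁ ⇒ Same (parts (pos i))
    first-refines zero    _   h = h
    first-refines (suc i) i<k h =
      coarser (trans (toℕ-pos i<k) (cong suc (sym (toℕ-pos (ℕ.<⇒≤ i<k))))) (first-refines i (ℕ.<⇒≤ i<k) h)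

    ∼μ : ∀ s x → Same (parts s) x (μ x)
    ∼μ s x = subst (λ t → Same (parts t) x (μ x)) (pos-toℕ s)
      (first-refines (toℕ s) (toℕ≤k s) (same-partner M₁ x))

    isNC : ∀ s → IsNCEquivalence (Same (parts s))
    isNC s = same-isNC (parts s) (P-noncrossing s)

    module S s = Successor (isNC s) μ-isNC (∼μ s)
    module L s = Link μ-isNC (S.link s)
    module R s = Relabel M₁ {S.σ s} {S.σ⁻ s} (L.σσ⁻ s) (L.σ⁻σ s)

  M : Fin (suc k) → Matching (suc k)
  M s = R.relabel s

  private
    partner-M : ∀ s x → partner (M s) x ≡ S.ν s x
    partner-M = R.partner-relabel

    M-noncrossing : ∀ s → Noncrossing (partition (M s))
    M-noncrossing s = isNC-partner⇒noncrossing (M s) (isNC-cong (sym ∘ partner-M s) (S.ν-isNC s))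

    -- The successor of a point in a block of two is its partner. Conjugation by σ is then trivial,
    -- and the necklace starts at M₁.
    σ-first : ∀ x → S.σ first x ≡ μ x
    σ-first x = [ (λ e → contradiction (sym e) (Next.distinct (S.σ-next first x))) , id ]′
      (same⇒partner M₁ {x} {S.σ first x} (Next.related (S.σ-next first x)))

  M-first : ∀ x → partner (M first) x ≡ μ x
  M-first x = trans (partner-M first x) (μ.injective
    (trans (sym (σ-first _)) (trans (L.conjugate first x) (cong μ (σ-first x)))))

  module _ {r s : Fin (suc k)} (succ : s IsNext r) where

    private
      P = Same (parts r)
      Q = Same (parts s)

      one-fewer : ∣classes∣ (Same-isDec r) ≡ suc (∣classes∣ (Same-isDec s))
      one-fewer = trans (∣P∣ r) (trans (ℕ.+-∸-assoc 1 (ℕ.≤-trans (ℕ.n≤1+n _) r<k))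
        (cong suc (sym (trans (∣P∣ s) (cong (suc k ∸_) succ)))))
        where
        r<k : suc (toℕ r) ≤ k
        r<k = subst (_≤ k) succ (toℕ≤k s)

      merged : ∃[ p ] ∃[ q ] Q p q × ¬ P p q
      merged with any? (λ p → any? (λ q → P._≟_ s p q ×-dec ¬? (P._≟_ r p q)))
      ... | yes h  = h
      ... | no  ¬h = contradiction
        (∣classes∣-anti (Same-isDec s) (Same-isDec r) λ {x} {y} Qxy →
          decidable-stable (P._≟_ r x y) λ n → ¬h (x , y , Qxy , n))
        (ℕ.<⇒≱ (ℕ.≤-reflexive (sym one-fewer)))

      p q : Fin (2 * suc k)
      p = proj₁ merged
      q = proj₁ (proj₂ merged)
      Qpq : Q p q
      Qpq = proj₁ (proj₂ (proj₂ merged))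
      ¬Ppq : ¬ P p q
      ¬Ppq = proj₂ (proj₂ (proj₂ merged))

      module J = Glue (Same-isDec r) p q

      J⇒Q : J.Glued ⇒ Q
      J⇒Q h = [ coarser succ , [
        (λ (e , f) → P.trans s (coarser succ e) (P.trans s Qpq (coarser succ f))) ,
        (λ (e , f) → P.trans s (coarser succ e) (P.trans s (P.sym s Qpq) (coarser succ f))) ]′ ]′ (J.glued-elim h)

      -- One step of the chain loses exactly one class, and gluing p and q alone already loses one;
      -- nothing else can be merged.
      Q⇒J : Q ⇒ J.Glued
      Q⇒J = ∣classes∣-≡⇒⊇ J.glued-isDecEquivalence (Same-isDec s) J⇒Q
        (ℕ.≤-pred (subst (∣classes∣ J.glued-isDecEquivalence <_) one-fewer
          (∣classes∣-strict (Same-isDec r) J.glued-isDecEquivalence J.∼⇒glued J.glued ¬Ppq)))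

      module G = Merge (isNC r) (isNC s) (S.σ-next r) (S.σ-next s) (L.σ-injective s)
        (coarser succ) ¬Ppq Qpq (λ h → J.glued-elim (Q⇒J h))

    ν-exchange : Σ (Exchange (S.ν r) (S.ν s)) λ e → Exchange.a e ≢ Exchange.b e
    ν-exchange = merge-exchange μ-isNC (S.link r) (S.link s) G.successor-transpose
      (λ e → G.¬Pab (subst (P G.a) e (S.∼ν r G.a)))
      (λ e → G.¬Pab (P.sym r (subst (P G.b) e (S.∼ν r G.b)))) ,
      λ e → G.¬Pab (subst (P G.a) e (P.refl r))

    M-flip : IsFlip (M r) (M s)
    M-flip = exchange⇒isFlip (M r) (M s)
      (exchange-cong (sym ∘ partner-M r) (sym ∘ partner-M s) (proj₁ ν-exchange)) (proj₂ ν-exchange)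

  private
    last-full : ∀ {s} → IsLast s → ∀ x y → Same (parts s) x y
    last-full {s} last x y with block-of (parts s) x | block-of (parts s) y
    ... | B , B∈ , x∈ | C , C∈ , y∈ = B , B∈ , x∈ , subst (y ∈ˢ_) (singleton one C∈ B∈) y∈
      where
      one : length (blocks (parts s)) ≡ 1
      one = trans (P-∣blocks∣ s) (trans (cong (suc k ∸_) (ℕ.suc-injective last)) (ℕ.m+n∸n≡m 1 k))
      singleton : ∀ {Bs : List (Subset (2 * suc k))} {B C} → length Bs ≡ 1 → B ∈ Bs → C ∈ Bs → B ≡ C
      singleton {_ ∷ []} _ (here refl) (here refl) = refl

  M-closed : ∀ {s} → IsLast s → IsRotation -1ℤ (M first) (M s)
  -- The last partition has a single block, whose successor permutation is the rotation.
  M-closed {s} last = conjugate⇒isRotation (M first) (M s) λ x →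
    trans (cong c (partner-M s x)) (trans (c≡σ (S.ν s x)) (trans (L.conjugate s x)
      (trans (sym (M-first _)) (cong (partner (M first)) (sym (c≡σ x))))))
    where
    c≡σ : ∀ x → c x ≡ S.σ s x
    c≡σ x = next-unique (next-cong {_∼_ = Full} {Same (parts s)} (λ _ → last-full last _ _) (λ _ → tt) (c-next x))
      (S.σ-next s x)

  necklace : Necklace (suc k)
  necklace = record
    { matching = M ; noncrossing = M-noncrossing ; flip = M-flip ; closed = M-closed }

  -- The loops of M₁ and σ⁻ μ σ are the blocks of the link by `Connected`, and a class of the
  -- partition is never split by a gap of its own successor permutation.
  recovered : ∀ s → Π₀ (M first) (M s) ≈ᴾ parts s
  recovered s = same⇒≈ᴾ (Π₀ (M first) (M s)) (parts s)
    (meander-fold (P.isEquivalence s)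
      (λ x → subst (Same (parts s) x) (sym (M-first x)) (∼μ s x))
      (λ x → subst (Same (parts s) x) (sym (partner-M s x)) (S.∼ν s x)) ∘ same⇒meander (M first) (M s))
    (meander⇒same (M first) (M s) ∘ meander-cong (sym ∘ M-first) (sym ∘ partner-M s) ∘
      L.Connected.connected s (IsDecEquivalence.isEquivalence (meander-isDecEquivalence μ (S.ν s))) meanderˡ meanderʳ ∘
      S.∼⇒≋ s)

-- The blocks of Π₀(M₁, M₁) are the pairs of M₁, so the first partition forces equal first
-- matchings. Then the links of both necklaces share the same μ and `link-unique` applies at each s.
necklace-partner-injective : {k : ℕ} (𝓝 𝓝′ : Necklace (suc k)) →
  (∀ s → FromNecklace.part 𝓝 s ≈ᴾ FromNecklace.part 𝓝′ s) →
  ∀ s x → FromNecklace.μ 𝓝 s x ≡ FromNecklace.μ 𝓝′ s x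
necklace-partner-injective {k} 𝓝 𝓝′ e s =
  link-unique (A.μ-isNC first) (proj₂ (proj₂ (A.link s))) link′ to from
  where
  module A = FromNecklace 𝓝
  module B = FromNecklace 𝓝′

  same⇒ : ∀ s → Meander (A.μ first) (A.μ s) ⇒ Meander (B.μ first) (B.μ s)
  same⇒ s = same⇒meander (B.matching first) (B.matching s) ∘
    ≈ᴾ⇒same (A.part s) (B.part s) (e s) ∘ meander⇒same (A.matching first) (A.matching s)

  same⇐ : ∀ s → Meander (B.μ first) (B.μ s) ⇒ Meander (A.μ first) (A.μ s)
  same⇐ s = same⇒meander (A.matching first) (A.matching s) ∘
    ≈ᴾ⇒same (B.part s) (A.part s) (Setoid.sym (partitionSetoid (2 * suc k)) {A.part s} {B.part s} (e s)) ∘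
    meander⇒same (B.matching first) (B.matching s)

  first≡ : ∀ x → A.μ first x ≡ B.μ first x
  first≡ x = [ (λ e → contradiction e (partner-fixpoint (A.matching first) x)) , id ]′
    (same⇒partner (B.matching first) {x} {A.μ first x}
      (meander-fold (IsDecEquivalence.isEquivalence (same-isDecEquivalence (partition (B.matching first))))
        (same-partner (B.matching first)) (same-partner (B.matching first)) (same⇒ first (meanderˡ x))))

  link′ : IsLink (A.μ first) (B.μ s) (proj₁ (B.link s)) (proj₁ (proj₂ (B.link s)))
  link′ = link-congˡ (sym ∘ first≡) (proj₂ (proj₂ (B.link s)))

  to : Meander (A.μ first) (A.μ s) ⇒ Meander (A.μ first) (B.μ s)
  to = meander-cong (sym ∘ first≡) (λ _ → refl) ∘ same⇒ s

  from : Meander (A.μ first) (B.μ s) ⇒ Meander (A.μ first) (A.μ s)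
  from = same⇐ s ∘ meander-cong first≡ (λ _ → refl)

necklace↔chain : (k : ℕ) → Bijection (necklaceSetoid (suc k)) (chainSetoid (suc k))
necklace↔chain k = record
  { to        = FromNecklace.chain
  ; cong      = λ {𝓝} {𝓝′} e s → part-cong 𝓝 𝓝′ e s
  ; bijective =
    (λ {𝓝} {𝓝′} e s → partner⇒≈ (Necklace.matching 𝓝 s) (Necklace.matching 𝓝′ s)
      (necklace-partner-injective 𝓝 𝓝′ e s)) ,
    λ 𝓒 → FromChain.necklace 𝓒 , λ {𝓝} e s → Setoid.trans (partitionSetoid (2 * suc k))
      {FromNecklace.part 𝓝 s} {FromNecklace.part (FromChain.necklace 𝓒) s} {MaximalChain.parts 𝓒 s}
      (part-cong 𝓝 (FromChain.necklace 𝓒) e s) (FromChain.recovered 𝓒 s)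
  }
  where
  part-cong : (𝓝 𝓝′ : Necklace (suc k)) → (∀ s → Necklace.matching 𝓝 s ≈ Necklace.matching 𝓝′ s) →
              ∀ s → FromNecklace.part 𝓝 s ≈ᴾ FromNecklace.part 𝓝′ s
  part-cong 𝓝 𝓝′ e s = same⇒≈ᴾ (FromNecklace.part 𝓝 s) (FromNecklace.part 𝓝′ s)
    (transfer 𝓝 𝓝′ e) (transfer 𝓝′ 𝓝 λ s → Setoid.sym (matchingSetoid (suc k)) {Necklace.matching 𝓝 s} {Necklace.matching 𝓝′ s} (e s))
    where
    transfer : (𝓝 𝓝′ : Necklace (suc k)) → (∀ s → Necklace.matching 𝓝 s ≈ Necklace.matching 𝓝′ s) →
               Same (FromNecklace.part 𝓝 s) ⇒ Same (FromNecklace.part 𝓝′ s)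
    transfer 𝓝 𝓝′ e = meander⇒same (B.matching first) (B.matching s) ∘
      meander-cong (≈⇒partner (A.matching first) (B.matching first) (e first)) (≈⇒partner (A.matching s) (B.matching s) (e s)) ∘
      same⇒meander (A.matching first) (A.matching s)
      where
      module A = FromNecklace 𝓝
      module B = FromNecklace 𝓝′

theorem6p10 : (n : ℕ) .{{_ : NonZero n}} →
    (Σ[ φ ∈ Bijection (necklaceSetoid n) (chainSetoid n) ]
       ∀ (𝓝 : Necklace n) s →
         MaximalChain.parts (Bijection.to φ 𝓝) s
           ≈ᴾ Π₀ (Necklace.matching 𝓝 first) (Necklace.matching 𝓝 s))
    × (∀ (𝓝 : Necklace n) → IsStrongNecklace (Necklace.matching 𝓝))
theorem6p10 (suc k) =
  (necklace↔chain k , λ 𝓝 s → Setoid.refl (partitionSetoid (2 * suc k)) {FromNecklace.part 𝓝 s}) ,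
  FromNecklace.isStrong
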